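{- Let $i,j\in[N]$ be such that $i-j\notin\{1,0,-1\}$. Then $E_iA^*E_j=0$.
   Context: Let $\mathbb F_q$ be a finite field with $q$ elements, let $N,M$ be positive integers, let $H$ be a vector space over $\mathbb F_q$ of dimension $N+M$, and fix a subspace $h\subseteq H$ of dimension $M$. Let $X$ be the set of subspaces $y\subseteq H$ with $y\cap h=0$, partially ordered by inclusion (the Attenuated Space poset $\mathcal A_q(N,M)$). For $y,z\in X$, $z$ covers $y$ when $y\subseteq z$ and $\dim z-\dim y=1$; $y,z$ are adjacent when one of them covers the other. Let $\mathrm{Mat}_X(\mathbb C)$ be the algebra of complex matrices with rows and columns indexed by $X$, acting on $V=\mathbb C^X$ by left multiplication. The matrix $A\in\mathrm{Mat}_X(\mathbb C)$ has $(y,z)$-entry $1$ if $y$ covers $z$; $q^{\dim y}$ if $z$ covers $y$; and $0$ if $y,z$ are not adjacent. The matrix $A^*\in\mathrm{Mat}_X(\mathbb C)$ is diagonal with $(y,y)$-entry $q^{ -\dim y}$. Let $[N]=\{i: 2i\in\mathbb Z,\ 0\le i\le N\}=\{0,1/2,1,\ldots,N\}$. The matrix $A$ is diagonalizable with mutually distinct eigenvalues $\theta_i=\frac{q^{N-i}-q^i}{q-1}q^{M/2}$ $(i\in[N])$, where $q^{1/2}>0$. For $i\in[N]$, $E_i\in\mathrm{Mat}_X(\mathbb C)$ is the primitive idempotent of $A$ for $\theta_i$ (the projection acting as the identity on the $\theta_i$-eigenspace and as $0$ on the other eigenspaces). -}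

module Defs where

open import Algebra.Bundles using (CommutativeRing)
open import Algebra.Module.Bundles using (Module)
open import Data.Bool.Base using (if_then_else_)
open import Data.Empty using (⊥-elim)
open import Data.Fin.Base as Fin using (Fin; toℕ)
import Data.Fin.Properties as Fin
open import Data.Integer.Base using (+_)
open import Data.Nat.Base as ℕ using (ℕ; zero; suc; _∸_; NonZero)
import Data.Nat.Properties as ℕ
open import Data.Product.Base using (∃; _×_; _,_)
open import Data.Rational.Base as ℚ using (ℚ; 0ℚ; 1ℚ; ½; ∣_∣)
import Data.Rational.Properties as ℚ
open import Data.Vec.Functional using (Vector)
open import Data.Unit.Base using (⊤)
open import Function.Bundles using (Inverse)
open import Level using (0ℓ) renaming (suc to lsuc)
open import Relation.Binary.Bundles using (Setoid)
open import Relation.Binary.PropositionalEquality as ≡ using (_≡_; _≢_)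
open import Relation.Nullary.Decidable using (Dec; does; map′; _×-dec_)
open import Relation.Nullary.Negation using (¬_)
open import Relation.Unary using (Pred; Decidable; _∈_; _⊆_)

private
  module Identities (R : CommutativeRing 0ℓ 0ℓ) where
    open CommutativeRing R
    open import Algebra.Properties.Ring ring
      using (-1*x≈-x; -‿+-comm; ⁻¹-anti-homo-//; x[y-z]≈xy-xz; [y-z]x≈yx-zx; -0#≈0#)
    open import Algebra.Properties.CommutativeSemigroup +-commutativeSemigroup
      using () renaming (interchange to +-interchange)
    open import Algebra.Solver.Ring.NaturalCoefficients.Default commutativeSemiring
      using (solve; _:=_; _:+_; _:*_)
    open import Relation.Binary.Reasoning.Setoid setoid

    swap : ∀ a b → - (a + - b) ≈ b + - a
    swap = ⁻¹-anti-homo-//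

    restore : ∀ a b → (a + - b) + b ≈ a
    restore a b = begin
      (a + - b) + b  ≈⟨ +-assoc a (- b) b ⟩
      a + (- b + b)  ≈⟨ +-congˡ (-‿inverseˡ b) ⟩
      a + 0#         ≈⟨ +-identityʳ a ⟩
      a              ∎

    telescope : ∀ a b c → (a + - b) + (b + - c) ≈ a + - c
    telescope a b c = begin
      (a + - b) + (b + - c)  ≈⟨ +-assoc (a + - b) b (- c) ⟨
      ((a + - b) + b) + - c  ≈⟨ +-congʳ (restore a b) ⟩
      a + - c                ∎

    interchange : ∀ a b c d → (a + - b) + (c + - d) ≈ (a + c) + - (b + d)
    interchange a b c d = begin
      (a + - b) + (c + - d)    ≈⟨ +-interchange a (- b) c (- d) ⟩
      (a + c) + (- b + - d)    ≈⟨ +-congˡ (-‿+-comm b d) ⟩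
      (a + c) + - (b + d)      ∎

    negate : ∀ a b → b + - a ≈ - a + - (- b)
    negate a b = begin
      b + - a          ≈⟨ swap a b ⟨
      - (a + - b)      ≈⟨ -‿+-comm a (- b) ⟨
      - a + - (- b)    ∎

    product : ∀ a b c d → a * (c + - d) + d * (a + - b) ≈ a * c + - (b * d)
    product a b c d = begin
      a * (c + - d) + d * (a + - b)              ≈⟨ +-congˡ (*-comm d (a + - b)) ⟩
      a * (c + - d) + (a + - b) * d              ≈⟨ +-cong (x[y-z]≈xy-xz a c d) ([y-z]x≈yx-zx d a b) ⟩
      (a * c + - (a * d)) + (a * d + - (b * d))  ≈⟨ telescope (a * c) (a * d) (b * d) ⟩
      a * c + - (b * d)                          ∎

    ≈-1* : ∀ x → - x ≈ - 1# * x
    ≈-1* x = sym (-1*x≈-x x)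

    assoc-re : ∀ a b c d e f →
      (a * c + - (b * d)) * e + - ((a * d + b * c) * f) ≈
      a * (c * e + - (d * f)) + - (b * (c * f + d * e))
    assoc-re a b c d e f = begin
      (a * c + - (b * d)) * e + - ((a * d + b * c) * f)
        ≈⟨ +-cong (*-congʳ (+-congˡ (≈-1* _))) (≈-1* _) ⟩
      (a * c + - 1# * (b * d)) * e + - 1# * ((a * d + b * c) * f)
        ≈⟨ solve 7 (λ a b c d e f m →
             (a :* c :+ m :* (b :* d)) :* e :+ m :* ((a :* d :+ b :* c) :* f) :=
             a :* (c :* e :+ m :* (d :* f)) :+ m :* (b :* (c :* f :+ d :* e)))
             refl a b c d e f (- 1#) ⟩
      a * (c * e + - 1# * (d * f)) + - 1# * (b * (c * f + d * e))
        ≈⟨ +-cong (*-congˡ (+-congˡ (-1*x≈-x _))) (-1*x≈-x _) ⟩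
      a * (c * e + - (d * f)) + - (b * (c * f + d * e)) ∎

    assoc-im : ∀ a b c d e f →
      (a * c + - (b * d)) * f + (a * d + b * c) * e ≈
      a * (c * f + d * e) + b * (c * e + - (d * f))
    assoc-im a b c d e f = begin
      (a * c + - (b * d)) * f + (a * d + b * c) * e
        ≈⟨ +-congʳ (*-congʳ (+-congˡ (≈-1* _))) ⟩
      (a * c + - 1# * (b * d)) * f + (a * d + b * c) * e
        ≈⟨ solve 7 (λ a b c d e f m →
             (a :* c :+ m :* (b :* d)) :* f :+ (a :* d :+ b :* c) :* e :=
             a :* (c :* f :+ d :* e) :+ b :* (c :* e :+ m :* (d :* f)))
             refl a b c d e f (- 1#) ⟩
      a * (c * f + d * e) + b * (c * e + - 1# * (d * f))
        ≈⟨ +-congˡ (*-congˡ (+-congˡ (-1*x≈-x _))) ⟩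
      a * (c * f + d * e) + b * (c * e + - (d * f)) ∎

    distrib-re : ∀ a b c d e f →
      a * (c + e) + - (b * (d + f)) ≈ (a * c + - (b * d)) + (a * e + - (b * f))
    distrib-re a b c d e f = begin
      a * (c + e) + - (b * (d + f))
        ≈⟨ +-cong (distribˡ a c e) (-‿cong (distribˡ b d f)) ⟩
      (a * c + a * e) + - (b * d + b * f)
        ≈⟨ interchange (a * c) (b * d) (a * e) (b * f) ⟨
      (a * c + - (b * d)) + (a * e + - (b * f)) ∎

    distrib-im : ∀ a b c d e f →
      a * (d + f) + b * (c + e) ≈ (a * d + b * c) + (a * f + b * e)
    distrib-im = solve 6 (λ a b c d e f →
      a :* (d :+ f) :+ b :* (c :+ e) :=
      (a :* d :+ b :* c) :+ (a :* f :+ b :* e)) refl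

    comm-re : ∀ a b c d → a * c + - (b * d) ≈ c * a + - (d * b)
    comm-re a b c d = +-cong (*-comm a c) (-‿cong (*-comm b d))

    comm-im : ∀ a b c d → a * d + b * c ≈ c * b + d * a
    comm-im a b c d = trans (+-comm _ _) (+-cong (*-comm b c) (*-comm a d))

    identity-re : ∀ a b → 1# * a + - (0# * b) ≈ a
    identity-re a b = trans
      (+-cong (*-identityˡ a) (trans (-‿cong (zeroˡ b)) -0#≈0#)) (+-identityʳ a)

    identity-im : ∀ a b → 1# * b + 0# * a ≈ b
    identity-im a b = trans (+-cong (*-identityˡ b) (zeroˡ a)) (+-identityʳ b)

------------------------------------------------------------------------
-- Real numbers: Cauchy sequences of rationals

infix 4 _~_

-- xₘ - yₙ → 0 as m and n tend to infinity independently.  Hence x ~ x says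
-- that x is a Cauchy sequence, and for Cauchy sequences x ~ y says that
-- xₙ - yₙ → 0.
record _~_ (x y : ℕ → ℚ) : Set where
  constructor lim
  field
    unlim : ∀ ε → 0ℚ ℚ.< ε →
            ∃ λ k → ∀ m n → k ℕ.≤ m → k ℕ.≤ n → ∣ x m ℚ.- y n ∣ ℚ.< ε

open _~_

record ℝ : Set where
  constructor _,_
  field
    seq    : ℕ → ℚ
    cauchy : seq ~ seq

open ℝ

infix 4 _≈ℝ_

record _≈ℝ_ (x y : ℝ) : Set where
  constructor mk≈
  field
    un≈ : seq x ~ seq y

open _≈ℝ_

private
  module I = Identities ℚ.+-*-commutativeRing

  swap : ∀ p r → ∣ p ℚ.- r ∣ ≡ ∣ r ℚ.- p ∣
  swap p r = ≡.trans (≡.sym (ℚ.∣-p∣≡∣p∣ (p ℚ.- r))) (≡.cong ∣_∣ (I.swap p r))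

  half-pos : ∀ {ε} → 0ℚ ℚ.< ε → 0ℚ ℚ.< ½ ℚ.* ε
  half-pos {ε} 0<ε = ≡.subst (ℚ._< ½ ℚ.* ε) (ℚ.*-zeroʳ ½) (ℚ.*-monoʳ-<-pos ½ 0<ε)

  half+half : ∀ ε → ½ ℚ.* ε ℚ.+ ½ ℚ.* ε ≡ ε
  half+half ε = ≡.trans (≡.sym (ℚ.*-distribʳ-+ ε ½ ½)) (ℚ.*-identityˡ ε)

  add : ∀ {ε} a b → ∣ a ∣ ℚ.< ½ ℚ.* ε → ∣ b ∣ ℚ.< ½ ℚ.* ε → ∣ a ℚ.+ b ∣ ℚ.< ε
  add {ε} a b a< b< = ≡.subst (∣ a ℚ.+ b ∣ ℚ.<_) (half+half ε)
    (ℚ.≤-<-trans (ℚ.∣p+q∣≤∣p∣+∣q∣ a b) (ℚ.+-mono-< a< b<))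

  sym~ : ∀ {x y} → x ~ y → y ~ x
  sym~ {x} {y} p .unlim ε 0<ε with unlim p ε 0<ε
  ... | k , f = k , λ m n k≤m k≤n →
    ≡.subst (ℚ._< ε) (swap (x n) (y m)) (f n m k≤n k≤m)

  trans~ : ∀ {x y z} → x ~ y → y ~ z → x ~ z
  trans~ {x} {y} {z} p r .unlim ε 0<ε with unlim p (½ ℚ.* ε) (half-pos 0<ε) | unlim r (½ ℚ.* ε) (half-pos 0<ε)
  ... | k , f | l , g = k ℕ.⊔ l , λ m n k≤m k≤n →
    ≡.subst (λ a → ∣ a ∣ ℚ.< ε)
      (I.telescope (x m) (y m) (z n))
      (add _ _
        (f m m (ℕ.m⊔n≤o⇒m≤o k l k≤m) (ℕ.m⊔n≤o⇒m≤o k l k≤m))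
        (g m n (ℕ.m⊔n≤o⇒n≤o k l k≤m) (ℕ.m⊔n≤o⇒n≤o k l k≤n)))

  +~ : ∀ {x x′ y y′} → x ~ x′ → y ~ y′ → (λ n → x n ℚ.+ y n) ~ (λ n → x′ n ℚ.+ y′ n)
  +~ {x} {x′} {y} {y′} p r .unlim ε 0<ε with unlim p (½ ℚ.* ε) (half-pos 0<ε) | unlim r (½ ℚ.* ε) (half-pos 0<ε)
  ... | k , f | l , g = k ℕ.⊔ l , λ m n k≤m k≤n →
    ≡.subst (λ a → ∣ a ∣ ℚ.< ε)
      (I.interchange (x m) (x′ n) (y m) (y′ n))
      (add _ _
        (f m n (ℕ.m⊔n≤o⇒m≤o k l k≤m) (ℕ.m⊔n≤o⇒m≤o k l k≤n))
        (g m n (ℕ.m⊔n≤o⇒n≤o k l k≤m) (ℕ.m⊔n≤o⇒n≤o k l k≤n)))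

  neg~ : ∀ {x y} → x ~ y → (λ n → ℚ.- x n) ~ (λ n → ℚ.- y n)
  neg~ {x} {y} p .unlim ε 0<ε with unlim p ε 0<ε
  ... | k , f = k , λ m n k≤m k≤n →
    ≡.subst (ℚ._< ε)
      (≡.trans (swap (x m) (y n)) (≡.cong ∣_∣
        (I.negate (x m) (y n))))
      (f m n k≤m k≤n)

  pt : ∀ {x x′ y y′} → (∀ n → x n ≡ x′ n) → (∀ n → y n ≡ y′ n) → x ~ y → x′ ~ y′
  pt e e′ p .unlim ε 0<ε with unlim p ε 0<ε
  ... | k , f = k , λ m n k≤m k≤n →
    ≡.subst₂ (λ a b → ∣ a ℚ.- b ∣ ℚ.< ε) (e m) (e′ n) (f m n k≤m k≤n)

  Bounded : (ℕ → ℚ) → Set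
  Bounded x = ∃ λ B → 0ℚ ℚ.< B × ∃ λ k → ∀ n → k ℕ.≤ n → ∣ x n ∣ ℚ.< B

  bound : ∀ c a → 0ℚ ℚ.< c → 0ℚ ℚ.< c ℚ.+ ∣ a ∣
  bound c a 0<c = ≡.subst (ℚ._< c ℚ.+ ∣ a ∣) (ℚ.+-identityʳ 0ℚ)
    (ℚ.+-mono-<-≤ {0ℚ} {c} {0ℚ} {∣ a ∣} 0<c (ℚ.0≤∣p∣ a))

  shift : ∀ c a b → ∣ a ℚ.- b ∣ ℚ.< c → ∣ a ∣ ℚ.< c ℚ.+ ∣ b ∣
  shift c a b a-b<c = ≡.subst (λ p → ∣ p ∣ ℚ.< c ℚ.+ ∣ b ∣) (I.restore a b)
    (ℚ.≤-<-trans (ℚ.∣p+q∣≤∣p∣+∣q∣ (a ℚ.- b) b) (ℚ.+-monoˡ-< ∣ b ∣ a-b<c))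

  bounded′ : ∀ {x} c → 0ℚ ℚ.< c → x ~ x → Bounded x
  bounded′ {x} c 0<c p with unlim p c 0<c
  ... | k , f = c ℚ.+ ∣ x k ∣ , bound c (x k) 0<c , k , λ n k≤n →
    shift c (x n) (x k) (f n k k≤n ℕ.≤-refl)

  bounded : ∀ {x} → x ~ x → Bounded x
  bounded = bounded′ 1ℚ (ℚ.positive⁻¹ 1ℚ)

  left-bounded : ∀ {x y} → x ~ y → Bounded x
  left-bounded p = bounded (trans~ p (sym~ p))

  scale : ∀ {B ε} → 0ℚ ℚ.< B → 0ℚ ℚ.< ε → ∃ λ δ → 0ℚ ℚ.< δ × B ℚ.* δ ≡ ε
  scale {B} {ε} 0<B 0<ε = δ , 0<δ , eq
    where
    instance
      B⁺ = ℚ.positive 0<B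
      B≢0 = ℚ.pos⇒nonZero B
      i⁺ = ℚ.1/pos⇒pos B
    δ = (ℚ.1/ B) ℚ.* ε
    0<δ = ≡.subst (ℚ._< δ) (ℚ.*-zeroʳ (ℚ.1/ B)) (ℚ.*-monoʳ-<-pos (ℚ.1/ B) 0<ε)
    eq = ≡.trans (≡.sym (ℚ.*-assoc B (ℚ.1/ B) ε))
          (≡.trans (≡.cong (ℚ._* ε) (ℚ.*-inverseʳ B)) (ℚ.*-identityˡ ε))

  mul : ∀ {B δ ε} a b → 0ℚ ℚ.< B → B ℚ.* δ ≡ ε → ∣ a ∣ ℚ.< B → ∣ b ∣ ℚ.< δ → ∣ a ℚ.* b ∣ ℚ.< ε
  mul {B} {δ} {ε} a b 0<B e a<B b<δ =
    ≡.subst₂ ℚ._<_ (≡.sym (ℚ.∣p*q∣≡∣p∣*∣q∣ a b)) e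
      (ℚ.≤-<-trans {∣ a ∣ ℚ.* ∣ b ∣} {B ℚ.* ∣ b ∣} {B ℚ.* δ}
        (ℚ.*-monoʳ-≤-nonNeg ∣ b ∣ {{ℚ.∣-∣-nonNeg b}} {∣ a ∣} {B} (ℚ.<⇒≤ a<B))
        (ℚ.*-monoʳ-<-pos B {{ℚ.positive 0<B}} {∣ b ∣} {δ} b<δ))

  mul+mul : ∀ {B β C γ ε} a b c d →
            0ℚ ℚ.< B → B ℚ.* β ≡ ½ ℚ.* ε → 0ℚ ℚ.< C → C ℚ.* γ ≡ ½ ℚ.* ε →
            ∣ a ∣ ℚ.< B → ∣ c ℚ.- d ∣ ℚ.< β → ∣ d ∣ ℚ.< C → ∣ a ℚ.- b ∣ ℚ.< γ →
            ∣ a ℚ.* c ℚ.- b ℚ.* d ∣ ℚ.< ε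
  mul+mul {B} {β} {C} {γ} {ε} a b c d 0<B eβ 0<C eγ a< c-d< d< a-b< =
    ≡.subst (λ p → ∣ p ∣ ℚ.< ε) (I.product a b c d)
      (add (a ℚ.* (c ℚ.- d)) (d ℚ.* (a ℚ.- b))
        (mul a (c ℚ.- d) 0<B eβ a< c-d<)
        (mul d (a ℚ.- b) 0<C eγ d< a-b<))

  *~ : ∀ {x x′ y y′} → x ~ x′ → y ~ y′ → (λ n → x n ℚ.* y n) ~ (λ n → x′ n ℚ.* y′ n)
  *~ {x} {x′} {y} {y′} p r .unlim ε 0<ε =
    let B , 0<B , k , f = left-bounded p
        C , 0<C , l , g = left-bounded (sym~ r)
        β , 0<β , eβ = scale 0<B (half-pos 0<ε)
        γ , 0<γ , eγ = scale 0<C (half-pos 0<ε)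
        k′ , f′ = unlim p γ 0<γ
        l′ , g′ = unlim r β 0<β
        N₁ = k ℕ.⊔ l
        N₂ = k′ ℕ.⊔ l′
    in N₁ ℕ.⊔ N₂ , λ m n N≤m N≤n →
      mul+mul {B} {β} {C} {γ} {ε} (x m) (x′ n) (y m) (y′ n) 0<B eβ 0<C eγ
        (f m (ℕ.m⊔n≤o⇒m≤o k l (ℕ.m⊔n≤o⇒m≤o N₁ N₂ N≤m)))
        (g′ m n (ℕ.m⊔n≤o⇒n≤o k′ l′ (ℕ.m⊔n≤o⇒n≤o N₁ N₂ N≤m))
                (ℕ.m⊔n≤o⇒n≤o k′ l′ (ℕ.m⊔n≤o⇒n≤o N₁ N₂ N≤n)))
        (g n (ℕ.m⊔n≤o⇒n≤o k l (ℕ.m⊔n≤o⇒m≤o N₁ N₂ N≤n)))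
        (f′ m n (ℕ.m⊔n≤o⇒m≤o k′ l′ (ℕ.m⊔n≤o⇒n≤o N₁ N₂ N≤m))
                (ℕ.m⊔n≤o⇒m≤o k′ l′ (ℕ.m⊔n≤o⇒n≤o N₁ N₂ N≤n)))

  const~ : ∀ p → (λ _ → p) ~ (λ _ → p)
  const~ p .unlim ε 0<ε = 0 , λ _ _ _ _ →
    ≡.subst (λ a → ∣ a ∣ ℚ.< ε) (≡.sym (ℚ.+-inverseʳ p)) 0<ε

fromℚ : ℚ → ℝ
fromℚ p = (λ _ → p) , const~ p

infixl 6 _+ℝ_
infixl 7 _*ℝ_
infix  8 -ℝ_

_+ℝ_ _*ℝ_ : ℝ → ℝ → ℝ
x +ℝ y = (λ n → seq x n ℚ.+ seq y n) , +~ (cauchy x) (cauchy y)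
x *ℝ y = (λ n → seq x n ℚ.* seq y n) , *~ (cauchy x) (cauchy y)

-ℝ_ : ℝ → ℝ
-ℝ x = (λ n → ℚ.- seq x n) , neg~ (cauchy x)

-- Eventually bounded below by a positive rational.
Positive : ℝ → Set
Positive x = ∃ λ ε → 0ℚ ℚ.< ε × ∃ λ k → ∀ n → k ℕ.≤ n → ε ℚ.≤ seq x n

private

  pointwise : ∀ {x y} → (∀ n → seq x n ≡ seq y n) → x ≈ℝ y
  pointwise {x} e = mk≈ (pt (λ _ → ≡.refl) e (cauchy x))

ℝ-commutativeRing : CommutativeRing 0ℓ 0ℓ
ℝ-commutativeRing = record
  { Carrier = ℝ ; _≈_ = _≈ℝ_ ; _+_ = _+ℝ_ ; _*_ = _*ℝ_ ; -_ = -ℝ_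
  ; 0# = fromℚ 0ℚ ; 1# = fromℚ 1ℚ
  ; isCommutativeRing = record
    { isRing = record
      { +-isAbelianGroup = record
        { isGroup = record
          { isMonoid = record
            { isSemigroup = record
              { isMagma = record
                { isEquivalence = record
                  { refl  = λ {x} → mk≈ (cauchy x)
                  ; sym   = λ p → mk≈ (sym~ (un≈ p))
                  ; trans = λ p r → mk≈ (trans~ (un≈ p) (un≈ r))
                  }
                ; ∙-cong = λ p r → mk≈ (+~ (un≈ p) (un≈ r))
                }
              ; assoc = λ x y z → pointwise λ n → ℚ.+-assoc (seq x n) (seq y n) (seq z n)
              }
            ; identity = (λ x → pointwise λ n → ℚ.+-identityˡ (seq x n))
                       , (λ x → pointwise λ n → ℚ.+-identityʳ (seq x n))
            }
          ; inverse = (λ x → pointwise λ n → ℚ.+-inverseˡ (seq x n))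
                    , (λ x → pointwise λ n → ℚ.+-inverseʳ (seq x n))
          ; ⁻¹-cong = λ p → mk≈ (neg~ (un≈ p))
          }
        ; comm = λ x y → pointwise λ n → ℚ.+-comm (seq x n) (seq y n)
        }
      ; *-cong = λ p r → mk≈ (*~ (un≈ p) (un≈ r))
      ; *-assoc = λ x y z → pointwise λ n → ℚ.*-assoc (seq x n) (seq y n) (seq z n)
      ; *-identity = (λ x → pointwise λ n → ℚ.*-identityˡ (seq x n))
                   , (λ x → pointwise λ n → ℚ.*-identityʳ (seq x n))
      ; distrib = (λ x y z → pointwise λ n → ℚ.*-distribˡ-+ (seq x n) (seq y n) (seq z n))
                , (λ x y z → pointwise λ n → ℚ.*-distribʳ-+ (seq x n) (seq y n) (seq z n))
      }
    ; *-comm = λ x y → pointwise λ n → ℚ.*-comm (seq x n) (seq y n)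
    }
  }

------------------------------------------------------------------------
-- Complex numbers: the ring R[i], for R = ℝ

module AdjoinI (R : CommutativeRing 0ℓ 0ℓ) where

  private
    module R = CommutativeRing R
    module J = Identities R

  infix 4 _≈_

  record Complex : Set where
    constructor _+i_
    field
      re im : R.Carrier

  open Complex

  record _≈_ (w z : Complex) : Set where
    constructor _+i_
    field
      re≈ : re w R.≈ re z
      im≈ : im w R.≈ im z

  open _≈_

  real : R.Carrier → Complex
  real x = x +i R.0#

  infixl 6 _+_
  infixl 7 _*_
  infix  8 -_

  _+_ _*_ : Complex → Complex → Complex
  (a +i b) + (c +i d) = (a R.+ c) +i (b R.+ d)
  (a +i b) * (c +i d) = (a R.* c R.+ R.- (b R.* d)) +i (a R.* d R.+ b R.* c)

  -_ : Complex → Complex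
  - (a +i b) = (R.- a) +i (R.- b)

  private

    *-identityˡ : ∀ z → real R.1# * z ≈ z
    *-identityˡ (a +i b) = J.identity-re a b +i J.identity-im a b

    *-comm : ∀ w z → w * z ≈ z * w
    *-comm (a +i b) (c +i d) = J.comm-re a b c d +i J.comm-im a b c d

    *-assoc : ∀ u w z → (u * w) * z ≈ u * (w * z)
    *-assoc (a +i b) (c +i d) (e +i f) = J.assoc-re a b c d e f +i J.assoc-im a b c d e f

    *-distribˡ : ∀ u w z → u * (w + z) ≈ u * w + u * z
    *-distribˡ (a +i b) (c +i d) (e +i f) = J.distrib-re a b c d e f +i J.distrib-im a b c d e f

    trans : ∀ {u w z} → u ≈ w → w ≈ z → u ≈ z
    trans (p +i q) (r +i s) = R.trans p r +i R.trans q s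

    +-cong : ∀ {u w u′ w′} → u ≈ u′ → w ≈ w′ → u + w ≈ u′ + w′
    +-cong (p +i q) (r +i s) = R.+-cong p r +i R.+-cong q s

    *-cong : ∀ {u w u′ w′} → u ≈ u′ → w ≈ w′ → u * w ≈ u′ * w′
    *-cong (p +i q) (r +i s) =
         R.+-cong (R.*-cong p r) (R.-‿cong (R.*-cong q s))
      +i R.+-cong (R.*-cong p s) (R.*-cong q r)

  commutativeRing : CommutativeRing 0ℓ 0ℓ
  commutativeRing = record
    { Carrier = Complex ; _≈_ = _≈_ ; _+_ = _+_ ; _*_ = _*_ ; -_ = -_
    ; 0# = real R.0# ; 1# = real R.1#
    ; isCommutativeRing = record
      { isRing = record
        { +-isAbelianGroup = record
          { isGroup = record
            { isMonoid = record
              { isSemigroup = record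
                { isMagma = record
                  { isEquivalence = record
                    { refl  = R.refl +i R.refl
                    ; sym   = λ (p +i q) → R.sym p +i R.sym q
                    ; trans = trans
                    }
                  ; ∙-cong = +-cong
                  }
                ; assoc = λ u w z → R.+-assoc (re u) (re w) (re z) +i R.+-assoc (im u) (im w) (im z)
                }
              ; identity = (λ z → R.+-identityˡ (re z) +i R.+-identityˡ (im z))
                         , (λ z → R.+-identityʳ (re z) +i R.+-identityʳ (im z))
              }
            ; inverse = (λ z → R.-‿inverseˡ (re z) +i R.-‿inverseˡ (im z))
                      , (λ z → R.-‿inverseʳ (re z) +i R.-‿inverseʳ (im z))
            ; ⁻¹-cong = λ (p +i q) → R.-‿cong p +i R.-‿cong q
            }
          ; comm = λ w z → R.+-comm (re w) (re z) +i R.+-comm (im w) (im z)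
          }
        ; *-cong = *-cong
        ; *-assoc = *-assoc
        ; *-identity = *-identityˡ
                     , (λ z → trans (*-comm z _) (*-identityˡ z))
        ; distrib = *-distribˡ
                  , (λ u w z → trans (*-comm (w + z) u)
                      (trans (*-distribˡ u w z) (+-cong (*-comm u w) (*-comm u z))))
        }
      ; *-comm = *-comm
      }
    }

module ℂ = CommutativeRing (AdjoinI.commutativeRing ℝ-commutativeRing)

ℂ : Set
ℂ = ℂ.Carrier

fromℝ : ℝ → ℂ
fromℝ = AdjoinI.real ℝ-commutativeRing

------------------------------------------------------------------------
-- Complex matrices

module _ where
  open import Algebra.Properties.CommutativeMonoid.Sum ℂ.+-commutativeMonoid using (sum)

  infixl 7 _·_
  infixl 7 _·ᵥ_
  infix  4 _≋_ _≋ᵥ_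

  Matrix : ℕ → Set
  Matrix n = Fin n → Fin n → ℂ

  _≋_ : ∀ {n} → Matrix n → Matrix n → Set
  A ≋ B = ∀ y z → A y z ℂ.≈ B y z

  _≋ᵥ_ : ∀ {n} → Vector ℂ n → Vector ℂ n → Set
  v ≋ᵥ w = ∀ y → v y ℂ.≈ w y

  0ₘ : ∀ {n} → Matrix n
  0ₘ _ _ = ℂ.0#

  0ᵥ : ∀ {n} → Vector ℂ n
  0ᵥ _ = ℂ.0#

  _·_ : ∀ {n} → Matrix n → Matrix n → Matrix n
  (A · B) x z = sum λ y → A x y ℂ.* B y z

  _·ᵥ_ : ∀ {n} → Matrix n → Vector ℂ n → Vector ℂ n
  (A ·ᵥ v) x = sum λ y → A x y ℂ.* v y

  Eigenspace : ∀ {n} → Matrix n → ℂ → Pred (Vector ℂ n) 0ℓ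
  Eigenspace A θ v = A ·ᵥ v ≋ᵥ λ y → θ ℂ.* v y

  -- The sum of the eigenspaces for θ k with k ≢ i; the summand w i is zero.
  OtherEigenspaces : ∀ {n m} → Matrix n → (Fin m → ℂ) → Fin m → Pred (Vector ℂ n) 0ℓ
  OtherEigenspaces {n} {m} A θ i v =
    ∃ λ (w : Fin m → Vector ℂ n) →
      (∀ k → w k ∈ Eigenspace A (θ k)) ×
      w i ≋ᵥ 0ᵥ ×
      v ≋ᵥ λ y → sum λ k → w k y

  record IsProjection {n} (range kernel : Pred (Vector ℂ n) 0ℓ) (E : Matrix n) : Set where
    field
      into        : ∀ v → E ·ᵥ v ∈ range
      identity    : ∀ v → v ∈ range → E ·ᵥ v ≋ᵥ v
      annihilates : ∀ v → v ∈ kernel → E ·ᵥ v ≋ᵥ 0ᵥ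
      kernel⊆     : ∀ v → E ·ᵥ v ≋ᵥ 0ᵥ → v ∈ kernel

  -- E is the projection onto the eigenspace for θ i along the sum of the other
  -- eigenspaces.  As v = E v + (v - E v), such a projection exists only if the
  -- eigenspaces for the θ k together span, i.e. if A is diagonalizable.
  IsPrimitiveIdempotent : ∀ {n m} → Matrix n → (Fin m → ℂ) → Fin m → Matrix n → Set
  IsPrimitiveIdempotent A θ i E =
    IsProjection (Eigenspace A (θ i)) (OtherEigenspaces A θ i) E

------------------------------------------------------------------------
-- Finite fields and vector spaces

Enumeration : ∀ {a ℓ} → Setoid a ℓ → ℕ → Set _
Enumeration S n = Inverse S (≡.setoid (Fin n))

record FiniteField (q : ℕ) : Set₁ where
  field
    commutativeRing : CommutativeRing 0ℓ 0ℓ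

  open CommutativeRing commutativeRing public

  field
    1≉0         : ¬ 1# ≈ 0#
    inverse     : ∀ x → ¬ x ≈ 0# → ∃ λ y → x * y ≈ 1#
    enumeration : Enumeration setoid q

module _ {q} (F : FiniteField q) where
  open FiniteField F

  1<q : 1 ℕ.< q
  1<q = go enumeration
    where
    go : ∀ {n} → Enumeration setoid n → 1 ℕ.< n
    go {0} e with Inverse.to e 0#
    ... | ()
    go {1} e with Inverse.to e 1# in p | Inverse.to e 0# in r
    ... | Fin.zero | Fin.zero = ⊥-elim (1≉0
      (trans (sym (Inverse.inverseʳ e (≡.sym p))) (Inverse.inverseʳ e (≡.sym r))))
    go {suc (suc _)} _ = ℕ.s<s ℕ.z<s

  q≢0 : NonZero q
  q≢0 = ℕ.>-nonZero (ℕ.<⇒≤ 1<q)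

  q-1≢0 : NonZero (q ∸ 1)
  q-1≢0 = ℕ.>-nonZero (ℕ.m<n⇒0<n∸m 1<q)

  VectorSpace : Set₁
  VectorSpace = Module commutativeRing 0ℓ 0ℓ

  module Subspaces (H : VectorSpace) where
    open Module H
    open import Algebra.Properties.CommutativeMonoid.Sum +ᴹ-commutativeMonoid using (sum)

    combination : ∀ {d} → Vector Carrier d → Vector Carrierᴹ d → Carrierᴹ
    combination c b = sum λ k → c k *ₗ b k

    record IsBasis (U : Pred Carrierᴹ 0ℓ) {d} (b : Vector Carrierᴹ d) : Set where
      field
        member      : ∀ k → b k ∈ U
        spanning    : ∀ {v} → v ∈ U → ∃ λ c → combination c b ≈ᴹ v
        independent : ∀ c → combination c b ≈ᴹ 0ᴹ → ∀ k → c k ≈ 0#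

    HasDimension : ℕ → Set
    HasDimension d = ∃ λ (b : Vector Carrierᴹ d) → IsBasis (λ _ → ⊤) b

    -- H is finite, so classically every subspace has decidable membership and
    -- a finite basis; constructively both are part of the data.
    record Subspace : Set₁ where
      field
        Member    : Pred Carrierᴹ 0ℓ
        member?   : Decidable Member
        resp      : ∀ {u v} → u ≈ᴹ v → u ∈ Member → v ∈ Member
        0-closed  : 0ᴹ ∈ Member
        +-closed  : ∀ {u v} → u ∈ Member → v ∈ Member → u +ᴹ v ∈ Member
        *-closed  : ∀ a {v} → v ∈ Member → a *ₗ v ∈ Member
        dim       : ℕ
        basis     : Vector Carrierᴹ dim
        isBasis   : IsBasis Member basis

      open IsBasis isBasis public

      combination-closed : ∀ {d} c (b : Vector Carrierᴹ d) → (∀ k → b k ∈ Member) →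
                           combination c b ∈ Member
      combination-closed {zero}  c b b∈ = 0-closed
      combination-closed {suc d} c b b∈ =
        +-closed (*-closed (c Fin.zero) (b∈ Fin.zero))
          (combination-closed (λ k → c (Fin.suc k)) (λ k → b (Fin.suc k)) (λ k → b∈ (Fin.suc k)))

    open Subspace using (Member; dim)

    module _ (h : Subspace) where

      -- An element of the Attenuated Space poset.
      record Point : Set₁ where
        field
          space  : Subspace
          y∩h≈0  : ∀ {v} → v ∈ Member space → v ∈ Member h → v ≈ᴹ 0ᴹ

      open Point

      infix 4 _≤ₓ_ _≤ₓ?_

      _≤ₓ_ : Point → Point → Set
      y ≤ₓ z = Member (space y) ⊆ Member (space z)

      pointSetoid : Setoid (lsuc 0ℓ) 0ℓ
      pointSetoid = record
        { Carrier = Point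
        ; _≈_ = λ y z → y ≤ₓ z × z ≤ₓ y
        ; isEquivalence = record
          { refl  = (λ v∈ → v∈) , (λ v∈ → v∈)
          ; sym   = λ (p , r) → r , p
          ; trans = λ (p , p′) (r , r′) → (λ v∈ → r (p v∈)) , (λ v∈ → p′ (r′ v∈))
          }
        }

      _≤ₓ?_ : ∀ y z → Dec (y ≤ₓ z)
      y ≤ₓ? z = map′
        (λ b∈z v∈y → let c , c·b≈v = Y.spanning v∈y in
          Z.resp c·b≈v (Z.combination-closed c Y.basis b∈z))
        (λ y⊆z k → y⊆z (Y.member k))
        (Fin.all? λ k → Z.member? (Y.basis k))
        where
        module Y = Subspace (space y)
        module Z = Subspace (space z)

      dimₓ : Point → ℕ
      dimₓ y = dim (space y)

      infix 4 _covers_ _covers?_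

      _covers_ : Point → Point → Set
      z covers y = y ≤ₓ z × dimₓ z ≡ suc (dimₓ y)

      _covers?_ : ∀ z y → Dec (z covers y)
      z covers? y = (y ≤ₓ? z) ×-dec (dimₓ z ℕ.≟ suc (dimₓ y))

      module _ {n} (X : Enumeration pointSetoid n) where

        point : Fin n → Point
        point = Inverse.from X

        A : Matrix n
        A y z =
          if does (point y covers? point z) then ℂ.1#
          else if does (point z covers? point y) then
            fromℝ (fromℚ (+ (q ℕ.^ dimₓ (point y)) ℚ./ 1))
          else ℂ.0#

        A* : Matrix n
        A* y z =
          if does (y Fin.≟ z) then
            fromℝ (fromℚ ((+ 1 ℚ./ (q ℕ.^ d)) {{ℕ.m^n≢0 q d {{q≢0}}}}))
          else ℂ.0#
          where d = dimₓ (point y)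

------------------------------------------------------------------------
-- Eigenvalues

-- {0, 1/2, 1, ..., N}, represented by the doubled indices 0, 1, ..., 2N.
HalfIntegers : ℕ → Set
HalfIntegers N = Fin (suc (2 ℕ.* N))

value : ∀ {N} → HalfIntegers N → ℚ
value k = + toℕ k ℚ./ 2

module _ {q} (F : FiniteField q) (√q : ℝ) (N M : ℕ) where

  open import Algebra.Properties.Semiring.Exp (CommutativeRing.semiring ℝ-commutativeRing)
    using (_^_)

  -- With i = k / 2: q^i = √q^k, q^(N-i) = √q^(2N-k) and q^(M/2) = √q^M.
  θ : HalfIntegers N → ℂ
  θ k = fromℝ
    (fromℚ ((+ 1 ℚ./ (q ∸ 1)) {{q-1≢0 F}})
      *ℝ (√q ^ (2 ℕ.* N ∸ toℕ k) +ℝ -ℝ (√q ^ toℕ k))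
      *ℝ √q ^ M)

-- A* scales y by q ^ (- dim y), so with A₊ and A₋ the parts of A that raise and lower the
-- dimension, A* A₊ = q⁻¹ A₊ A* and A* A₋ = q A₋ A*.  Therefore the (x, y)-entry of the commutator of
-- A with q² (A² A* + A* A²) - q (q² + 1) A A* A - q ^ (N + M) (q + 1)² A* is a weighted number of
-- paths x ← z ← w ← y, and it is zero for trivial reasons unless dim x - dim y = ± 1.  In the
-- remaining cases it vanishes because of a linear relation between the numbers of paths of the
-- types up-up-down, up-down-up and down-up-up, which is found by counting vectors.
--
-- Multiplied by E i on the left and E j on the right, the commutator becomes the scalar
-- (θ i - θ j) (q² (θ i)² - q (q² + 1) (θ i) (θ j) + q² (θ j)² - q ^ (N + M) (q + 1)²)
-- times E i A* E j.  The second factor is q² (θ j - θ (i + 1)) (θ j - θ (i - 1)), so the scalar is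
-- nonzero for i - j ∉ {1, 0, -1}.

module Submission where

open import Algebra.Bundles using (CommutativeMonoid; CommutativeRing; RawRing)
open import Algebra.Module.Bundles using (Module)
open import Algebra.Solver.Ring.AlmostCommutativeRing using (_-Raw-AlmostCommutative⟶_; fromCommutativeRing)
open import Data.Bool.Base using (Bool; true; false; if_then_else_)
open import Data.Empty using (⊥-elim)
open import Data.Fin.Base as Fin using (Fin; zero; suc; toℕ; finToFun; funToFin)
import Data.Fin.Properties as Fin
open import Data.Integer.Base as ℤ using (+_)
import Data.Integer.Properties as ℤ
open import Data.List.Base using (_∷_; [])
open import Data.List.Membership.Propositional using (_∉_)
open import Data.List.Relation.Unary.Any using (here; there)
open import Data.Maybe.Base using (Maybe; just; nothing)
open import Data.Nat.Base as ℕ using (ℕ; zero; suc; NonZero)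
import Data.Nat.Properties as ℕ
open import Data.Nat.Solver using (module +-*-Solver)
open import Data.Product.Base using (∃; _×_; _,_; proj₁; proj₂)
open import Data.Product.Properties using (≡-dec)
open import Data.Rational.Base as ℚ using (ℚ; 0ℚ; 1ℚ; fromℚᵘ)
import Data.Rational.Properties as ℚ
open import Data.Rational.Unnormalised.Base as ℚᵘ using (mkℚᵘ; *≡*)
import Data.Rational.Unnormalised.Properties as ℚᵘ
open import Data.Sum.Base using (_⊎_; inj₁; inj₂)
open import Data.Vec.Functional as Vector using (Vector)
open import Defs hiding (θ)
open import Function.Base using (_∘_)
open import Function.Bundles using (Inverse; mk↔ₛ′)
open import Level using (0ℓ)
open import Relation.Binary.Bundles using (Setoid)
open import Relation.Binary.Definitions using (tri<; tri≈; tri>)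
open import Relation.Binary.PropositionalEquality as ≡ using (_≡_; _≢_)
import Relation.Binary.Reasoning.Setoid as SetoidReasoning
open import Relation.Nullary.Decidable
  using (Dec; yes; no; does; map′; _×-dec_; ¬?; dec-true; dec-false; decidable-stable)
open import Relation.Nullary.Negation using (¬_; contradiction)
open import Relation.Unary using (Pred; Decidable; _∈_)

-- Reals given by Cauchy sequences cannot be tested for zero or inverted at will, so a nonzero
-- scalar is replaced by a `Cancellable` one, an element `x` for which `x * y ≈ 0#` forces `y ≈ 0#`.
-- Cancellable elements are closed under products and under passing to factors. This suffices, since
-- every factor of the scalar is a sum of powers of `√q`, hence positive, or up to sign a product of
-- divisors of positive integers such as `q ^ k - 1`. The indices `i + 1` and `i - 1` may leave [N],
-- so the quadratic factor is decomposed directly in powers of `√q`. The constant `q ^ (N + M)` is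
-- the number of vectors of `H`. It enters because the vectors outside `y + h` are distributed in
-- equal shares over the covers of `y`; comparing this count for `y` and for a cover `x` of `y`
-- removes the sizes of `y + h` and `x + h` and leaves a multiple of the number of all vectors.
-- Dimensions of sums and intersections are obtained by comparing cardinalities.

module Counting where

  -- Finite sums of natural numbers and counting by indicators

  open import Algebra.Properties.Semiring.Sum ℕ.+-*-semiring public
    using (sum; sum-cong-≗; ∑-distrib-+; ∑-comm; sum-permute; *-distribˡ-sum; *-distribʳ-sum; sum-replicate-zero)

  sum-zero : ∀ {n} {f : Fin n → ℕ} → (∀ i → f i ≡ 0) → sum f ≡ 0
  sum-zero {n} f≡0 = ≡.trans (sum-cong-≗ f≡0) (sum-replicate-zero n)

  sum-const : ∀ {n k} {f : Fin n → ℕ} → (∀ i → f i ≡ k) → sum f ≡ n ℕ.* k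
  sum-const {zero}  f≡k = ≡.refl
  sum-const {suc n} f≡k = ≡.cong₂ ℕ._+_ (f≡k zero) (sum-const (f≡k ∘ suc))

  sum-single : ∀ {n} {f : Fin n → ℕ} i → (∀ j → j ≢ i → f j ≡ 0) → sum f ≡ f i
  sum-single {suc n} {f} zero f≡0 =
    ≡.trans (≡.cong (f zero ℕ.+_) (sum-zero λ j → f≡0 (suc j) λ ())) (ℕ.+-identityʳ _)
  sum-single {suc n} {f} (suc i) f≡0 = ≡.cong₂ ℕ._+_ (f≡0 zero λ ())
    (sum-single i λ j j≢i → f≡0 (suc j) (j≢i ∘ Fin.suc-injective))

  sum-mono-≤ : ∀ {n} {f g : Fin n → ℕ} → (∀ i → f i ℕ.≤ g i) → sum f ℕ.≤ sum g
  sum-mono-≤ {zero}  f≤g = ℕ.z≤n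
  sum-mono-≤ {suc n} f≤g = ℕ.+-mono-≤ (f≤g zero) (sum-mono-≤ (f≤g ∘ suc))

  sum-mono-< : ∀ {n} {f g : Fin n → ℕ} i → (∀ j → f j ℕ.≤ g j) → f i ℕ.< g i → sum f ℕ.< sum g
  sum-mono-< zero    f≤g fi<gi = ℕ.+-mono-<-≤ fi<gi (sum-mono-≤ (f≤g ∘ suc))
  sum-mono-< (suc i) f≤g fi<gi = ℕ.+-mono-≤-< (f≤g zero) (sum-mono-< i (f≤g ∘ suc) fi<gi)

  𝟙 : ∀ {a} {P : Set a} → Dec P → ℕ
  𝟙 P? = if does P? then 1 else 0

  𝟙-yes : ∀ {a} {P : Set a} (P? : Dec P) → P → 𝟙 P? ≡ 1
  𝟙-yes P? p rewrite dec-true P? p = ≡.refl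

  𝟙-no : ∀ {a} {P : Set a} (P? : Dec P) → ¬ P → 𝟙 P? ≡ 0
  𝟙-no P? ¬p rewrite dec-false P? ¬p = ≡.refl

  𝟙-× : ∀ {a b} {P : Set a} {Q : Set b} (P? : Dec P) (Q? : Dec Q) →
        𝟙 (P? ×-dec Q?) ≡ 𝟙 P? ℕ.* 𝟙 Q?
  𝟙-× (no  _) Q? = ≡.refl
  𝟙-× (yes _) Q? = ≡.sym (ℕ.+-identityʳ _)

  𝟙-mono : ∀ {a b} {P : Set a} {Q : Set b} (P? : Dec P) (Q? : Dec Q) →
           (P → Q) → 𝟙 P? ℕ.≤ 𝟙 Q?
  𝟙-mono (no  _) Q? P⇒Q = ℕ.z≤n
  𝟙-mono (yes p) Q? P⇒Q = ℕ.≤-reflexive (≡.sym (𝟙-yes Q? (P⇒Q p)))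

  𝟙-cong : ∀ {a b} {P : Set a} {Q : Set b} (P? : Dec P) (Q? : Dec Q) →
           (P → Q) → (Q → P) → 𝟙 P? ≡ 𝟙 Q?
  𝟙-cong P? Q? P⇒Q Q⇒P = ℕ.≤-antisym (𝟙-mono P? Q? P⇒Q) (𝟙-mono Q? P? Q⇒P)

  sum-𝟙-unique : ∀ {a n} {P : Fin n → Set a} (P? : ∀ i → Dec (P i)) i →
                 P i → (∀ j → P j → j ≡ i) → sum (λ j → 𝟙 (P? j)) ≡ 1
  sum-𝟙-unique P? i p unique =
    ≡.trans (sum-single i λ j j≢i → 𝟙-no (P? j) (j≢i ∘ unique j)) (𝟙-yes (P? i) p)

  sum-𝟙-none : ∀ {a n} {P : Fin n → Set a} (P? : ∀ i → Dec (P i)) →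
               (∀ i → ¬ P i) → sum (λ i → 𝟙 (P? i)) ≡ 0
  sum-𝟙-none P? none = sum-zero λ i → 𝟙-no (P? i) (none i)

  sum-𝟙-< : ∀ {a b n} {P : Fin n → Set a} {Q : Fin n → Set b}
            (P? : ∀ i → Dec (P i)) (Q? : ∀ i → Dec (Q i)) → (∀ i → P i → Q i) →
            ∀ i → Q i → ¬ P i → sum (λ i → 𝟙 (P? i)) ℕ.< sum (λ i → 𝟙 (Q? i))
  sum-𝟙-< P? Q? P⇒Q i q ¬p = sum-mono-< i (λ j → 𝟙-mono (P? j) (Q? j) (P⇒Q j))
    (≡.subst₂ ℕ._<_ (≡.sym (𝟙-no (P? i) ¬p)) (≡.sym (𝟙-yes (Q? i) q)) ℕ.≤-refl)

  -- Double counting: an `i` in `P` is related to exactly one `j` and any other `i` to none, so each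
  -- row sum of the indicator of `R` is the indicator of `P`.
  sum-𝟙-double : ∀ {a b n m} {P : Fin n → Set a} {R : Fin n → Fin m → Set b}
                 (P? : ∀ i → Dec (P i)) (R? : ∀ i j → Dec (R i j)) →
                 (∀ i → P i → ∃ λ j → R i j × (∀ k → R i k → k ≡ j)) →
                 (∀ i j → R i j → P i) →
                 sum (λ i → 𝟙 (P? i)) ≡ sum λ j → sum λ i → 𝟙 (R? i j)
  sum-𝟙-double P? R? P⇒R R⇒P =
    ≡.trans (sum-cong-≗ λ i → pointwise i (P? i)) (∑-comm (λ i j → 𝟙 (R? i j)))
    where
    pointwise : ∀ i (d : Dec _) → 𝟙 d ≡ sum λ j → 𝟙 (R? i j)
    pointwise i (no ¬p) = ≡.sym (sum-𝟙-none (R? i) λ j r → ¬p (R⇒P i j r))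
    pointwise i (yes p) with P⇒R i p
    ... | j , r , unique = ≡.sym (sum-𝟙-unique (R? i) j r unique)

  -- Here g is the indicator of a set containing k, and m is 1 on that set away from k.
  sum-exchange : ∀ {n} {g m : Fin n → ℕ} k → g k ≡ 1 →
                 (∀ i → i ≢ k → g i ℕ.* m i ≡ g i) →
                 sum (λ i → g i ℕ.* m i) ℕ.+ 1 ≡ sum g ℕ.+ m k
  sum-exchange {suc n} {g} {m} zero gk≡1 eq rewrite gk≡1 | sum-cong-≗ (λ i → eq (suc i) λ ()) =
    begin
      m zero ℕ.+ 0 ℕ.+ s ℕ.+ 1  ≡⟨ ≡.cong (λ a → a ℕ.+ s ℕ.+ 1) (ℕ.+-identityʳ (m zero)) ⟩
      m zero ℕ.+ s ℕ.+ 1        ≡⟨ ℕ.+-comm (m zero ℕ.+ s) 1 ⟩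
      suc (m zero ℕ.+ s)        ≡⟨ ≡.cong suc (ℕ.+-comm (m zero) s) ⟩
      suc (s ℕ.+ m zero)        ∎
    where
    open ≡.≡-Reasoning
    s = sum (g ∘ suc)
  sum-exchange {suc n} {g} {m} (suc k) gk≡1 eq rewrite eq zero (λ ()) =
    ≡.trans (ℕ.+-assoc (g zero) _ 1) (≡.trans
      (≡.cong (g zero ℕ.+_) (sum-exchange k gk≡1 λ i i≢k → eq (suc i) (i≢k ∘ Fin.suc-injective)))
      (≡.sym (ℕ.+-assoc (g zero) _ _)))

-- Polynomial identities behind the counts

module Arithmetic where
  open +-*-Solver

  factor-q : ∀ r q k u c → r ℕ.* (q ℕ.* k ℕ.* u) ℕ.+ q ℕ.* c ≡ q ℕ.* (u ℕ.* (r ℕ.* k) ℕ.+ c)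
  factor-q = solve 5 (λ r q k u c → r :* (q :* k :* u) :+ q :* c := q :* (u :* (r :* k) :+ c)) ≡.refl

  factor-r : ∀ r Q u D c → r ℕ.* Q ℕ.+ (u ℕ.* (r ℕ.* D) ℕ.+ c) ≡ r ℕ.* (D ℕ.* u ℕ.+ Q) ℕ.+ c
  factor-r = solve 5 (λ r Q u D c → r :* Q :+ (u :* (r :* D) :+ c) := r :* (D :* u :+ Q) :+ c) ≡.refl

  cover-total : ∀ D q u l Q →
    D ℕ.* (u ℕ.* suc q ℕ.+ q ℕ.* (l ℕ.* suc q)) ℕ.+ suc q ℕ.* Q ℕ.* 1 ≡
    suc q ℕ.* (D ℕ.* u ℕ.+ Q) ℕ.+ D ℕ.* (suc q ℕ.* (q ℕ.* l))
  cover-total = solve 5 (λ D q u l Q →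
    D :* (u :* (con 1 :+ q) :+ q :* (l :* (con 1 :+ q))) :+ (con 1 :+ q) :* Q :* con 1 :=
    (con 1 :+ q) :* (D :* u :+ Q) :+ D :* ((con 1 :+ q) :* (q :* l))) ≡.refl

  cover-factor : ∀ D q u l →
    suc q ℕ.* (D ℕ.* u) ℕ.+ D ℕ.* (suc q ℕ.* (q ℕ.* l)) ≡ D ℕ.* (suc q ℕ.* (u ℕ.+ q ℕ.* l))
  cover-factor = solve 4 (λ D q u l →
    (con 1 :+ q) :* (D :* u) :+ D :* ((con 1 :+ q) :* (q :* l)) :=
    D :* ((con 1 :+ q) :* (u :+ q :* l))) ≡.refl

  lower-total : ∀ q l → l ℕ.* suc q ℕ.+ 1 ≡ q ℕ.* l ℕ.+ 1 ℕ.+ l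
  lower-total = solve 2 (λ q l → l :* (con 1 :+ q) :+ con 1 := q :* l :+ con 1 :+ l) ≡.refl

-- Cancellable elements in place of nonzero ones

module Cancellation (R : CommutativeRing 0ℓ 0ℓ) where

  open CommutativeRing R
  open import Algebra.Properties.Ring ring using (x[y-z]≈xy-xz)
  open import Algebra.Properties.Group +-group using (x∙y⁻¹≈ε⇒x≈y; x≈y⇒x∙y⁻¹≈ε)

  Cancellable : Carrier → Set
  Cancellable x = ∀ y → x * y ≈ 0# → y ≈ 0#

  cancellable-* : ∀ {x y} → Cancellable x → Cancellable y → Cancellable (x * y)
  cancellable-* {x} {y} cx cy z e = cy z (cx (y * z) (trans (sym (*-assoc x y z)) e))

  -- If `x * z` vanishes, so does `x * y * z`. This makes a difference cancellable as soon as some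
  -- multiple of it is recognized as a positive integer.
  cancellable-factor : ∀ {x y} → Cancellable (x * y) → Cancellable x
  cancellable-factor {x} {y} cxy z e = cxy z (trans (*-congʳ (*-comm x y))
    (trans (*-assoc y x z) (trans (*-congˡ e) (zeroʳ y))))

  cancellable-cong : ∀ {x y} → x ≈ y → Cancellable x → Cancellable y
  cancellable-cong x≈y cx z e = cx z (trans (*-congʳ x≈y) e)

  cancellable-1 : Cancellable 1#
  cancellable-1 y e = trans (sym (*-identityˡ y)) e

  cancel : ∀ {x y z} → Cancellable x → x * y ≈ x * z → y ≈ z
  cancel {x} {y} {z} cx e = x∙y⁻¹≈ε⇒x≈y y z
    (cx (y - z) (trans (x[y-z]≈xy-xz x y z) (x≈y⇒x∙y⁻¹≈ε e)))

-- The commutator relation between `A` and `A*`, deduced from path counts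

module OverRing (R : CommutativeRing 0ℓ 0ℓ) where

  open CommutativeRing R hiding (zero)
  open Cancellation R

  -- Only a dimension function, a cover relation and the image `φ` of the natural numbers enter
  -- here. `a k` stands for `q ^ (- k)`, known through `a-suc`, and `Q₀` for the constant in the
  -- relation between path counts.
  module WeightedAdjacency
    (φ : ℕ → Carrier) (φ-0 : φ 0 ≈ 0#) (φ-1 : φ 1 ≈ 1#)
    (φ-+ : ∀ m n → φ (m ℕ.+ n) ≈ φ m + φ n) (φ-* : ∀ m n → φ (m ℕ.* n) ≈ φ m * φ n)
    (q Q₀ : ℕ) {n : ℕ} (d : Fin n → ℕ) (cov : Fin n → Fin n → Bool)
    (cov-d : ∀ z y → cov z y ≡ true → d z ≡ suc (d y))
    (a : ℕ → Carrier) (a-suc : ∀ k → φ q * a (suc k) ≈ a k)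
    where

    open import Algebra.Properties.Semiring.Sum semiring
      using (sum; sum-cong-≋; ∑-distrib-+; ∑-comm; *-distribˡ-sum; *-distribʳ-sum)
    open import Algebra.Properties.Group +-group using (∙-cancelʳ)
    open import Algebra.Solver.Ring.NaturalCoefficients.Default commutativeSemiring
      using (solve; _:=_; _:+_; _:*_; con)
    open SetoidReasoning setoid
    private module ℕ∑ = Counting

    A : Fin n → Fin n → Carrier
    A y z = if cov y z then 1# else if cov z y then φ (q ℕ.^ d y) else 0#

    ι : Fin n → Fin n → ℕ
    ι y z = if cov y z then 1 else 0

    UUD UDU DUU : Fin n → Fin n → ℕ
    UUD x y = ℕ∑.sum λ z → ι z x ℕ.* ℕ∑.sum λ w → ι z w ℕ.* ι w y
    UDU x y = ℕ∑.sum λ z → ι x z ℕ.* ℕ∑.sum λ w → ι w z ℕ.* ι w y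
    DUU x y = ℕ∑.sum λ z → ι x z ℕ.* ℕ∑.sum λ w → ι z w ℕ.* ι y w

    φ-sum : ∀ {m} (f : Fin m → ℕ) → φ (ℕ∑.sum f) ≈ sum λ i → φ (f i)
    φ-sum {zero}  f = φ-0
    φ-sum {suc m} f = trans (φ-+ (f zero) _) (+-congˡ (φ-sum (f ∘ suc)))

    φ-paths : ∀ (e f : Fin n → ℕ) (g : Fin n → Fin n → ℕ) →
      φ (ℕ∑.sum λ z → e z ℕ.* ℕ∑.sum λ w → g z w ℕ.* f w) ≈
      sum λ z → sum λ w → φ (e z) * (φ (g z w) * φ (f w))
    φ-paths e f g = begin
      φ (ℕ∑.sum λ z → e z ℕ.* ℕ∑.sum λ w → g z w ℕ.* f w)
        ≈⟨ φ-sum (λ z → e z ℕ.* ℕ∑.sum λ w → g z w ℕ.* f w) ⟩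
      (sum λ z → φ (e z ℕ.* ℕ∑.sum λ w → g z w ℕ.* f w))
        ≈⟨ sum-cong-≋ (λ z → trans (φ-* (e z) _) (*-congˡ (φ-sum λ w → g z w ℕ.* f w))) ⟩
      (sum λ z → φ (e z) * sum λ w → φ (g z w ℕ.* f w))
        ≈⟨ sum-cong-≋ (λ z → trans (*-distribˡ-sum (φ (e z)) (λ w → φ (g z w ℕ.* f w)))
             (sum-cong-≋ λ w → *-congˡ (φ-* (g z w) (f w)))) ⟩
      (sum λ z → sum λ w → φ (e z) * (φ (g z w) * φ (f w))) ∎

    -- In the commutator of the overview the word `A A* A²` receives `q²` from one term and
    -- `q (q² + 1)` from another, together `Q * s`; likewise `A² A* A` with the opposite sign.
    Q s T : Carrier
    Q = φ q
    s = Q * Q + Q + 1#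
    T = φ Q₀ * ((Q + 1#) * (Q + 1#))

    α : Fin n → Carrier
    α y = a (d y)

    -- The value of `A*` is taken at the vertex of the path where `A*` stands in the word: `y` and
    -- `z` for the positive words, `w` and `x` for the negative ones. Keeping the signs on separate
    -- sides avoids subtraction.
    Φ⁺ Φ⁻ : Carrier → Carrier → Carrier
    Φ⁺ ay az = Q * Q * ay + Q * s * az
    Φ⁻ aw ax = Q * s * aw + Q * Q * ax

    -- Each case records both entries of `A` and both cover indicators, so that a split on the three
    -- steps of a path fixes its weight and its type together.
    data Step (x z : Fin n) : Set where
      up   : d x ≡ suc (d z) → A x z ≈ 1# → A z x ≈ φ (q ℕ.^ d z) →
             φ (ι x z) ≈ 1# → φ (ι z x) ≈ 0# → Step x z
      down : d z ≡ suc (d x) → A x z ≈ φ (q ℕ.^ d x) → A z x ≈ 1# →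
             φ (ι x z) ≈ 0# → φ (ι z x) ≈ 1# → Step x z
      none : A x z ≈ 0# → A z x ≈ 0# → φ (ι x z) ≈ 0# → φ (ι z x) ≈ 0# → Step x z

    step : ∀ x z → Step x z
    step x z = go (cov x z) (cov z x) ≡.refl ≡.refl
      where
      go : ∀ b b′ → cov x z ≡ b → cov z x ≡ b′ → Step x z
      go true true e e′ = contradiction
        (≡.trans (≡.trans (cov-d x z e) (≡.cong suc (cov-d z x e′))) ≡.refl)
        (ℕ.<⇒≢ (ℕ.m<n⇒m<1+n (ℕ.n<1+n (d x))))
      go true false e e′ = up (cov-d x z e)
        (reflexive (≡.cong (if_then 1# else (if cov z x then φ (q ℕ.^ d x) else 0#)) e))
        (reflexive (≡.cong₂ (λ b b′ → if b then 1# else if b′ then φ (q ℕ.^ d z) else 0#) e′ e))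
        (trans (reflexive (≡.cong (λ b → φ (if b then 1 else 0)) e)) φ-1)
        (trans (reflexive (≡.cong (λ b → φ (if b then 1 else 0)) e′)) φ-0)
      go false true e e′ = down (cov-d z x e′)
        (reflexive (≡.cong₂ (λ b b′ → if b then 1# else if b′ then φ (q ℕ.^ d x) else 0#) e e′))
        (reflexive (≡.cong (if_then 1# else (if cov x z then φ (q ℕ.^ d z) else 0#)) e′))
        (trans (reflexive (≡.cong (λ b → φ (if b then 1 else 0)) e)) φ-0)
        (trans (reflexive (≡.cong (λ b → φ (if b then 1 else 0)) e′)) φ-1)
      go false false e e′ = none
        (reflexive (≡.cong₂ (λ b b′ → if b then 1# else if b′ then φ (q ℕ.^ d x) else 0#) e e′))
        (reflexive (≡.cong₂ (λ b b′ → if b then 1# else if b′ then φ (q ℕ.^ d z) else 0#) e′ e))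
        (trans (reflexive (≡.cong (λ b → φ (if b then 1 else 0)) e)) φ-0)
        (trans (reflexive (≡.cong (λ b → φ (if b then 1 else 0)) e′)) φ-0)

    path : Fin n → Fin n → Fin n → Fin n → Carrier
    path x z w y = A x z * (A z w * A w y)

    path⁺ path⁻ : Fin n → Fin n → Fin n → Fin n → Carrier
    path⁺ x z w y = path x z w y * Φ⁺ (α y) (α z)
    path⁻ x z w y = path x z w y * Φ⁻ (α w) (α x)

    -- G (Q² - 1) times ((Q + 1) udu - uud - Q duu), the two signs being separated.
    Ω⁺ Ω⁻ : Carrier → Carrier → Carrier → Carrier → Carrier
    Ω⁺ G uud udu duu = G * (Q * Q * (uud + Q * duu) + (Q + 1#) * udu)
    Ω⁻ G uud udu duu = G * ((uud + Q * duu) + Q * Q * ((Q + 1#) * udu))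

    Ω⁺-cong : ∀ {G G′ u u′ v v′ w w′} → G ≈ G′ → u ≈ u′ → v ≈ v′ → w ≈ w′ → Ω⁺ G u v w ≈ Ω⁺ G′ u′ v′ w′
    Ω⁺-cong c e f g = *-cong c (+-cong (*-congˡ (+-cong e (*-congˡ g))) (*-congˡ f))

    Ω⁻-cong : ∀ {G G′ u u′ v v′ w w′} → G ≈ G′ → u ≈ u′ → v ≈ v′ → w ≈ w′ → Ω⁻ G u v w ≈ Ω⁻ G′ u′ v′ w′
    Ω⁻-cong c e f g = *-cong c (+-cong (+-cong e (*-congˡ g)) (*-congˡ (*-congˡ f)))

    private
      *-zero₁ : ∀ {b c d} → b ≈ 0# → b * (c * d) ≈ 0#
      *-zero₁ e = trans (*-congʳ e) (zeroˡ _)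

      *-zero₂ : ∀ {b c d} → c ≈ 0# → b * (c * d) ≈ 0#
      *-zero₂ e = trans (*-congˡ (trans (*-congʳ e) (zeroˡ _))) (zeroʳ _)

      *-zero₃ : ∀ {b c d} → d ≈ 0# → b * (c * d) ≈ 0#
      *-zero₃ e = trans (*-congˡ (trans (*-congˡ e) (zeroʳ _))) (zeroʳ _)

      *-one : ∀ {b c d} → b ≈ 1# → c ≈ 1# → d ≈ 1# → b * (c * d) ≈ 1#
      *-one e f g = trans (*-cong e (trans (*-cong f g) (*-identityˡ _))) (*-identityˡ _)

    uud udu duu : Fin n → Fin n → Fin n → Fin n → Carrier
    uud x z w y = φ (ι z x) * (φ (ι z w) * φ (ι w y))
    udu x z w y = φ (ι x z) * (φ (ι w z) * φ (ι w y))
    duu x z w y = φ (ι x z) * (φ (ι z w) * φ (ι y w))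

    α-suc : ∀ {x y} → d x ≡ suc (d y) → α y ≈ Q * α x
    α-suc {x} {y} e = sym (trans (*-congˡ (reflexive (≡.cong a e))) (a-suc (d y)))

    φ-suc : ∀ {x y} → d x ≡ suc (d y) → φ (q ℕ.^ d x) ≈ Q * φ (q ℕ.^ d y)
    φ-suc {x} {y} e = trans (reflexive (≡.cong (λ k → φ (q ℕ.^ k)) e)) (φ-* q (q ℕ.^ d y))

    module Raising {x y} (dx : d x ≡ suc (d y)) where

      G : Carrier
      G = φ (q ℕ.^ d x) * α x

      -- The relation path by path: the two weights differ by a multiple of the signed type
      -- indicator, and the same factor `G (Q² - 1)` serves all three types because it depends on
      -- `x` alone.
      Balanced : Fin n → Fin n → Set
      Balanced z w = path⁺ x z w y + Ω⁺ G (uud x z w y) (udu x z w y) (duu x z w y) ≈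
                     path⁻ x z w y + Ω⁻ G (uud x z w y) (udu x z w y) (duu x z w y)

      balance : ∀ z w {G′ P u v t ax ay az aw} → G ≈ G′ →
        path x z w y ≈ P → uud x z w y ≈ u → udu x z w y ≈ v → duu x z w y ≈ t →
        α x ≈ ax → α y ≈ ay → α z ≈ az → α w ≈ aw →
        P * Φ⁺ ay az + Ω⁺ G′ u v t ≈ P * Φ⁻ aw ax + Ω⁻ G′ u v t → Balanced z w
      balance z w eG eP eu ev et ex ey ez ew e = trans
        (+-cong (*-cong eP (+-cong (*-congˡ ey) (*-congˡ ez))) (Ω⁺-cong eG eu ev et))
        (trans e (sym (+-cong (*-cong eP (+-cong (*-congˡ ew) (*-congˡ ex))) (Ω⁻-cong eG eu ev et))))

      balance-0 : ∀ z w → path x z w y ≈ 0# → uud x z w y ≈ 0# → udu x z w y ≈ 0# → duu x z w y ≈ 0# → Balanced z w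
      balance-0 z w eP eu ev et = balance z w refl eP eu ev et refl refl refl refl (begin
        0# * Φ⁺ (α y) (α z) + Ω⁺ G 0# 0# 0#
          ≈⟨ +-cong (zeroˡ _) (solve 2 (λ G Q → G :* (Q :* Q :* (con 0 :+ Q :* con 0) :+ (Q :+ con 1) :* con 0) := con 0) refl G Q) ⟩
        0# + 0#
          ≈⟨ +-cong (zeroˡ _) (solve 2 (λ G Q → G :* ((con 0 :+ Q :* con 0) :+ Q :* Q :* ((Q :+ con 1) :* con 0)) := con 0) refl G Q) ⟨
        0# * Φ⁻ (α w) (α x) + Ω⁻ G 0# 0# 0# ∎)

      balanced : ∀ z w → Balanced z w
      balanced z w with step x z | step z w | step w y
      ... | none A₁ _ i₁ j₁ | _ | _ = balance-0 z w (*-zero₁ A₁) (*-zero₁ j₁) (*-zero₁ i₁) (*-zero₁ i₁)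
      ... | up _ _ _ _ _ | none A₂ _ i₂ j₂ | _ = balance-0 z w (*-zero₂ A₂) (*-zero₂ i₂) (*-zero₂ j₂) (*-zero₂ i₂)
      ... | down _ _ _ _ _ | none A₂ _ i₂ j₂ | _ = balance-0 z w (*-zero₂ A₂) (*-zero₂ i₂) (*-zero₂ j₂) (*-zero₂ i₂)
      ... | up _ _ _ _ _ | up _ _ _ _ _ | none A₃ _ i₃ j₃ = balance-0 z w (*-zero₃ A₃) (*-zero₃ i₃) (*-zero₃ i₃) (*-zero₃ j₃)
      ... | up _ _ _ _ _ | down _ _ _ _ _ | none A₃ _ i₃ j₃ = balance-0 z w (*-zero₃ A₃) (*-zero₃ i₃) (*-zero₃ i₃) (*-zero₃ j₃)
      ... | down _ _ _ _ _ | up _ _ _ _ _ | none A₃ _ i₃ j₃ = balance-0 z w (*-zero₃ A₃) (*-zero₃ i₃) (*-zero₃ i₃) (*-zero₃ j₃)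
      ... | down _ _ _ _ _ | down _ _ _ _ _ | none A₃ _ i₃ j₃ = balance-0 z w (*-zero₃ A₃) (*-zero₃ i₃) (*-zero₃ i₃) (*-zero₃ j₃)
      -- The admissible patterns, read from `y`, are down-up-up, up-down-up and up-up-down. In each,
      -- `p` is the weight of the path and `G` is rewritten through it.
      ... | up e₁ A₁ _ i₁ j₁ | up e₂ A₂ _ i₂ j₂ | down e₃ A₃ _ i₃ j₃ =
        balance z w (*-congʳ (trans (φ-suc e₁) (*-congˡ (φ-suc e₂))))
          (*-cong A₁ (*-cong A₂ A₃)) (*-zero₁ j₁) (*-zero₂ j₂) (*-one i₁ i₂ j₃)
          refl (α-suc dx) (α-suc e₁) (trans (α-suc e₂) (*-congˡ (α-suc e₁)))
          (solve 3 (λ Q p β →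
            let s = Q :* Q :+ Q :+ con 1; G = Q :* (Q :* p) :* β in
            con 1 :* (con 1 :* p) :* (Q :* Q :* (Q :* β) :+ Q :* s :* (Q :* β))
              :+ G :* (Q :* Q :* (con 0 :+ Q :* con 1) :+ (Q :+ con 1) :* con 0) :=
            con 1 :* (con 1 :* p) :* (Q :* s :* (Q :* (Q :* β)) :+ Q :* Q :* β)
              :+ G :* ((con 0 :+ Q :* con 1) :+ Q :* Q :* ((Q :+ con 1) :* con 0)))
            refl Q (φ (q ℕ.^ d w)) (α x))
      ... | up e₁ A₁ _ i₁ j₁ | down e₂ A₂ _ i₂ j₂ | up e₃ A₃ _ i₃ j₃ =
        balance z w (*-congʳ (φ-suc e₁))
          (*-cong A₁ (*-cong A₂ A₃)) (*-zero₁ j₁) (*-one i₁ j₂ i₃) (*-zero₂ i₂)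
          refl (α-suc dx) (α-suc e₁) (reflexive (≡.cong a (≡.trans e₂ (≡.sym e₁))))
          (solve 3 (λ Q p β →
            let s = Q :* Q :+ Q :+ con 1; G = Q :* p :* β in
            con 1 :* (p :* con 1) :* (Q :* Q :* (Q :* β) :+ Q :* s :* (Q :* β))
              :+ G :* (Q :* Q :* (con 0 :+ Q :* con 0) :+ (Q :+ con 1) :* con 1) :=
            con 1 :* (p :* con 1) :* (Q :* s :* β :+ Q :* Q :* β)
              :+ G :* ((con 0 :+ Q :* con 0) :+ Q :* Q :* ((Q :+ con 1) :* con 1)))
            refl Q (φ (q ℕ.^ d z)) (α x))
      ... | down e₁ A₁ _ i₁ j₁ | up e₂ A₂ _ i₂ j₂ | up e₃ A₃ _ i₃ j₃ =
        balance z w (*-congˡ (α-suc e₁))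
          (*-cong A₁ (*-cong A₂ A₃)) (*-one j₁ i₂ i₃) (*-zero₁ i₁) (*-zero₁ i₁)
          (α-suc e₁) (trans (α-suc e₃) (*-congˡ (α-suc e₂))) refl (α-suc e₂)
          (solve 3 (λ Q p β →
            let s = Q :* Q :+ Q :+ con 1; G = p :* (Q :* β) in
            p :* (con 1 :* con 1) :* (Q :* Q :* (Q :* (Q :* β)) :+ Q :* s :* β)
              :+ G :* (Q :* Q :* (con 1 :+ Q :* con 0) :+ (Q :+ con 1) :* con 0) :=
            p :* (con 1 :* con 1) :* (Q :* s :* (Q :* β) :+ Q :* Q :* (Q :* β))
              :+ G :* ((con 1 :+ Q :* con 0) :+ Q :* Q :* ((Q :+ con 1) :* con 0)))
            refl Q (φ (q ℕ.^ d x)) (α z))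
      -- The five remaining patterns change the dimension by 3, by -1 or by -3 instead of by 1.
      ... | up e₁ _ _ _ _ | up e₂ _ _ _ _ | up e₃ _ _ _ _ = contradiction
        (ℕ.suc-injective (≡.trans (≡.sym dx) (≡.trans e₁ (≡.cong suc (≡.trans e₂ (≡.cong suc e₃))))))
        (ℕ.m≢1+n+m (d y) {1})
      ... | up e₁ _ _ _ _ | down e₂ _ _ _ _ | down e₃ _ _ _ _ = contradiction
        (≡.trans e₃ (≡.cong suc (≡.trans e₂ (≡.trans (≡.sym e₁) dx))))
        (ℕ.m≢1+n+m (d y) {1})
      ... | down e₁ _ _ _ _ | up e₂ _ _ _ _ | down e₃ _ _ _ _ = contradiction
        (≡.trans e₃ (≡.trans (≡.sym e₂) (≡.trans e₁ (≡.cong suc dx))))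
        (ℕ.m≢1+n+m (d y) {1})
      ... | down e₁ _ _ _ _ | down e₂ _ _ _ _ | up e₃ _ _ _ _ = contradiction
        (ℕ.suc-injective (≡.trans (≡.sym e₃) (≡.trans e₂ (≡.cong suc (≡.trans e₁ (≡.cong suc dx))))))
        (ℕ.m≢1+n+m (d y) {1})
      ... | down e₁ _ _ _ _ | down e₂ _ _ _ _ | down e₃ _ _ _ _ = contradiction
        (≡.trans e₃ (≡.cong suc (≡.trans e₂ (≡.cong suc (≡.trans e₁ (≡.cong suc dx))))))
        (ℕ.m≢1+n+m (d y) {3})

    ∑∑ : (Fin n → Fin n → Carrier) → Carrier
    ∑∑ f = sum λ z → sum λ w → f z w

    ∑∑-cong : ∀ {f g : Fin n → Fin n → Carrier} → (∀ z w → f z w ≈ g z w) → ∑∑ f ≈ ∑∑ g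
    ∑∑-cong e = sum-cong-≋ λ z → sum-cong-≋ (e z)

    ∑∑-+ : ∀ f g → ∑∑ (λ z w → f z w + g z w) ≈ ∑∑ f + ∑∑ g
    ∑∑-+ f g = trans (sum-cong-≋ λ z → ∑-distrib-+ (f z) (g z))
      (∑-distrib-+ (λ z → sum (f z)) (λ z → sum (g z)))

    ∑∑-*ˡ : ∀ c f → ∑∑ (λ z w → c * f z w) ≈ c * ∑∑ f
    ∑∑-*ˡ c f = sym (trans (*-distribˡ-sum c (λ z → sum (f z))) (sum-cong-≋ λ z → *-distribˡ-sum c (f z)))

    ∑∑-*ʳ : ∀ c f → ∑∑ (λ z w → f z w * c) ≈ ∑∑ f * c
    ∑∑-*ʳ c f = sym (trans (*-distribʳ-sum c (λ z → sum (f z))) (sum-cong-≋ λ z → *-distribʳ-sum c (f z)))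

    S⁺ S⁻ : Fin n → Fin n → Carrier
    S⁺ x y = ∑∑ λ z w → path⁺ x z w y
    S⁻ x y = ∑∑ λ z w → path⁻ x z w y

    -- The (x, y)-entry of Q² A³A* + Q s A A* A² + T A* A = Q s A² A* A + Q² A* A³ + T A A*.
    Relation : Fin n → Fin n → Set
    Relation x y = S⁺ x y + T * A x y * α x ≈ S⁻ x y + T * A x y * α y

    -- The one fact about the poset on which the matrix relation depends; `PathCounts.path-relation`
    -- supplies it.
    module _
      (path-relation : ∀ x y → d x ≡ suc (d y) →
        q ℕ.^ d x ℕ.* (UUD x y ℕ.+ q ℕ.* DUU x y) ℕ.+ suc q ℕ.* Q₀ ℕ.* ι x y ≡
        q ℕ.^ d x ℕ.* (suc q ℕ.* UDU x y))
      where

      -- Summing `balanced` over all paths brings in the three path counts, and `path-relation`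
      -- leaves only the term `C` containing `Q₀`. As `α y ≈ Q * α x`, the `T` terms are
      -- `b * C + Q * (b * C)` and `Q * (b * C) + Q * Q * (b * C)`; they share a part, and what is
      -- left is `core`.
      relation-raising : ∀ {x y} → d x ≡ suc (d y) → Relation x y
      relation-raising {x} {y} dx = begin
        S⁺ x y + T * A x y * b             ≈⟨ +-congˡ (*-congʳ (*-congˡ A≈c)) ⟩
        S⁺ x y + T * c * b
          ≈⟨ solve 5 (λ S k Q c b → S :+ k :* ((Q :+ con 1) :* (Q :+ con 1)) :* c :* b :=
               S :+ b :* ((con 1 :+ Q) :* k :* c) :+ Q :* (b :* ((con 1 :+ Q) :* k :* c))) refl (S⁺ x y) (φ Q₀) Q c b ⟩
        S⁺ x y + b * C + Q * (b * C)       ≈⟨ +-congʳ core ⟩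
        S⁻ x y + Q * Q * (b * C) + Q * (b * C)
          ≈⟨ solve 5 (λ S k Q c b → S :+ k :* ((Q :+ con 1) :* (Q :+ con 1)) :* c :* (Q :* b) :=
               S :+ Q :* Q :* (b :* ((con 1 :+ Q) :* k :* c)) :+ Q :* (b :* ((con 1 :+ Q) :* k :* c))) refl (S⁻ x y) (φ Q₀) Q c b ⟨
        S⁻ x y + T * c * (Q * b)           ≈⟨ +-congˡ (*-cong (*-congˡ A≈c) (α-suc dx)) ⟨
        S⁻ x y + T * A x y * α y           ∎
        where
        open Raising {x} {y} dx
        p = φ (q ℕ.^ d x)
        b = α x
        c = φ (ι x y)
        C = (1# + Q) * φ Q₀ * c
        U = φ (UUD x y)
        V = φ (UDU x y)
        W = φ (DUU x y)

        A≈c : A x y ≈ c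
        A≈c with step x y
        ... | up _ A≈1 _ c≈1 _   = trans A≈1 (sym c≈1)
        ... | none A≈0 _ c≈0 _   = trans A≈0 (sym c≈0)
        ... | down dy _ _ _ _ = contradiction (≡.trans dx (≡.cong suc dy)) (ℕ.m≢1+n+m (d x) {1})

        counted : p * (U + Q * W) + C ≈ p * ((1# + Q) * V)
        counted = begin
          p * (U + Q * W) + C
            ≈⟨ +-cong (*-congˡ (+-congˡ (φ-* q (DUU x y)))) (*-congʳ (trans (φ-* (suc q) Q₀) (*-congʳ φ-1+q))) ⟨
          p * (U + φ (q ℕ.* DUU x y)) + φ (suc q ℕ.* Q₀) * c
            ≈⟨ +-cong (trans (φ-* (q ℕ.^ d x) _) (*-congˡ (φ-+ (UUD x y) _))) (φ-* (suc q ℕ.* Q₀) (ι x y)) ⟨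
          φ (q ℕ.^ d x ℕ.* (UUD x y ℕ.+ q ℕ.* DUU x y)) + φ (suc q ℕ.* Q₀ ℕ.* ι x y)
            ≈⟨ φ-+ _ _ ⟨
          φ (q ℕ.^ d x ℕ.* (UUD x y ℕ.+ q ℕ.* DUU x y) ℕ.+ suc q ℕ.* Q₀ ℕ.* ι x y)
            ≡⟨ ≡.cong φ (path-relation x y dx) ⟩
          φ (q ℕ.^ d x ℕ.* (suc q ℕ.* UDU x y))
            ≈⟨ trans (φ-* (q ℕ.^ d x) _) (*-congˡ (trans (φ-* (suc q) (UDU x y)) (*-congʳ φ-1+q))) ⟩
          p * ((1# + Q) * V) ∎
          where
          φ-1+q : φ (suc q) ≈ 1# + Q
          φ-1+q = trans (φ-+ 1 q) (+-congʳ φ-1)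

        summed : S⁺ x y + Ω⁺ G U V W ≈ S⁻ x y + Ω⁻ G U V W
        summed = begin
          S⁺ x y + Ω⁺ G U V W
            ≈⟨ +-congˡ (Ω⁺-cong refl eU eV eW) ⟩
          S⁺ x y + G * (Q * Q * (∑∑ u + Q * ∑∑ w) + (Q + 1#) * ∑∑ v)
            ≈⟨ +-congˡ (*-congˡ (+-cong (*-congˡ u+Qw) (sym (∑∑-*ˡ (Q + 1#) v)))) ⟩
          S⁺ x y + G * (Q * Q * ∑∑ (λ z w′ → u z w′ + Q * w z w′) + ∑∑ (λ z w′ → (Q + 1#) * v z w′))
            ≈⟨ +-congˡ (*-congˡ (trans (+-congʳ (sym (∑∑-*ˡ (Q * Q) _))) (sym (∑∑-+ _ _)))) ⟩
          S⁺ x y + G * ∑∑ (λ z w′ → Q * Q * (u z w′ + Q * w z w′) + (Q + 1#) * v z w′)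
            ≈⟨ trans (+-congˡ (sym (∑∑-*ˡ G _))) (sym (∑∑-+ _ _)) ⟩
          ∑∑ (λ z w′ → path⁺ x z w′ y + Ω⁺ G (u z w′) (v z w′) (w z w′))
            ≈⟨ ∑∑-cong balanced ⟩
          ∑∑ (λ z w′ → path⁻ x z w′ y + Ω⁻ G (u z w′) (v z w′) (w z w′))
            ≈⟨ trans (∑∑-+ _ _) (+-congˡ (∑∑-*ˡ G _)) ⟩
          S⁻ x y + G * ∑∑ (λ z w′ → (u z w′ + Q * w z w′) + Q * Q * ((Q + 1#) * v z w′))
            ≈⟨ +-congˡ (*-congˡ (trans (∑∑-+ _ _) (+-congˡ (∑∑-*ˡ (Q * Q) _)))) ⟩
          S⁻ x y + G * (∑∑ (λ z w′ → u z w′ + Q * w z w′) + Q * Q * ∑∑ (λ z w′ → (Q + 1#) * v z w′))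
            ≈⟨ +-congˡ (*-congˡ (+-cong (sym u+Qw) (*-congˡ (∑∑-*ˡ (Q + 1#) v)))) ⟩
          S⁻ x y + G * ((∑∑ u + Q * ∑∑ w) + Q * Q * ((Q + 1#) * ∑∑ v))
            ≈⟨ +-congˡ (Ω⁻-cong refl eU eV eW) ⟨
          S⁻ x y + Ω⁻ G U V W ∎
          where
          u v w : Fin n → Fin n → Carrier
          u z w′ = uud x z w′ y
          v z w′ = udu x z w′ y
          w z w′ = duu x z w′ y
          eU = φ-paths (λ z → ι z x) (λ w → ι w y) ι
          eV = φ-paths (ι x) (λ w → ι w y) (λ z w → ι w z)
          eW = φ-paths (ι x) (ι y) ι
          u+Qw : ∑∑ u + Q * ∑∑ w ≈ ∑∑ (λ z w′ → u z w′ + Q * w z w′)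
          u+Qw = trans (+-congˡ (sym (∑∑-*ˡ Q w))) (sym (∑∑-+ u _))

        E = p * (U + Q * W)

        core : S⁺ x y + b * C ≈ S⁻ x y + Q * Q * (b * C)
        -- The added terms let `counted` be applied with weight 1 on the left and with weight
        -- `Q * Q` on the right, which produces `Ω⁺` and `Ω⁻`.
        core = ∙-cancelʳ (Q * Q * (b * E) + b * E) _ _ (begin
          S⁺ x y + b * C + (Q * Q * (b * E) + b * E)
            ≈⟨ solve 5 (λ S b C Q E → S :+ b :* C :+ (Q :* Q :* (b :* E) :+ b :* E) :=
                 S :+ (Q :* Q :* (b :* E) :+ b :* (E :+ C))) refl (S⁺ x y) b C Q E ⟩
          S⁺ x y + (Q * Q * (b * E) + b * (E + C))
            ≈⟨ +-congˡ (+-congˡ (*-congˡ counted)) ⟩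
          S⁺ x y + (Q * Q * (b * E) + b * (p * ((1# + Q) * V)))
            ≈⟨ solve 7 (λ S b Q p U V W →
                 S :+ (Q :* Q :* (b :* (p :* (U :+ Q :* W))) :+ b :* (p :* ((con 1 :+ Q) :* V))) :=
                 S :+ p :* b :* (Q :* Q :* (U :+ Q :* W) :+ (Q :+ con 1) :* V)) refl (S⁺ x y) b Q p U V W ⟩
          S⁺ x y + Ω⁺ G U V W
            ≈⟨ summed ⟩
          S⁻ x y + Ω⁻ G U V W
            ≈⟨ solve 7 (λ S b Q p U V W →
                 S :+ (Q :* Q :* (b :* (p :* ((con 1 :+ Q) :* V))) :+ b :* (p :* (U :+ Q :* W))) :=
                 S :+ p :* b :* ((U :+ Q :* W) :+ Q :* Q :* ((Q :+ con 1) :* V))) refl (S⁻ x y) b Q p U V W ⟨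
          S⁻ x y + (Q * Q * (b * (p * ((1# + Q) * V))) + b * E)
            ≈⟨ +-congˡ (+-congʳ (*-congˡ (*-congˡ counted))) ⟨
          S⁻ x y + (Q * Q * (b * (E + C)) + b * E)
            ≈⟨ solve 5 (λ S b C Q E → S :+ Q :* Q :* (b :* C) :+ (Q :* Q :* (b :* E) :+ b :* E) :=
                 S :+ (Q :* Q :* (b :* (E :+ C)) :+ b :* E)) refl (S⁻ x y) b C Q E ⟨
          S⁻ x y + Q * Q * (b * C) + (Q * Q * (b * E) + b * E) ∎)

      -- A path with nonzero weight must now have three equal steps, any other pattern changing the
      -- dimension by 1 or -1. For three equal steps the weights agree because `Q³ - 1 = s (Q - 1)`.
      relation-far : ∀ {x y} → ¬ d x ≡ suc (d y) → ¬ d y ≡ suc (d x) → Relation x y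
      relation-far {x} {y} ¬dx ¬dy = +-cong (∑∑-cong same) (trans (vanish (α x)) (sym (vanish (α y))))
        where
        A≈0 : A x y ≈ 0#
        A≈0 with step x y
        ... | up e _ _ _ _   = contradiction e ¬dx
        ... | down e _ _ _ _ = contradiction e ¬dy
        ... | none e _ _ _   = e

        vanish : ∀ k → T * A x y * k ≈ 0#
        vanish k = trans (*-congʳ (trans (*-congˡ A≈0) (zeroʳ T))) (zeroˡ k)

        both-zero : ∀ z w → path x z w y ≈ 0# → path⁺ x z w y ≈ path⁻ x z w y
        both-zero z w e = trans (trans (*-congʳ e) (zeroˡ _)) (sym (trans (*-congʳ e) (zeroˡ _)))

        same : ∀ z w → path⁺ x z w y ≈ path⁻ x z w y
        same z w with step x z | step z w | step w y
        ... | none A₁ _ _ _ | _ | _ = both-zero z w (*-zero₁ A₁)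
        ... | up _ _ _ _ _ | none A₂ _ _ _ | _ = both-zero z w (*-zero₂ A₂)
        ... | down _ _ _ _ _ | none A₂ _ _ _ | _ = both-zero z w (*-zero₂ A₂)
        ... | up _ _ _ _ _ | up _ _ _ _ _ | none A₃ _ _ _ = both-zero z w (*-zero₃ A₃)
        ... | up _ _ _ _ _ | down _ _ _ _ _ | none A₃ _ _ _ = both-zero z w (*-zero₃ A₃)
        ... | down _ _ _ _ _ | up _ _ _ _ _ | none A₃ _ _ _ = both-zero z w (*-zero₃ A₃)
        ... | down _ _ _ _ _ | down _ _ _ _ _ | none A₃ _ _ _ = both-zero z w (*-zero₃ A₃)
        ... | up e₁ _ _ _ _ | up e₂ _ _ _ _ | up e₃ _ _ _ _ = *-congˡ (begin
          Q * Q * α y + Q * s * α z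
            ≈⟨ +-cong (*-congˡ αy) (*-congˡ αz) ⟩
          Q * Q * (Q * (Q * (Q * α x))) + Q * s * (Q * α x)
            ≈⟨ solve 2 (λ Q b → let s = Q :* Q :+ Q :+ con 1 in
                 Q :* Q :* (Q :* (Q :* (Q :* b))) :+ Q :* s :* (Q :* b) :=
                 Q :* s :* (Q :* (Q :* b)) :+ Q :* Q :* b) refl Q (α x) ⟩
          Q * s * (Q * (Q * α x)) + Q * Q * α x
            ≈⟨ +-congʳ (*-congˡ αw) ⟨
          Q * s * α w + Q * Q * α x ∎)
          where
          αz = α-suc e₁
          αw = trans (α-suc e₂) (*-congˡ αz)
          αy = trans (α-suc e₃) (*-congˡ αw)
        ... | down e₁ _ _ _ _ | down e₂ _ _ _ _ | down e₃ _ _ _ _ = *-congˡ (begin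
          Q * Q * α y + Q * s * α z
            ≈⟨ +-congˡ (*-congˡ αz) ⟩
          Q * Q * α y + Q * s * (Q * (Q * α y))
            ≈⟨ solve 2 (λ Q b → let s = Q :* Q :+ Q :+ con 1 in
                 Q :* Q :* b :+ Q :* s :* (Q :* (Q :* b)) :=
                 Q :* s :* (Q :* b) :+ Q :* Q :* (Q :* (Q :* (Q :* b)))) refl Q (α y) ⟩
          Q * s * (Q * α y) + Q * Q * (Q * (Q * (Q * α y)))
            ≈⟨ +-cong (*-congˡ αw) (*-congˡ αx) ⟨
          Q * s * α w + Q * Q * α x ∎)
          where
          αw = α-suc e₃
          αz = trans (α-suc e₂) (*-congˡ αw)
          αx = trans (α-suc e₁) (*-congˡ αz)
        ... | up e₁ _ _ _ _ | up e₂ _ _ _ _ | down e₃ _ _ _ _ =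
          contradiction (≡.trans e₁ (≡.cong suc (≡.trans e₂ (≡.sym e₃)))) ¬dx
        ... | up e₁ _ _ _ _ | down e₂ _ _ _ _ | up e₃ _ _ _ _ =
          contradiction (≡.trans e₁ (≡.trans (≡.sym e₂) e₃)) ¬dx
        ... | down e₁ _ _ _ _ | up e₂ _ _ _ _ | up e₃ _ _ _ _ =
          contradiction (≡.trans (ℕ.suc-injective (≡.trans (≡.sym e₁) e₂)) e₃) ¬dx
        ... | up e₁ _ _ _ _ | down e₂ _ _ _ _ | down e₃ _ _ _ _ =
          contradiction (≡.trans e₃ (≡.cong suc (≡.trans e₂ (≡.sym e₁)))) ¬dy
        ... | down e₁ _ _ _ _ | up e₂ _ _ _ _ | down e₃ _ _ _ _ =
          contradiction (≡.trans e₃ (≡.trans (≡.sym e₂) e₁)) ¬dy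
        ... | down e₁ _ _ _ _ | down e₂ _ _ _ _ | up e₃ _ _ _ _ =
          contradiction (≡.trans (ℕ.suc-injective (≡.trans (≡.sym e₃) e₂)) e₁) ¬dy

      -- Conjugation by diag (q ^ (d y choose 2)) makes A symmetric.
      κ : ℕ → Carrier
      κ zero    = 1#
      κ (suc k) = κ k * φ (q ℕ.^ k)

      κ-symmetric : ∀ y z → κ (d y) * A y z ≈ κ (d z) * A z y
      κ-symmetric y z with step y z
      ... | none e e′ _ _ = trans (trans (*-congˡ e) (zeroʳ _)) (sym (trans (*-congˡ e′) (zeroʳ _)))
      ... | up dy e e′ _ _ = trans (trans (*-congˡ e) (*-identityʳ _))
        (trans (reflexive (≡.cong κ dy)) (*-congˡ (sym e′)))
      ... | down dz e e′ _ _ = sym (trans (trans (*-congˡ e′) (*-identityʳ _))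
        (trans (reflexive (≡.cong κ dz)) (*-congˡ (sym e))))

      κ-path : ∀ x z w y → κ (d x) * path x z w y ≈ κ (d y) * path y w z x
      κ-path x z w y = begin
        κ (d x) * (A x z * (A z w * A w y))  ≈⟨ *-assoc _ _ _ ⟨
        κ (d x) * A x z * (A z w * A w y)    ≈⟨ *-congʳ (κ-symmetric x z) ⟩
        κ (d z) * A z x * (A z w * A w y)
          ≈⟨ solve 4 (λ k a b c → k :* a :* (b :* c) := a :* (k :* b :* c)) refl (κ (d z)) (A z x) (A z w) (A w y) ⟩
        A z x * (κ (d z) * A z w * A w y)    ≈⟨ *-congˡ (*-congʳ (κ-symmetric z w)) ⟩
        A z x * (κ (d w) * A w z * A w y)
          ≈⟨ solve 4 (λ k a b c → a :* (k :* b :* c) := a :* b :* (k :* c)) refl (κ (d w)) (A z x) (A w z) (A w y) ⟩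
        A z x * A w z * (κ (d w) * A w y)    ≈⟨ *-congˡ (κ-symmetric w y) ⟩
        A z x * A w z * (κ (d y) * A y w)
          ≈⟨ solve 4 (λ k a b c → a :* b :* (k :* c) := k :* (c :* (b :* a))) refl (κ (d y)) (A z x) (A w z) (A y w) ⟩
        κ (d y) * (A y w * (A w z * A z x))  ∎

      -- Reversing a path exchanges `x` with `y` and `z` with `w`, which turns `Φ⁺` into `Φ⁻`. Up to
      -- `κ`, the relation at `(x , y)` is thus the one at `(y , x)` with its sides exchanged, and
      -- the lowering case follows from the raising case.
      κ-S : ∀ x y → κ (d x) * S⁺ x y ≈ κ (d y) * S⁻ y x
      κ-S x y = begin
        κ (d x) * S⁺ x y
          ≈⟨ ∑∑-*ˡ (κ (d x)) _ ⟨
        ∑∑ (λ z w → κ (d x) * path⁺ x z w y)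
          ≈⟨ ∑∑-cong (λ z w → trans (sym (*-assoc _ _ _)) (trans
               (*-cong (κ-path x z w y) (+-comm _ _)) (*-assoc _ _ _))) ⟩
        ∑∑ (λ z w → κ (d y) * path⁻ y w z x)
          ≈⟨ ∑-comm (λ z w → κ (d y) * path⁻ y w z x) ⟩
        ∑∑ (λ w z → κ (d y) * path⁻ y w z x)
          ≈⟨ ∑∑-*ˡ (κ (d y)) _ ⟩
        κ (d y) * S⁻ y x ∎

      module _ (Q-cancellable : Cancellable Q) where

        κ-cancellable : ∀ k → Cancellable (κ k)
        κ-cancellable zero    = cancellable-1
        κ-cancellable (suc k) = cancellable-* (κ-cancellable k) (power k)
          where
          power : ∀ k → Cancellable (φ (q ℕ.^ k))
          power zero    = cancellable-cong (sym φ-1) cancellable-1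
          power (suc k) = cancellable-cong (sym (φ-* q (q ℕ.^ k))) (cancellable-* Q-cancellable (power k))

        relation-lowering : ∀ {x y} → d y ≡ suc (d x) → Relation x y
        relation-lowering {x} {y} dy = cancel (κ-cancellable (d x)) (begin
          κ (d x) * (S⁺ x y + T * A x y * α x)                ≈⟨ expand (κ (d x)) _ _ _ ⟩
          κ (d x) * S⁺ x y + T * (κ (d x) * A x y) * α x      ≈⟨ +-cong (κ-S x y) (*-congʳ (*-congˡ (κ-symmetric x y))) ⟩
          κ (d y) * S⁻ y x + T * (κ (d y) * A y x) * α x      ≈⟨ expand (κ (d y)) _ _ _ ⟨
          κ (d y) * (S⁻ y x + T * A y x * α x)                ≈⟨ *-congˡ (relation-raising dy) ⟨
          κ (d y) * (S⁺ y x + T * A y x * α y)                ≈⟨ expand (κ (d y)) _ _ _ ⟩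
          κ (d y) * S⁺ y x + T * (κ (d y) * A y x) * α y      ≈⟨ +-cong (κ-S y x) (*-congʳ (*-congˡ (κ-symmetric y x))) ⟩
          κ (d x) * S⁻ x y + T * (κ (d x) * A x y) * α y      ≈⟨ expand (κ (d x)) _ _ _ ⟨
          κ (d x) * (S⁻ x y + T * A x y * α y)                ∎)
          where
          expand : ∀ k S A b → k * (S + T * A * b) ≈ k * S + T * (k * A) * b
          expand k S A b = solve 5 (λ k S T A b → k :* (S :+ T :* A :* b) := k :* S :+ T :* (k :* A) :* b)
            refl k S T A b

        relation : ∀ x y → Relation x y
        relation x y with d x ℕ.≟ suc (d y) | d y ℕ.≟ suc (d x)
        ... | yes dx | _      = relation-raising dx
        ... | no _   | yes dy = relation-lowering dy
        ... | no ¬dx | no ¬dy = relation-far ¬dx ¬dy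

    -- Pairing the relation with a left and a right eigenvector

    apply : (Fin n → Carrier) → Fin n → Carrier
    apply f x = sum λ z → A x z * f z

    ∑-linear : ∀ {m} (M f g : Fin m → Carrier) b c →
      sum (λ y → M y * (b * f y + c * g y)) ≈ b * sum (λ y → M y * f y) + c * sum (λ y → M y * g y)
    ∑-linear M f g b c = begin
      sum (λ y → M y * (b * f y + c * g y))
        ≈⟨ sum-cong-≋ (λ y → solve 5 (λ M b f c g → M :* (b :* f :+ c :* g) := b :* (M :* f) :+ c :* (M :* g))
             refl (M y) b (f y) c (g y)) ⟩
      sum (λ y → b * (M y * f y) + c * (M y * g y))
        ≈⟨ ∑-distrib-+ (λ y → b * (M y * f y)) (λ y → c * (M y * g y)) ⟩
      sum (λ y → b * (M y * f y)) + sum (λ y → c * (M y * g y))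
        ≈⟨ +-cong (*-distribˡ-sum b (λ y → M y * f y)) (*-distribˡ-sum c (λ y → M y * g y)) ⟨
      b * sum (λ y → M y * f y) + c * sum (λ y → M y * g y) ∎

    -- The sum over paths becomes three successive applications of `A`. The weight stays innermost,
    -- to be moved outwards to the vertex on which it depends.
    nested : ∀ x (g : Fin n → Fin n → Fin n → Carrier) (v : Fin n → Carrier) →
      sum (λ y → ∑∑ (λ z w → path x z w y * g z w y) * v y) ≈
      sum λ z → A x z * sum λ w → A z w * sum λ y → A w y * (g z w y * v y)
    nested x g v = begin
      sum (λ y → ∑∑ (λ z w → path x z w y * g z w y) * v y)
        ≈⟨ sum-cong-≋ (λ y → ∑∑-*ʳ (v y) _) ⟨
      sum (λ y → ∑∑ λ z w → path x z w y * g z w y * v y)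
        ≈⟨ ∑-comm (λ y z → sum λ w → path x z w y * g z w y * v y) ⟩
      sum (λ z → sum λ y → sum λ w → path x z w y * g z w y * v y)
        ≈⟨ sum-cong-≋ (λ z → ∑-comm (λ y w → path x z w y * g z w y * v y)) ⟩
      sum (λ z → sum λ w → sum λ y → path x z w y * g z w y * v y)
        ≈⟨ sum-cong-≋ (λ z → sum-cong-≋ λ w → sum-cong-≋ λ y →
             solve 5 (λ a b c g v → a :* (b :* c) :* g :* v := a :* (b :* (c :* (g :* v))))
               refl (A x z) (A z w) (A w y) (g z w y) (v y)) ⟩
      sum (λ z → sum λ w → sum λ y → A x z * (A z w * (A w y * (g z w y * v y))))
        ≈⟨ sum-cong-≋ (λ z → sum-cong-≋ λ w → trans
             (sym (*-distribˡ-sum (A x z) (λ y → A z w * (A w y * (g z w y * v y)))))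
             (*-congˡ (sym (*-distribˡ-sum (A z w) (λ y → A w y * (g z w y * v y)))))) ⟩
      sum (λ z → sum λ w → A x z * (A z w * sum λ y → A w y * (g z w y * v y)))
        ≈⟨ sum-cong-≋ (λ z → *-distribˡ-sum (A x z) (λ w → A z w * sum λ y → A w y * (g z w y * v y))) ⟨
      sum (λ z → A x z * sum λ w → A z w * sum λ y → A w y * (g z w y * v y)) ∎

    module _ (relation : ∀ x y → Relation x y) {r v : Fin n → Carrier} {ϑ μ}
             (left  : ∀ z → sum (λ x → r x * A x z) ≈ ϑ * r z)
             (right : ∀ x → apply v x ≈ μ * v x) where

      pair : (Fin n → Carrier) → Carrier
      pair f = sum λ x → r x * f x

      pair-apply : ∀ f → pair (apply f) ≈ ϑ * pair f
      pair-apply f = begin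
        sum (λ x → r x * sum λ z → A x z * f z)
          ≈⟨ sum-cong-≋ (λ x → trans (*-distribˡ-sum (r x) (λ z → A x z * f z))
               (sum-cong-≋ λ z → sym (*-assoc (r x) (A x z) (f z)))) ⟩
        sum (λ x → sum λ z → r x * A x z * f z)
          ≈⟨ ∑-comm (λ x z → r x * A x z * f z) ⟩
        sum (λ z → sum λ x → r x * A x z * f z)
          ≈⟨ sum-cong-≋ (λ z → trans (sym (*-distribʳ-sum (f z) (λ x → r x * A x z)))
               (trans (*-congʳ (left z)) (*-assoc ϑ (r z) (f z)))) ⟩
        sum (λ z → ϑ * (r z * f z))
          ≈⟨ *-distribˡ-sum ϑ (λ z → r z * f z) ⟨
        ϑ * sum (λ z → r z * f z) ∎

      u : Fin n → Carrier
      u y = α y * v y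

      -- Where `A` acts directly on `v` it becomes `μ`; elsewhere it acts on `u`, which is `A*`
      -- applied to `v`. The factor `1#` gives the sum the two-term shape required by `∑-linear`.
      lhs : ∀ x → sum (λ y → (S⁺ x y + T * A x y * α x) * v y) ≈
                  Q * Q * apply (apply (apply u)) x + 1# * (Q * s * (μ * μ) * apply u x + T * μ * u x)
      lhs x = begin
        sum (λ y → (S⁺ x y + T * A x y * α x) * v y)
          ≈⟨ sum-cong-≋ (λ y → solve 5 (λ S T A a v → (S :+ T :* A :* a) :* v := S :* v :+ T :* a :* (A :* v))
               refl (S⁺ x y) T (A x y) (α x) (v y)) ⟩
        sum (λ y → S⁺ x y * v y + T * α x * (A x y * v y))
          ≈⟨ trans (∑-distrib-+ (λ y → S⁺ x y * v y) (λ y → T * α x * (A x y * v y)))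
               (+-cong (nested x (λ z w y → Φ⁺ (α y) (α z)) v)
                 (trans (sym (*-distribˡ-sum (T * α x) (λ y → A x y * v y))) (*-congˡ (right x)))) ⟩
        sum (λ z → A x z * sum λ w → A z w * sum λ y → A w y * (Φ⁺ (α y) (α z) * v y)) + T * α x * (μ * v x)
          ≈⟨ +-congʳ (sum-cong-≋ λ z → *-congˡ (sum-cong-≋ λ w → *-congˡ (inner z w))) ⟩
        sum (λ z → A x z * sum λ w → A z w * (Q * Q * apply u w + Q * s * α z * μ * v w)) + T * α x * (μ * v x)
          ≈⟨ +-congʳ (sum-cong-≋ λ z → *-congˡ (trans (∑-linear (A z) (apply u) v (Q * Q) (Q * s * α z * μ))
               (+-congˡ (*-congˡ (right z))))) ⟩
        sum (λ z → A x z * (Q * Q * apply (apply u) z + Q * s * α z * μ * (μ * v z))) + T * α x * (μ * v x)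
          ≈⟨ +-cong (sum-cong-≋ λ z → *-congˡ (+-congˡ
               (solve 5 (λ Q s a m v → Q :* s :* a :* m :* (m :* v) := Q :* s :* (m :* m) :* (a :* v)) refl Q s (α z) μ (v z))))
               (solve 4 (λ T a m v → T :* a :* (m :* v) := T :* m :* (a :* v)) refl T (α x) μ (v x)) ⟩
        sum (λ z → A x z * (Q * Q * apply (apply u) z + Q * s * (μ * μ) * u z)) + T * μ * u x
          ≈⟨ +-congʳ (∑-linear (A x) (apply (apply u)) u (Q * Q) (Q * s * (μ * μ))) ⟩
        Q * Q * apply (apply (apply u)) x + Q * s * (μ * μ) * apply u x + T * μ * u x
          ≈⟨ trans (+-assoc _ _ _) (+-congˡ (sym (*-identityˡ _))) ⟩
        Q * Q * apply (apply (apply u)) x + 1# * (Q * s * (μ * μ) * apply u x + T * μ * u x) ∎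
        where
        inner : ∀ z w → sum (λ y → A w y * (Φ⁺ (α y) (α z) * v y)) ≈ Q * Q * apply u w + Q * s * α z * μ * v w
        inner z w = begin
          sum (λ y → A w y * (Φ⁺ (α y) (α z) * v y))
            ≈⟨ sum-cong-≋ (λ y → *-congˡ (solve 5 (λ Q s a b v →
                 (Q :* Q :* a :+ Q :* s :* b) :* v := Q :* Q :* (a :* v) :+ Q :* s :* b :* v) refl Q s (α y) (α z) (v y))) ⟩
          sum (λ y → A w y * (Q * Q * u y + Q * s * α z * v y))
            ≈⟨ ∑-linear (A w) u v (Q * Q) (Q * s * α z) ⟩
          Q * Q * apply u w + Q * s * α z * apply v w
            ≈⟨ +-congˡ (trans (*-congˡ (right w)) (sym (*-assoc _ _ _))) ⟩
          Q * Q * apply u w + Q * s * α z * μ * v w ∎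

      rhs : ∀ x → sum (λ y → (S⁻ x y + T * A x y * α y) * v y) ≈
                  Q * s * μ * apply (apply u) x + 1# * (Q * Q * (μ * μ * μ) * u x + T * apply u x)
      rhs x = begin
        sum (λ y → (S⁻ x y + T * A x y * α y) * v y)
          ≈⟨ sum-cong-≋ (λ y → solve 5 (λ S T A a v → (S :+ T :* A :* a) :* v := S :* v :+ T :* (A :* (a :* v)))
               refl (S⁻ x y) T (A x y) (α y) (v y)) ⟩
        sum (λ y → S⁻ x y * v y + T * (A x y * u y))
          ≈⟨ trans (∑-distrib-+ (λ y → S⁻ x y * v y) (λ y → T * (A x y * u y)))
               (+-cong (nested x (λ z w y → Φ⁻ (α w) (α x)) v) (sym (*-distribˡ-sum T (λ y → A x y * u y)))) ⟩
        sum (λ z → A x z * sum λ w → A z w * sum λ y → A w y * (Φ⁻ (α w) (α x) * v y)) + T * apply u x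
          ≈⟨ +-congʳ (sum-cong-≋ λ z → *-congˡ {x = A x z} (sum-cong-≋ λ w → *-congˡ {x = A z w} (inner w))) ⟩
        sum (λ z → A x z * sum λ w → A z w * (Q * s * μ * u w + Q * Q * α x * μ * v w)) + T * apply u x
          ≈⟨ +-congʳ (sum-cong-≋ λ z → *-congˡ (trans (∑-linear (A z) u v (Q * s * μ) (Q * Q * α x * μ))
               (+-congˡ (*-congˡ (right z))))) ⟩
        sum (λ z → A x z * (Q * s * μ * apply u z + Q * Q * α x * μ * (μ * v z))) + T * apply u x
          ≈⟨ +-congʳ (sum-cong-≋ λ z → *-congˡ (+-congˡ (sym (*-assoc _ μ (v z))))) ⟩
        sum (λ z → A x z * (Q * s * μ * apply u z + Q * Q * α x * μ * μ * v z)) + T * apply u x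
          ≈⟨ +-congʳ (trans (∑-linear (A x) (apply u) v (Q * s * μ) (Q * Q * α x * μ * μ)) (+-congˡ (*-congˡ (right x)))) ⟩
        Q * s * μ * apply (apply u) x + Q * Q * α x * μ * μ * (μ * v x) + T * apply u x
          ≈⟨ +-congʳ (+-congˡ (solve 4 (λ Q a m v →
               Q :* Q :* a :* m :* m :* (m :* v) := Q :* Q :* (m :* m :* m) :* (a :* v)) refl Q (α x) μ (v x))) ⟩
        Q * s * μ * apply (apply u) x + Q * Q * (μ * μ * μ) * u x + T * apply u x
          ≈⟨ trans (+-assoc _ _ _) (+-congˡ (sym (*-identityˡ _))) ⟩
        Q * s * μ * apply (apply u) x + 1# * (Q * Q * (μ * μ * μ) * u x + T * apply u x) ∎
        where
        inner : ∀ w → sum (λ y → A w y * (Φ⁻ (α w) (α x) * v y)) ≈ Q * s * μ * u w + Q * Q * α x * μ * v w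
        inner w = begin
          sum (λ y → A w y * (Φ⁻ (α w) (α x) * v y))
            ≈⟨ sum-cong-≋ (λ y → solve 3 (λ a k v → a :* (k :* v) := k :* (a :* v)) refl (A w y) (Φ⁻ (α w) (α x)) (v y)) ⟩
          sum (λ y → Φ⁻ (α w) (α x) * (A w y * v y))
            ≈⟨ *-distribˡ-sum (Φ⁻ (α w) (α x)) (λ y → A w y * v y) ⟨
          Φ⁻ (α w) (α x) * apply v w
            ≈⟨ *-congˡ (right w) ⟩
          Φ⁻ (α w) (α x) * (μ * v w)
            ≈⟨ solve 6 (λ Q s a b m v → (Q :* s :* a :+ Q :* Q :* b) :* (m :* v) :=
                 Q :* s :* m :* (a :* v) :+ Q :* Q :* b :* m :* v) refl Q s (α w) (α x) μ (v w) ⟩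
          Q * s * μ * u w + Q * Q * α x * μ * v w ∎

      -- Between `r` and `v`, every `A` to the left of `A*` acts as `ϑ` and every `A` to the right
      -- as `μ`, so each word is a monomial times the single number `pair u`.
      eigenvalue-relation :
        (Q * Q * (ϑ * ϑ * ϑ) + Q * s * (μ * μ) * ϑ + T * μ) * pair u ≈
        (Q * s * μ * (ϑ * ϑ) + Q * Q * (μ * μ * μ) + T * ϑ) * pair u
      eigenvalue-relation = begin
        (Q * Q * (ϑ * ϑ * ϑ) + Q * s * (μ * μ) * ϑ + T * μ) * pair u
          ≈⟨ solve 6 (λ Q s T t m p →
               (Q :* Q :* (t :* t :* t) :+ Q :* s :* (m :* m) :* t :+ T :* m) :* p :=
               Q :* Q :* (t :* (t :* (t :* p))) :+ con 1 :* (Q :* s :* (m :* m) :* (t :* p) :+ T :* m :* p))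
               refl Q s T ϑ μ (pair u) ⟩
        Q * Q * (ϑ * (ϑ * (ϑ * pair u))) + 1# * (Q * s * (μ * μ) * (ϑ * pair u) + T * μ * pair u)
          ≈⟨ +-cong (*-congˡ cubed) (*-congˡ (+-congʳ (*-congˡ (pair-apply u)))) ⟨
        Q * Q * pair (apply (apply (apply u))) + 1# * (Q * s * (μ * μ) * pair (apply u) + T * μ * pair u)
          ≈⟨ +-congˡ (*-congˡ (∑-linear r (apply u) u (Q * s * (μ * μ)) (T * μ))) ⟨
        Q * Q * pair (apply (apply (apply u))) + 1# * pair (λ x → Q * s * (μ * μ) * apply u x + T * μ * u x)
          ≈⟨ ∑-linear r (apply (apply (apply u))) (λ x → Q * s * (μ * μ) * apply u x + T * μ * u x) (Q * Q) 1# ⟨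
        pair (λ x → Q * Q * apply (apply (apply u)) x + 1# * (Q * s * (μ * μ) * apply u x + T * μ * u x))
          ≈⟨ sum-cong-≋ (λ x → *-congˡ (lhs x)) ⟨
        pair (λ x → sum λ y → (S⁺ x y + T * A x y * α x) * v y)
          ≈⟨ sum-cong-≋ (λ x → *-congˡ (sum-cong-≋ λ y → *-congʳ (relation x y))) ⟩
        pair (λ x → sum λ y → (S⁻ x y + T * A x y * α y) * v y)
          ≈⟨ sum-cong-≋ (λ x → *-congˡ (rhs x)) ⟩
        pair (λ x → Q * s * μ * apply (apply u) x + 1# * (Q * Q * (μ * μ * μ) * u x + T * apply u x))
          ≈⟨ ∑-linear r (apply (apply u)) (λ x → Q * Q * (μ * μ * μ) * u x + T * apply u x) (Q * s * μ) 1# ⟩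
        Q * s * μ * pair (apply (apply u)) + 1# * pair (λ x → Q * Q * (μ * μ * μ) * u x + T * apply u x)
          ≈⟨ +-congˡ (*-congˡ (∑-linear r u (apply u) (Q * Q * (μ * μ * μ)) T)) ⟩
        Q * s * μ * pair (apply (apply u)) + 1# * (Q * Q * (μ * μ * μ) * pair u + T * pair (apply u))
          ≈⟨ +-cong (*-congˡ (trans (pair-apply (apply u)) (*-congˡ (pair-apply u))))
               (*-congˡ (+-congˡ (*-congˡ (pair-apply u)))) ⟩
        Q * s * μ * (ϑ * (ϑ * pair u)) + 1# * (Q * Q * (μ * μ * μ) * pair u + T * (ϑ * pair u))
          ≈⟨ solve 6 (λ Q s T t m p →
               (Q :* s :* m :* (t :* t) :+ Q :* Q :* (m :* m :* m) :+ T :* t) :* p :=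
               Q :* s :* m :* (t :* (t :* p)) :+ con 1 :* (Q :* Q :* (m :* m :* m) :* p :+ T :* (t :* p)))
               refl Q s T ϑ μ (pair u) ⟨
        (Q * s * μ * (ϑ * ϑ) + Q * Q * (μ * μ * μ) + T * ϑ) * pair u ∎
        where
        cubed : pair (apply (apply (apply u))) ≈ ϑ * (ϑ * (ϑ * pair u))
        cubed = trans (pair-apply (apply (apply u))) (*-congˡ (trans (pair-apply (apply u)) (*-congˡ (pair-apply u))))

-- The ring solver with integer coefficients, (m , n) standing for m - n.
module DifferenceSolver (R : CommutativeRing 0ℓ 0ℓ) where

  open CommutativeRing R hiding (zero)
  open import Algebra.Properties.Ring ring using (-0#≈0#; -‿+-comm; ⁻¹-anti-homo-//; x[y-z]≈xy-xz; [y-z]x≈yx-zx)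
  open import Algebra.Properties.CommutativeSemigroup +-commutativeSemigroup using (interchange)
  open import Algebra.Properties.Semiring.Mult.TCOptimised semiring using (×-homo-+; ×1-homo-*) renaming (_×_ to _×′_)
  open SetoidReasoning setoid

  -- Normal forms are compared syntactically, so equal coefficients must coincide.
  reduce : ℕ → ℕ → ℕ × ℕ
  reduce a b = a ℕ.∸ b , b ℕ.∸ a

  differences : RawRing 0ℓ 0ℓ
  differences = record
    { Carrier = ℕ × ℕ
    ; _≈_     = _≡_
    ; _+_     = λ (a , b) (c , d) → reduce (a ℕ.+ c) (b ℕ.+ d)
    ; _*_     = λ (a , b) (c , d) → reduce (a ℕ.* c ℕ.+ b ℕ.* d) (a ℕ.* d ℕ.+ b ℕ.* c)
    ; -_      = λ (a , b) → b , a
    ; 0#      = 0 , 0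
    ; 1#      = 1 , 0
    }

  -- The separate case of second component zero makes `(0 , 0)` and `(1 , 0)` evaluate to `0#` and
  -- `1#` themselves, so that solved identities have exactly the form in which they are stated.
  ⟦_⟧ : ℕ × ℕ → Carrier
  ⟦ a , zero ⟧  = a ×′ 1#
  ⟦ a , suc b ⟧ = a ×′ 1# - suc b ×′ 1#

  ⟦⟧≈- : ∀ p → ⟦ p ⟧ ≈ proj₁ p ×′ 1# - proj₂ p ×′ 1#
  ⟦⟧≈- (a , zero)  = sym (trans (+-congˡ -0#≈0#) (+-identityʳ _))
  ⟦⟧≈- (a , suc b) = refl

  private
    φ : ℕ → Carrier
    φ n = n ×′ 1#

    -‿interchange : ∀ w x y z → (w + x) - (y + z) ≈ (w - y) + (x - z)
    -‿interchange w x y z = trans (+-congˡ (sym (-‿+-comm y z))) (interchange w x (- y) (- z))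

    -‿product : ∀ w x y z → (w - x) * (y - z) ≈ (w * y + x * z) - (w * z + x * y)
    -‿product w x y z = begin
      (w - x) * (y - z)                        ≈⟨ [y-z]x≈yx-zx (y - z) w x ⟩
      w * (y - z) - x * (y - z)                ≈⟨ +-cong (x[y-z]≈xy-xz w y z) (-‿cong (x[y-z]≈xy-xz x y z)) ⟩
      (w * y - w * z) - (x * y - x * z)        ≈⟨ +-congˡ (⁻¹-anti-homo-// (x * y) (x * z)) ⟩
      (w * y - w * z) + (x * z - x * y)        ≈⟨ -‿interchange (w * y) (x * z) (w * z) (x * y) ⟨
      (w * y + x * z) - (w * z + x * y)        ∎

    -‿cancel : ∀ w x y z → w + z ≈ y + x → w - x ≈ y - z
    -‿cancel w x y z e = begin
      w - x                    ≈⟨ +-congʳ (trans (sym (+-identityʳ w)) (+-congˡ (sym (-‿inverseʳ z)))) ⟩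
      (w + (z - z)) - x        ≈⟨ +-congʳ (sym (+-assoc w z (- z))) ⟩
      ((w + z) - z) - x        ≈⟨ +-congʳ (+-congʳ e) ⟩
      ((y + x) - z) - x        ≈⟨ +-congʳ (trans (+-assoc y x (- z)) (trans (+-congˡ (+-comm x (- z))) (sym (+-assoc y (- z) x)))) ⟩
      ((y - z) + x) - x        ≈⟨ trans (+-assoc (y - z) x (- x)) (trans (+-congˡ (-‿inverseʳ x)) (+-identityʳ _)) ⟩
      y - z                    ∎

    ⟦reduce⟧ : ∀ a b → ⟦ reduce a b ⟧ ≈ φ a - φ b
    ⟦reduce⟧ a b = trans (⟦⟧≈- (reduce a b)) (-‿cancel (φ (a ℕ.∸ b)) (φ (b ℕ.∸ a)) (φ a) (φ b)
      (trans (sym (×-homo-+ 1# (a ℕ.∸ b) b)) (trans (reflexive (≡.cong φ (∸-balance a b))) (×-homo-+ 1# a (b ℕ.∸ a)))))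
      where
      ∸-balance : ∀ a b → a ℕ.∸ b ℕ.+ b ≡ a ℕ.+ (b ℕ.∸ a)
      ∸-balance zero    zero    = ≡.refl
      ∸-balance zero    (suc b) = ≡.refl
      ∸-balance (suc a) zero    = ≡.refl
      ∸-balance (suc a) (suc b) = ≡.trans (ℕ.+-suc (a ℕ.∸ b) b) (≡.cong suc (∸-balance a b))

  homomorphism : differences -Raw-AlmostCommutative⟶ fromCommutativeRing R
  homomorphism = record
    { ⟦_⟧    = ⟦_⟧
    ; +-homo = λ p@(a , b) r@(c , d) → begin
        ⟦ reduce (a ℕ.+ c) (b ℕ.+ d) ⟧   ≈⟨ ⟦reduce⟧ (a ℕ.+ c) (b ℕ.+ d) ⟩
        φ (a ℕ.+ c) - φ (b ℕ.+ d)        ≈⟨ +-cong (×-homo-+ 1# a c) (-‿cong (×-homo-+ 1# b d)) ⟩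
        (φ a + φ c) - (φ b + φ d)        ≈⟨ -‿interchange (φ a) (φ c) (φ b) (φ d) ⟩
        (φ a - φ b) + (φ c - φ d)        ≈⟨ +-cong (⟦⟧≈- p) (⟦⟧≈- r) ⟨
        ⟦ p ⟧ + ⟦ r ⟧                    ∎
    ; *-homo = λ p@(a , b) r@(c , d) → begin
        ⟦ reduce (a ℕ.* c ℕ.+ b ℕ.* d) (a ℕ.* d ℕ.+ b ℕ.* c) ⟧
          ≈⟨ ⟦reduce⟧ (a ℕ.* c ℕ.+ b ℕ.* d) (a ℕ.* d ℕ.+ b ℕ.* c) ⟩
        φ (a ℕ.* c ℕ.+ b ℕ.* d) - φ (a ℕ.* d ℕ.+ b ℕ.* c)
          ≈⟨ +-cong (sum-of-products a c b d) (-‿cong (sum-of-products a d b c)) ⟩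
        (φ a * φ c + φ b * φ d) - (φ a * φ d + φ b * φ c)  ≈⟨ -‿product (φ a) (φ b) (φ c) (φ d) ⟨
        (φ a - φ b) * (φ c - φ d)                          ≈⟨ *-cong (⟦⟧≈- p) (⟦⟧≈- r) ⟨
        ⟦ p ⟧ * ⟦ r ⟧                                      ∎
    ; -‿homo = λ p@(a , b) → trans (⟦⟧≈- (b , a)) (sym (trans (-‿cong (⟦⟧≈- p)) (⁻¹-anti-homo-// (φ a) (φ b))))
    ; 0-homo = refl
    ; 1-homo = refl
    }
    where
    sum-of-products : ∀ a b c d → φ (a ℕ.* b ℕ.+ c ℕ.* d) ≈ φ a * φ b + φ c * φ d
    sum-of-products a b c d = trans (×-homo-+ 1# (a ℕ.* b) (c ℕ.* d)) (+-cong (×1-homo-* a b) (×1-homo-* c d))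

  _≟_ : ∀ p r → Maybe (⟦ p ⟧ ≈ ⟦ r ⟧)
  p ≟ r with ≡-dec ℕ._≟_ ℕ._≟_ p r
  ... | no _       = nothing
  ... | yes ≡.refl = just refl

  open import Algebra.Solver.Ring differences (fromCommutativeRing R) homomorphism _≟_ public
    using (solve; _:=_; _:+_; _:*_; _:-_; con)

-- Factorization of the scalar

module Factorization (R : CommutativeRing 0ℓ 0ℓ) where

  open CommutativeRing R hiding (zero)
  open DifferenceSolver R

  -- Of degree two in `ϑ` and `μ`: the cofactor of `ϑ - μ` in the cubic expression of
  -- `cubic-factor`.
  cubic : Carrier → Carrier → Carrier → Carrier → Carrier
  cubic Q T ϑ μ = Q * Q * (ϑ * ϑ) + Q * Q * (μ * μ) - Q * (Q * Q + 1#) * (ϑ * μ) - T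

  cubic-factor : ∀ Q T ϑ μ → let s = Q * Q + Q + 1# in
    (Q * Q * (ϑ * ϑ * ϑ) + Q * s * (μ * μ) * ϑ + T * μ) - (Q * s * μ * (ϑ * ϑ) + Q * Q * (μ * μ * μ) + T * ϑ) ≈
    (ϑ - μ) * cubic Q T ϑ μ
  cubic-factor = solve 4 (λ Q T ϑ μ →
    let one = con (1 , 0); s = Q :* Q :+ Q :+ one in
    (Q :* Q :* (ϑ :* ϑ :* ϑ) :+ Q :* s :* (μ :* μ) :* ϑ :+ T :* μ)
      :- (Q :* s :* μ :* (ϑ :* ϑ) :+ Q :* Q :* (μ :* μ :* μ) :+ T :* ϑ) :=
    (ϑ :- μ) :* (Q :* Q :* (ϑ :* ϑ) :+ Q :* Q :* (μ :* μ) :- Q :* (Q :* Q :+ one) :* (ϑ :* μ) :- T)) refl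

  cubic-sym : ∀ Q T ϑ μ → cubic Q T ϑ μ ≈ cubic Q T μ ϑ
  cubic-sym = solve 4 (λ Q T ϑ μ → let one = con (1 , 0) in
    Q :* Q :* (ϑ :* ϑ) :+ Q :* Q :* (μ :* μ) :- Q :* (Q :* Q :+ one) :* (ϑ :* μ) :- T :=
    Q :* Q :* (μ :* μ) :+ Q :* Q :* (ϑ :* ϑ) :- Q :* (Q :* Q :+ one) :* (μ :* ϑ) :- T) refl

  difference-split : ∀ c x b t → c * (x * t - b) - c * (x - b * t) ≈ c * ((t - 1#) * (x + b))
  difference-split = solve 4 (λ c x b t →
    c :* (x :* t :- b) :- c :* (x :- b :* t) := c :* ((t :- con (1 , 0)) :* (x :+ b))) refl

  -- In the application `c` is the common factor of two eigenvalues and `x`, `t`, `b` are powers of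
  -- `√q`. For `t` a positive power only `t - Q` can vanish, which happens for doubled indices at
  -- distance 2.
  cubic-split : ∀ Q c x b t →
    cubic Q (c * c * ((Q - 1#) * (Q - 1#)) * (x * t * b) * ((Q + 1#) * (Q + 1#))) (c * (x * t - b)) (c * (x - b * t)) ≈
    c * c * ((t - Q) * (Q * t - 1#)) * ((x + Q * b) * (Q * x + b))
  cubic-split = solve 5 (λ Q c x b t →
    let one = con (1 , 0); ϑ = c :* (x :* t :- b); μ = c :* (x :- b :* t) in
    Q :* Q :* (ϑ :* ϑ) :+ Q :* Q :* (μ :* μ) :- Q :* (Q :* Q :+ one) :* (ϑ :* μ)
      :- c :* c :* ((Q :- one) :* (Q :- one)) :* (x :* t :* b) :* ((Q :+ one) :* (Q :+ one)) :=
    c :* c :* ((t :- Q) :* (Q :* t :- one)) :* ((x :+ Q :* b) :* (Q :* x :+ b))) refl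

  difference-of-squares : ∀ x → (x - 1#) * (x + 1#) ≈ x * x - 1#
  difference-of-squares = solve 1 (λ x → (x :- con (1 , 0)) :* (x :+ con (1 , 0)) := x :* x :- con (1 , 0)) refl

-- Separation of the eigenvalues

module Spectrum (R : CommutativeRing 0ℓ 0ℓ) where

  open CommutativeRing R hiding (zero)
  open Cancellation R
  open Factorization R
  open DifferenceSolver R
  open import Algebra.Properties.Semiring.Exp semiring using (_^_; ^-homo-*; ^-congʳ)
  open import Algebra.Properties.Group +-group using (x≈y⇒x∙y⁻¹≈ε)
  open import Algebra.Properties.Ring ring using ([y-z]x≈yx-zx; -‿distribˡ-*; ⁻¹-anti-homo-//; -0#≈0#)
  open SetoidReasoning setoid

  cancellable-neg : ∀ {x y} → Cancellable (x - y) → Cancellable (y - x)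
  cancellable-neg {x} {y} c z e = c z (begin
    (x - y) * z      ≈⟨ *-congʳ (⁻¹-anti-homo-// y x) ⟨
    - (y - x) * z    ≈⟨ -‿distribˡ-* (y - x) z ⟨
    - ((y - x) * z)  ≈⟨ -‿cong e ⟩
    - 0#             ≈⟨ -0#≈0# ⟩
    0#               ∎)

  cancel-difference : ∀ {x y z} → Cancellable (x - y) → x * z ≈ y * z → z ≈ 0#
  cancel-difference {x} {y} {z} c e = c z (trans ([y-z]x≈yx-zx z x y) (x≈y⇒x∙y⁻¹≈ε e))

  -- `σ` stands for the square root of `q` and `c₀` for the inverse of `q - 1`. Positivity of `σ`
  -- enters through `σ-sum-cancellable`; differences of powers of `σ` are reduced to integers
  -- instead.
  module Eigenvalues
    (φ : ℕ → Carrier) (φ-1 : φ 1 ≈ 1#)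
    (φ-+ : ∀ m n → φ (m ℕ.+ n) ≈ φ m + φ n) (φ-* : ∀ m n → φ (m ℕ.* n) ≈ φ m * φ n)
    (φ-cancellable : ∀ k → Cancellable (φ (suc k)))
    (q N M : ℕ) (1<q : 1 ℕ.< q) (σ : Carrier) (σ*σ≈q : σ * σ ≈ φ q)
    (σ-sum-cancellable : ∀ i j → Cancellable (σ ^ i + σ ^ j))
    (c₀ : Carrier) (c₀-inverse : c₀ * φ (q ℕ.∸ 1) ≈ 1#)
    where

    Q s T c : Carrier
    Q = φ q
    s = Q * Q + Q + 1#
    T = φ (q ℕ.^ (N ℕ.+ M)) * ((Q + 1#) * (Q + 1#))
    c = c₀ * σ ^ M

    θ : ℕ → Carrier
    θ k = c₀ * (σ ^ (2 ℕ.* N ℕ.∸ k) - σ ^ k) * σ ^ M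

    φ-pred : ∀ {m} → 1 ℕ.< m → φ m - 1# ≈ φ (m ℕ.∸ 1)
    φ-pred {suc m} _ = begin
      φ (suc m) - 1#        ≈⟨ +-congʳ (trans (φ-+ 1 m) (trans (+-congʳ φ-1) (+-comm 1# (φ m)))) ⟩
      φ m + 1# - 1#         ≈⟨ +-assoc (φ m) 1# (- 1#) ⟩
      φ m + (1# - 1#)       ≈⟨ +-congˡ (-‿inverseʳ 1#) ⟩
      φ m + 0#              ≈⟨ +-identityʳ (φ m) ⟩
      φ m                   ∎

    φ-pos-cancellable : ∀ {m} → 0 ℕ.< m → Cancellable (φ m)
    φ-pos-cancellable {suc m} _ = φ-cancellable m

    σ^k*σ^k : ∀ k → σ ^ k * σ ^ k ≈ φ (q ℕ.^ k)
    σ^k*σ^k zero    = trans (*-identityˡ 1#) (sym φ-1)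
    σ^k*σ^k (suc k) = begin
      σ * σ ^ k * (σ * σ ^ k)      ≈⟨ solve 2 (λ σ t → σ :* t :* (σ :* t) := σ :* σ :* (t :* t)) refl σ (σ ^ k) ⟩
      σ * σ * (σ ^ k * σ ^ k)      ≈⟨ *-cong σ*σ≈q (σ^k*σ^k k) ⟩
      φ q * φ (q ℕ.^ k)            ≈⟨ φ-* q (q ℕ.^ k) ⟨
      φ (q ℕ.^ suc k)              ∎

    Q*σ^k : ∀ k → Q * σ ^ k ≈ σ ^ (2 ℕ.+ k)
    Q*σ^k k = trans (*-congʳ (sym σ*σ≈q)) (*-assoc σ σ (σ ^ k))

    σ^2N : σ ^ (2 ℕ.* N) ≈ φ (q ℕ.^ N)
    σ^2N = trans (^-homo-* σ N (N ℕ.+ 0)) (trans (*-congˡ (^-congʳ σ (ℕ.+-identityʳ N))) (σ^k*σ^k N))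

    σ-cancellable : Cancellable σ
    σ-cancellable = cancellable-factor (cancellable-cong (sym σ*σ≈q) (φ-pos-cancellable (ℕ.<⇒≤ 1<q)))

    σ^-cancellable : ∀ k → Cancellable (σ ^ k)
    σ^-cancellable zero    = cancellable-1
    σ^-cancellable (suc k) = cancellable-* σ-cancellable (σ^-cancellable k)

    -- Multiplied by `σ ^ suc k + 1#` this difference becomes the positive integer `q ^ suc k - 1`.
    σ^suc-1-cancellable : ∀ k → Cancellable (σ ^ suc k - 1#)
    σ^suc-1-cancellable k = cancellable-factor (cancellable-cong (begin
      φ (q ℕ.^ suc k ℕ.∸ 1)            ≈⟨ φ-pred 1<q^ ⟨
      φ (q ℕ.^ suc k) - 1#             ≈⟨ +-congʳ (σ^k*σ^k (suc k)) ⟨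
      σ ^ suc k * σ ^ suc k - 1#       ≈⟨ difference-of-squares (σ ^ suc k) ⟨
      (σ ^ suc k - 1#) * (σ ^ suc k + 1#) ∎)
      (φ-pos-cancellable (ℕ.m<n⇒0<n∸m 1<q^)))
      where
      1<q^ : 1 ℕ.< q ℕ.^ suc k
      1<q^ = ℕ.^-monoʳ-< q 1<q {0} {suc k} ℕ.z<s

    c-cancellable : Cancellable c
    c-cancellable = cancellable-*
      (cancellable-factor (cancellable-cong (sym c₀-inverse) cancellable-1)) (σ^-cancellable M)

    module _ {k m : ℕ} (m≢0 : m ≢ 0) (m≢2 : m ≢ 2) (k+m≤2N : k ℕ.+ m ℕ.≤ 2 ℕ.* N) where

      private
        -- The exponents are chosen so that both eigenvalues are polynomials in natural powers:
        -- `σ ^ (2N - k)` is `x * t`, `σ ^ (k + m)` is `b * t`, and `x * t * b` is `q ^ N`.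
        x = σ ^ (2 ℕ.* N ℕ.∸ (k ℕ.+ m))
        t = σ ^ m
        b = σ ^ k

        x*t : x * t ≈ σ ^ (2 ℕ.* N ℕ.∸ k)
        x*t = trans (sym (^-homo-* σ (2 ℕ.* N ℕ.∸ (k ℕ.+ m)) m)) (^-congʳ σ (≡.trans
          (≡.cong (ℕ._+ m) (≡.sym (ℕ.∸-+-assoc (2 ℕ.* N) k m)))
          (ℕ.m∸n+n≡m (ℕ.m+n≤o⇒m≤o∸n m (≡.subst (ℕ._≤ 2 ℕ.* N) (ℕ.+-comm k m) k+m≤2N)))))

        x*t*b : x * t * b ≈ φ (q ℕ.^ N)
        x*t*b = trans (*-congʳ x*t) (trans (sym (^-homo-* σ (2 ℕ.* N ℕ.∸ k) k))
          (trans (^-congʳ σ (ℕ.m∸n+n≡m (ℕ.m+n≤o⇒m≤o k k+m≤2N))) σ^2N))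

        rearrange : ∀ y → c₀ * y * σ ^ M ≈ c * y
        rearrange y = trans (*-assoc c₀ y _) (trans (*-congˡ (*-comm y _)) (sym (*-assoc c₀ _ y)))

      θ-lower : θ k ≈ c * (x * t - b)
      θ-lower = trans (rearrange _) (*-congˡ (+-congʳ (sym x*t)))

      θ-upper : θ (k ℕ.+ m) ≈ c * (x - b * t)
      θ-upper = trans (rearrange _) (*-congˡ (+-congˡ (-‿cong (^-homo-* σ k m))))

      -- The square of `c` contributes `q ^ M` and the inverse square of `q - 1`, while `x * t * b`
      -- contributes `q ^ N`.
      T≈ : T ≈ c * c * ((Q - 1#) * (Q - 1#)) * (x * t * b) * ((Q + 1#) * (Q + 1#))
      T≈ = *-congʳ (sym (begin
        c * c * ((Q - 1#) * (Q - 1#)) * (x * t * b)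
          ≈⟨ solve 4 (λ c₀ s r X → c₀ :* s :* (c₀ :* s) :* (r :* r) :* X := c₀ :* r :* (c₀ :* r) :* (X :* (s :* s)))
               refl c₀ (σ ^ M) (Q - 1#) (x * t * b) ⟩
        c₀ * (Q - 1#) * (c₀ * (Q - 1#)) * (x * t * b * (σ ^ M * σ ^ M))
          ≈⟨ *-cong (*-cong unit unit) (*-cong x*t*b (σ^k*σ^k M)) ⟩
        1# * 1# * (φ (q ℕ.^ N) * φ (q ℕ.^ M))
          ≈⟨ trans (*-congʳ (*-identityˡ 1#)) (*-identityˡ _) ⟩
        φ (q ℕ.^ N) * φ (q ℕ.^ M)
          ≈⟨ φ-* (q ℕ.^ N) (q ℕ.^ M) ⟨
        φ (q ℕ.^ N ℕ.* q ℕ.^ M)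
          ≡⟨ ≡.cong φ (ℕ.^-distribˡ-+-* q N M) ⟨
        φ (q ℕ.^ (N ℕ.+ M)) ∎))
        where
        unit : c₀ * (Q - 1#) ≈ 1#
        unit = trans (*-congˡ (φ-pred 1<q)) c₀-inverse

      -- `Q` is the square of `σ`, so the difference is `Q` times `σ ^ (m - 2) - 1` for `m` above 2,
      -- and up to sign `σ` times `σ - 1` for `m` equal to 1. The excluded value 2 is the case of
      -- neighbouring indices.
      t-Q-cancellable : Cancellable (t - Q)
      t-Q-cancellable = go m m≢0 m≢2
        where
        go : ∀ m → m ≢ 0 → m ≢ 2 → Cancellable (σ ^ m - Q)
        go 0 m≢0 m≢2 = contradiction ≡.refl m≢0
        go 1 m≢0 m≢2 = cancellable-neg (cancellable-cong (begin
          σ * (σ ^ 1 - 1#)  ≈⟨ solve 2 (λ σ o → σ :* (σ :* o :- o) := σ :* σ :* o :- σ :* o) refl σ 1# ⟩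
          σ * σ * 1# - σ ^ 1 ≈⟨ +-congʳ (trans (*-identityʳ _) σ*σ≈q) ⟩
          Q - σ ^ 1         ∎) (cancellable-* σ-cancellable (σ^suc-1-cancellable 0)))
        go 2 m≢0 m≢2 = contradiction ≡.refl m≢2
        go (suc (suc (suc m))) m≢0 m≢2 = cancellable-cong (begin
          Q * (σ ^ suc m - 1#)        ≈⟨ solve 2 (λ Q t → Q :* (t :- con (1 , 0)) := Q :* t :- Q) refl Q (σ ^ suc m) ⟩
          Q * σ ^ suc m - Q           ≈⟨ +-congʳ (Q*σ^k (suc m)) ⟩
          σ ^ suc (suc (suc m)) - Q   ∎)
          (cancellable-* (φ-pos-cancellable (ℕ.<⇒≤ 1<q)) (σ^suc-1-cancellable m))

      difference-cancellable : Cancellable (θ k - θ (k ℕ.+ m))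
      difference-cancellable = cancellable-cong
        (sym (trans (+-cong θ-lower (-‿cong θ-upper)) (difference-split c x b t)))
        (cancellable-* c-cancellable (cancellable-* (t-1-cancellable m m≢0)
          (σ-sum-cancellable (2 ℕ.* N ℕ.∸ (k ℕ.+ m)) k)))
        where
        t-1-cancellable : ∀ m → m ≢ 0 → Cancellable (σ ^ m - 1#)
        t-1-cancellable zero    m≢0 = contradiction ≡.refl m≢0
        t-1-cancellable (suc m) _   = σ^suc-1-cancellable m

      cubic-cancellable : Cancellable (cubic Q T (θ k) (θ (k ℕ.+ m)))
      cubic-cancellable = cancellable-cong (sym (begin
        cubic Q T (θ k) (θ (k ℕ.+ m))
          ≈⟨ cubic-cong T≈ θ-lower θ-upper ⟩
        cubic Q _ (c * (x * t - b)) (c * (x - b * t))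
          ≈⟨ cubic-split Q c x b t ⟩
        c * c * ((t - Q) * (Q * t - 1#)) * ((x + Q * b) * (Q * x + b)) ∎))
        (cancellable-*
          (cancellable-* (cancellable-* c-cancellable c-cancellable)
            (cancellable-* t-Q-cancellable
              (cancellable-cong (+-congʳ (sym (Q*σ^k m))) (σ^suc-1-cancellable (suc m)))))
          (cancellable-*
            (cancellable-cong (+-congˡ (sym (Q*σ^k k))) (σ-sum-cancellable i (2 ℕ.+ k)))
            (cancellable-cong (+-congʳ (sym (Q*σ^k i))) (σ-sum-cancellable (2 ℕ.+ i) k))))
        where
        i = 2 ℕ.* N ℕ.∸ (k ℕ.+ m)
        cubic-cong : ∀ {T T′ ϑ ϑ′ μ μ′} → T ≈ T′ → ϑ ≈ ϑ′ → μ ≈ μ′ → cubic Q T ϑ μ ≈ cubic Q T′ ϑ′ μ′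
        cubic-cong eT eϑ eμ = +-cong (+-cong
          (+-cong (*-congˡ (*-cong eϑ eϑ)) (*-congˡ (*-cong eμ eμ)))
          (-‿cong (*-congˡ (*-cong eϑ eμ)))) (-‿cong eT)

    -- Indices being doubled, `i - j = 1` reads `k ≡ 2 + l`. Since `cubic` is symmetric and
    -- `θ k - θ l` changes only its sign, the smaller index may be taken as the lower one.
    eigenvalue-separation : ∀ k l {S} → k ℕ.≤ 2 ℕ.* N → l ℕ.≤ 2 ℕ.* N →
      k ≢ l → k ≢ 2 ℕ.+ l → l ≢ 2 ℕ.+ k →
      (Q * Q * (θ k * θ k * θ k) + Q * s * (θ l * θ l) * θ k + T * θ l) * S ≈
      (Q * s * θ l * (θ k * θ k) + Q * Q * (θ l * θ l * θ l) + T * θ k) * S →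
      S ≈ 0#
    eigenvalue-separation k l {S} k≤ l≤ k≢l k≢2+l l≢2+k e = cancel-difference
      (cancellable-cong (sym (cubic-factor Q T (θ k) (θ l))) (cancellable-* (proj₁ factors) (proj₂ factors))) e
      where
      ordered : ∀ {k l} → k ℕ.< l → l ℕ.≤ 2 ℕ.* N → l ≢ 2 ℕ.+ k →
                Cancellable (θ k - θ l) × Cancellable (cubic Q T (θ k) (θ l))
      ordered {k} {l} k<l l≤ l≢2+k = ≡.subst
        (λ l → Cancellable (θ k - θ l) × Cancellable (cubic Q T (θ k) (θ l))) k+m≡l
        (difference-cancellable m≢0 m≢2 k+m≤ , cubic-cancellable m≢0 m≢2 k+m≤)
        where
        m = l ℕ.∸ k
        k+m≡l : k ℕ.+ m ≡ l
        k+m≡l = ℕ.m+[n∸m]≡n (ℕ.<⇒≤ k<l)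
        k+m≤ : k ℕ.+ m ℕ.≤ 2 ℕ.* N
        k+m≤ = ≡.subst (ℕ._≤ 2 ℕ.* N) (≡.sym k+m≡l) l≤
        m≢0 : m ≢ 0
        m≢0 = ℕ.m>n⇒m∸n≢0 k<l
        m≢2 : m ≢ 2
        m≢2 e = l≢2+k (≡.trans (≡.sym k+m≡l) (≡.trans (≡.cong (k ℕ.+_) e) (ℕ.+-comm k 2)))

      factors : Cancellable (θ k - θ l) × Cancellable (cubic Q T (θ k) (θ l))
      factors with ℕ.<-cmp k l
      ... | tri< k<l _ _ = ordered k<l l≤ l≢2+k
      ... | tri≈ _ k≡l _ = contradiction k≡l k≢l
      ... | tri> _ _ l<k = let d , p = ordered l<k k≤ k≢2+l in
        cancellable-neg d , cancellable-cong (cubic-sym Q T (θ l) (θ k)) p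

-- Matrices acting on vectors, and projections onto eigenspaces

module MatrixAction (R : CommutativeRing 0ℓ 0ℓ) where

  open CommutativeRing R hiding (zero)
  open import Algebra.Properties.Semiring.Sum semiring
    using (sum; sum-cong-≋; sum-replicate-zero; ∑-distrib-+; ∑-comm; *-distribˡ-sum)
  open import Algebra.Properties.CommutativeSemigroup *-commutativeSemigroup using (x∙yz≈y∙xz)
  open SetoidReasoning setoid

  infixr 7 _·ᵛ_
  infix 4 _≋ᵛ_

  _·ᵛ_ : ∀ {n} → (Fin n → Fin n → Carrier) → (Fin n → Carrier) → Fin n → Carrier
  (A ·ᵛ v) x = sum λ y → A x y * v y

  _≋ᵛ_ : ∀ {n} → (Fin n → Carrier) → (Fin n → Carrier) → Set
  v ≋ᵛ w = ∀ y → v y ≈ w y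

  sum-single : ∀ {n} {f : Fin n → Carrier} i → (∀ j → j ≢ i → f j ≈ 0#) → sum f ≈ f i
  sum-single {suc n} {f} zero f≈0 = trans
    (+-congˡ (trans (sum-cong-≋ λ j → f≈0 (suc j) λ ()) (sum-replicate-zero n))) (+-identityʳ _)
  sum-single {suc n} {f} (suc i) f≈0 = trans
    (+-cong (f≈0 zero λ ()) (sum-single i λ j j≢i → f≈0 (suc j) (j≢i ∘ Fin.suc-injective))) (+-identityˡ _)

  δ : ∀ {n} → Fin n → Fin n → Carrier
  δ y z = if does (z Fin.≟ y) then 1# else 0#

  ·-δ : ∀ {n} (A : Fin n → Fin n → Carrier) x y → (A ·ᵛ δ y) x ≈ A x y
  ·-δ A x y = trans
    (sum-single y λ z z≢y → trans (*-congˡ (reflexive (≡.cong (if_then 1# else 0#) (dec-false (z Fin.≟ y) z≢y)))) (zeroʳ _))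
    (trans (*-congˡ (reflexive (≡.cong (if_then 1# else 0#) (dec-true (y Fin.≟ y) ≡.refl)))) (*-identityʳ _))

  sum-diagonal : ∀ {n} (r a : Fin n → Carrier) w →
    sum (λ z → r z * (if does (z Fin.≟ w) then a z else 0#)) ≈ r w * a w
  sum-diagonal r a w = trans
    (sum-single w λ z z≢w → trans (*-congˡ (reflexive (≡.cong (if_then a z else 0#) (dec-false (z Fin.≟ w) z≢w)))) (zeroʳ _))
    (*-congˡ (reflexive (≡.cong (if_then a w else 0#) (dec-true (w Fin.≟ w) ≡.refl))))

  ·-cong : ∀ {n} (A : Fin n → Fin n → Carrier) {v w} → v ≋ᵛ w → A ·ᵛ v ≋ᵛ A ·ᵛ w
  ·-cong A v≋w x = sum-cong-≋ λ y → *-congˡ (v≋w y)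

  ·-+ : ∀ {n} (A : Fin n → Fin n → Carrier) v w → A ·ᵛ (λ y → v y + w y) ≋ᵛ λ x → (A ·ᵛ v) x + (A ·ᵛ w) x
  ·-+ A v w x = trans (sum-cong-≋ λ y → distribˡ (A x y) (v y) (w y))
    (∑-distrib-+ (λ y → A x y * v y) (λ y → A x y * w y))

  ·-* : ∀ {n} (A : Fin n → Fin n → Carrier) c v → A ·ᵛ (λ y → c * v y) ≋ᵛ λ x → c * (A ·ᵛ v) x
  ·-* A c v x = trans (sum-cong-≋ λ y → x∙yz≈y∙xz (A x y) c (v y)) (sym (*-distribˡ-sum c (λ y → A x y * v y)))

  ·-sum : ∀ {n m} (A : Fin n → Fin n → Carrier) (w : Fin m → Fin n → Carrier) →
          A ·ᵛ (λ y → sum λ k → w k y) ≋ᵛ λ x → sum λ k → (A ·ᵛ w k) x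
  ·-sum A w x = trans (sum-cong-≋ λ y → *-distribˡ-sum (A x y) (λ k → w k y)) (∑-comm λ y k → A x y * w k y)

  module _ {n m} (A : Fin n → Fin n → Carrier) (θ : Fin m → Carrier) where

    Eigenvector : Fin m → (Fin n → Carrier) → Set
    Eigenvector k v = A ·ᵛ v ≋ᵛ λ y → θ k * v y

    Complementary : Fin m → (Fin n → Carrier) → Set
    Complementary i v = ∃ λ (w : Fin m → Fin n → Carrier) →
      (∀ k → Eigenvector k (w k)) × w i ≋ᵛ (λ _ → 0#) × v ≋ᵛ λ y → sum λ k → w k y

    -- Each summand is merely scaled by its own eigenvalue, and the absent one stays zero.
    A-complementary : ∀ {i v} → Complementary i v → Complementary i (A ·ᵛ v)
    A-complementary {i} {v} (w , eigen , wᵢ≋0 , v≋) =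
      (λ k y → θ k * w k y) ,
      (λ k x → trans (·-* A (θ k) (w k) x) (*-congˡ (eigen k x))) ,
      (λ y → trans (*-congˡ (wᵢ≋0 y)) (zeroʳ _)) ,
      (λ x → trans (·-cong A v≋ x) (trans (·-sum A w x) (sum-cong-≋ λ k → eigen k x)))

    module _
      (i : Fin m) (E : Fin n → Fin n → Carrier)
      (into        : ∀ v → Eigenvector i (E ·ᵛ v))
      (identity    : ∀ v → Eigenvector i v → E ·ᵛ v ≋ᵛ v)
      (annihilates : ∀ v → Complementary i v → E ·ᵛ v ≋ᵛ λ _ → 0#)
      (kernel⊆     : ∀ v → E ·ᵛ v ≋ᵛ (λ _ → 0#) → Complementary i v)
      where

      -- Both the kernel and the range of `E` are invariant under `A`. In the splitting of `v` as
      -- `u` plus `E ·ᵛ v`, with `u` in the kernel, `E` annihilates `A ·ᵛ u` and fixes the multiple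
      -- `θ i` of the other summand. Hence the rows of `E` are left eigenvectors of `A`.
      left-eigen : ∀ v → E ·ᵛ A ·ᵛ v ≋ᵛ λ x → θ i * (E ·ᵛ v) x
      left-eigen v x = begin
        (E ·ᵛ A ·ᵛ v) x
          ≈⟨ ·-cong E (λ z → trans (·-cong A v≋u+Ev z) (·-+ A u (E ·ᵛ v) z)) x ⟩
        (E ·ᵛ λ z → (A ·ᵛ u) z + (A ·ᵛ E ·ᵛ v) z) x
          ≈⟨ ·-+ E (A ·ᵛ u) (A ·ᵛ E ·ᵛ v) x ⟩
        (E ·ᵛ A ·ᵛ u) x + (E ·ᵛ A ·ᵛ E ·ᵛ v) x
          ≈⟨ +-cong (annihilates (A ·ᵛ u) (A-complementary (kernel⊆ u Eu≋0)) x)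
               (trans (·-cong E (into v) x) (·-* E (θ i) (E ·ᵛ v) x)) ⟩
        0# + θ i * (E ·ᵛ E ·ᵛ v) x
          ≈⟨ trans (+-identityˡ _) (*-congˡ (identity (E ·ᵛ v) (into v) x)) ⟩
        θ i * (E ·ᵛ v) x ∎
        where
        u : Fin n → Carrier
        -- The minus sign is a scalar factor, so that the linearity of `E` applies to it.
        u y = v y + - 1# * (E ·ᵛ v) y

        open import Algebra.Properties.Ring ring using (-1*x≈-x)

        minus-self : ∀ y → y + - 1# * y ≈ 0#
        minus-self y = trans (+-congˡ (-1*x≈-x y)) (-‿inverseʳ y)

        v≋u+Ev : v ≋ᵛ λ y → u y + (E ·ᵛ v) y
        v≋u+Ev y = sym (trans (+-assoc (v y) _ _) (trans (+-congˡ (trans (+-comm _ _) (minus-self _))) (+-identityʳ _)))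

        Eu≋0 : E ·ᵛ u ≋ᵛ λ _ → 0#
        Eu≋0 x = begin
          (E ·ᵛ u) x                                        ≈⟨ ·-+ E v (λ y → - 1# * (E ·ᵛ v) y) x ⟩
          (E ·ᵛ v) x + (E ·ᵛ λ y → - 1# * (E ·ᵛ v) y) x       ≈⟨ +-congˡ (·-* E (- 1#) (E ·ᵛ v) x) ⟩
          (E ·ᵛ v) x + - 1# * (E ·ᵛ E ·ᵛ v) x                 ≈⟨ +-congˡ (*-congˡ (identity (E ·ᵛ v) (into v) x)) ⟩
          (E ·ᵛ v) x + - 1# * (E ·ᵛ v) x                     ≈⟨ minus-self _ ⟩
          0#                                               ∎

-- Rational arithmetic for matrix entries and half-integers

module Fractions where

  fromℚᵘ-+ : ∀ p r → fromℚᵘ p ℚ.+ fromℚᵘ r ≡ fromℚᵘ (p ℚᵘ.+ r)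
  fromℚᵘ-+ p r = ℚ.toℚᵘ-injective (ℚᵘ.≃-trans (ℚ.toℚᵘ-homo-+ (fromℚᵘ p) (fromℚᵘ r))
    (ℚᵘ.≃-trans (ℚᵘ.+-cong (ℚ.toℚᵘ-fromℚᵘ p) (ℚ.toℚᵘ-fromℚᵘ r)) (ℚᵘ.≃-sym (ℚ.toℚᵘ-fromℚᵘ (p ℚᵘ.+ r)))))

  fromℚᵘ-* : ∀ p r → fromℚᵘ p ℚ.* fromℚᵘ r ≡ fromℚᵘ (p ℚᵘ.* r)
  fromℚᵘ-* p r = ℚ.toℚᵘ-injective (ℚᵘ.≃-trans (ℚ.toℚᵘ-homo-* (fromℚᵘ p) (fromℚᵘ r))
    (ℚᵘ.≃-trans (ℚᵘ.*-cong (ℚ.toℚᵘ-fromℚᵘ p) (ℚ.toℚᵘ-fromℚᵘ r)) (ℚᵘ.≃-sym (ℚ.toℚᵘ-fromℚᵘ (p ℚᵘ.* r)))))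

  ℕ/1-+ : ∀ m n → + (m ℕ.+ n) ℚ./ 1 ≡ (+ m ℚ./ 1) ℚ.+ (+ n ℚ./ 1)
  ℕ/1-+ m n = ≡.sym (≡.trans (fromℚᵘ-+ (mkℚᵘ (+ m) 0) (mkℚᵘ (+ n) 0))
    (ℚ.fromℚᵘ-cong {mkℚᵘ (+ m) 0 ℚᵘ.+ mkℚᵘ (+ n) 0} {mkℚᵘ (+ (m ℕ.+ n)) 0}
      (*≡* (≡.cong (ℤ._* + 1) (≡.cong₂ ℤ._+_ (ℤ.*-identityʳ (+ m)) (ℤ.*-identityʳ (+ n)))))))

  ℕ/1-* : ∀ m n → + (m ℕ.* n) ℚ./ 1 ≡ (+ m ℚ./ 1) ℚ.* (+ n ℚ./ 1)
  ℕ/1-* m n = ≡.sym (≡.trans (fromℚᵘ-* (mkℚᵘ (+ m) 0) (mkℚᵘ (+ n) 0))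
    (ℚ.fromℚᵘ-cong {mkℚᵘ (+ m) 0 ℚᵘ.* mkℚᵘ (+ n) 0} {mkℚᵘ (+ (m ℕ.* n)) 0}
      (*≡* (≡.cong (ℤ._* + 1) (≡.sym (ℤ.pos-* m n))))))

  reciprocal : ∀ m .{{_ : NonZero m}} → (+ 1 ℚ./ m) ℚ.* (+ m ℚ./ 1) ≡ 1ℚ
  reciprocal (suc m) = ≡.trans (fromℚᵘ-* (mkℚᵘ (+ 1) m) (mkℚᵘ (+ suc m) 0))
    (ℚ.fromℚᵘ-cong {mkℚᵘ (+ 1) m ℚᵘ.* mkℚᵘ (+ suc m) 0} {mkℚᵘ (+ 1) 0} (*≡* (≡.trans
      (≡.cong (ℤ._* + 1) (ℤ.*-identityˡ (+ suc m)))
      (≡.sym (ℤ.*-identityˡ (+ suc m ℤ.* + 1))))))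

  -- Translates a difference of 2 between doubled indices into the difference 1 that the hypothesis
  -- on `i - j` excludes.
  half-shift : ∀ m → + (2 ℕ.+ m) ℚ./ 2 ≡ 1ℚ ℚ.+ (+ m ℚ./ 2)
  half-shift m = ≡.sym (≡.trans (fromℚᵘ-+ (mkℚᵘ (+ 1) 0) (mkℚᵘ (+ m) 1))
    (ℚ.fromℚᵘ-cong {mkℚᵘ (+ 1) 0 ℚᵘ.+ mkℚᵘ (+ m) 1} {mkℚᵘ (+ (2 ℕ.+ m)) 1}
      (*≡* (≡.cong (λ a → (+ 2 ℤ.+ a) ℤ.* + 2) (ℤ.*-identityʳ (+ m))))))

  1+p-p≡1 : ∀ p → (1ℚ ℚ.+ p) ℚ.- p ≡ 1ℚ
  1+p-p≡1 p = ≡.trans (ℚ.+-assoc 1ℚ p (ℚ.- p))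
    (≡.trans (≡.cong (1ℚ ℚ.+_) (ℚ.+-inverseʳ p)) (ℚ.+-identityʳ 1ℚ))

  p-[1+p]≡-1 : ∀ p → p ℚ.- (1ℚ ℚ.+ p) ≡ ℚ.- 1ℚ
  p-[1+p]≡-1 p = ≡.trans (≡.cong (p ℚ.+_) (ℚ.neg-distrib-+ 1ℚ p))
    (≡.trans (ℚ.+-comm p _) (≡.trans (ℚ.+-assoc (ℚ.- 1ℚ) (ℚ.- p) p)
      (≡.trans (≡.cong (ℚ.- 1ℚ ℚ.+_) (ℚ.+-inverseˡ p)) (ℚ.+-identityʳ (ℚ.- 1ℚ)))))

-- Counting vectors in subspaces over the finite field

module LinearAlgebra {q} (F : FiniteField q) (H : VectorSpace F)
                     {K} (dimH : Subspaces.HasDimension F H K) where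

  open Counting
  open FiniteField F hiding (zero)
  open Module H
  open Subspaces F H using (combination; IsBasis; Subspace)
  open import Algebra.Properties.Ring ring using (-1*x≈-x)
  open import Algebra.Properties.Group +-group using (x∙y⁻¹≈ε⇒x≈y)
  open import Algebra.Properties.CommutativeSemigroup
    (CommutativeMonoid.commutativeSemigroup +ᴹ-commutativeMonoid)
    using (interchange)
  private
    module ∑ where
      open import Algebra.Properties.CommutativeMonoid.Sum +ᴹ-commutativeMonoid public

  coefficient : Fin q → Carrier
  coefficient = Inverse.from enumeration

  index : Carrier → Fin q
  index = Inverse.to enumeration

  coefficient-index : ∀ a → coefficient (index a) ≈ a
  coefficient-index a = Inverse.inverseʳ enumeration ≡.refl

  coefficient-injective : ∀ {i j} → coefficient i ≈ coefficient j → i ≡ j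
  coefficient-injective {i} {j} e = ≡.trans
    (≡.sym (Inverse.inverseˡ enumeration refl)) (Inverse.inverseˡ enumeration e)

  infix 4 _≟_

  _≟_ : ∀ a b → Dec (a ≈ b)
  a ≟ b = map′
    (λ e → trans (sym (coefficient-index a)) (trans (reflexive (≡.cong coefficient e)) (coefficient-index b)))
    (Inverse.to-cong enumeration) (index a Fin.≟ index b)

  -1*≈0⇒≈ : ∀ a b → a + - 1# * b ≈ 0# → a ≈ b
  -1*≈0⇒≈ a b e = x∙y⁻¹≈ε⇒x≈y a b (trans (+-congˡ (sym (-1*x≈-x b))) e)

  v-v≈0 : ∀ v → v +ᴹ - 1# *ₗ v ≈ᴹ 0ᴹ
  v-v≈0 v = begin
    v +ᴹ - 1# *ₗ v        ≈⟨ +ᴹ-congʳ (*ₗ-identityˡ v) ⟨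
    1# *ₗ v +ᴹ - 1# *ₗ v  ≈⟨ *ₗ-distribʳ v 1# (- 1#) ⟨
    (1# + - 1#) *ₗ v      ≈⟨ *ₗ-congʳ (-‿inverseʳ 1#) ⟩
    0# *ₗ v               ≈⟨ *ₗ-zeroˡ v ⟩
    0ᴹ                    ∎
    where open SetoidReasoning ≈ᴹ-setoid

  u+v-v≈u : ∀ u v → (u +ᴹ v) +ᴹ - 1# *ₗ v ≈ᴹ u
  u+v-v≈u u v = ≈ᴹ-trans (+ᴹ-assoc u v _) (≈ᴹ-trans (+ᴹ-congˡ (v-v≈0 v)) (+ᴹ-identityʳ u))

  u-v+v≈u : ∀ u v → (u +ᴹ - 1# *ₗ v) +ᴹ v ≈ᴹ u
  u-v+v≈u u v = ≈ᴹ-trans (+ᴹ-assoc u _ v)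
    (≈ᴹ-trans (+ᴹ-congˡ (≈ᴹ-trans (+ᴹ-comm _ v) (v-v≈0 v))) (+ᴹ-identityʳ u))

  affine-+ : ∀ u u′ a a′ v →
             (u +ᴹ a *ₗ v) +ᴹ (u′ +ᴹ a′ *ₗ v) ≈ᴹ (u +ᴹ u′) +ᴹ (a + a′) *ₗ v
  affine-+ u u′ a a′ v =
    ≈ᴹ-trans (interchange u _ u′ _) (+ᴹ-congˡ (≈ᴹ-sym (*ₗ-distribʳ v a a′)))

  affine-* : ∀ c u a v → c *ₗ (u +ᴹ a *ₗ v) ≈ᴹ c *ₗ u +ᴹ (c * a) *ₗ v
  affine-* c u a v = ≈ᴹ-trans (*ₗ-distribˡ c u _) (+ᴹ-congˡ (≈ᴹ-sym (*ₗ-assoc c a v)))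

  unscale : ∀ {a} → ¬ a ≈ 0# → ∀ v → ∃ λ c → c *ₗ a *ₗ v ≈ᴹ v
  unscale {a} a≉0 v with inverse a a≉0
  ... | c , ac≈1 = c , ≈ᴹ-trans (≈ᴹ-sym (*ₗ-assoc c a v))
    (≈ᴹ-trans (*ₗ-congʳ (trans (*-comm c a) ac≈1)) (*ₗ-identityˡ v))

  combination-+ : ∀ {d} c c′ (b : Vector Carrierᴹ d) →
    combination (λ k → c k + c′ k) b ≈ᴹ combination c b +ᴹ combination c′ b
  combination-+ c c′ b = ≈ᴹ-trans (∑.sum-cong-≋ λ k → *ₗ-distribʳ (b k) (c k) (c′ k))
    (∑.∑-distrib-+ (λ k → c k *ₗ b k) (λ k → c′ k *ₗ b k))

  combination-* : ∀ {d} a c (b : Vector Carrierᴹ d) →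
    combination (λ k → a * c k) b ≈ᴹ a *ₗ combination c b
  combination-* {zero}  a c b = ≈ᴹ-sym (*ₗ-zeroʳ a)
  combination-* {suc d} a c b = ≈ᴹ-trans
    (+ᴹ-cong (*ₗ-assoc a (c zero) (b zero)) (combination-* a (c ∘ suc) (b ∘ suc)))
    (≈ᴹ-sym (*ₗ-distribˡ a _ _))

  combination-cong : ∀ {d} {c c′} (b : Vector Carrierᴹ d) → (∀ k → c k ≈ c′ k) →
    combination c b ≈ᴹ combination c′ b
  combination-cong b c≈c′ = ∑.sum-cong-≋ λ k → *ₗ-congʳ (c≈c′ k)

  Independent : ∀ {d} → Vector Carrierᴹ d → Set
  Independent b = ∀ c → combination c b ≈ᴹ 0ᴹ → ∀ k → c k ≈ 0#

  combination-injective : ∀ {d} {b : Vector Carrierᴹ d} → Independent b →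
    ∀ c c′ → combination c b ≈ᴹ combination c′ b → ∀ k → c k ≈ c′ k
  combination-injective {b = b} ind c c′ e k = -1*≈0⇒≈ (c k) (c′ k) (ind (λ k → c k + - 1# * c′ k)
    (≈ᴹ-trans (combination-+ c (λ k → - 1# * c′ k) b)
      (≈ᴹ-trans (+ᴹ-cong e (combination-* (- 1#) c′ b)) (v-v≈0 _))) k)

  tuple : ∀ {d} → Fin (q ℕ.^ d) → Fin d → Carrier
  tuple i k = coefficient (finToFun i k)

  untuple : ∀ {d} → (Fin d → Carrier) → Fin (q ℕ.^ d)
  untuple c = funToFin (index ∘ c)

  tuple-untuple : ∀ {d} (c : Fin d → Carrier) k → tuple (untuple c) k ≈ c k
  tuple-untuple c k = trans
    (reflexive (≡.cong coefficient (Fin.finToFun-funToFin (index ∘ c) k))) (coefficient-index (c k))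

  funToFin-cong : ∀ {m n} {f g : Fin m → Fin n} → (∀ k → f k ≡ g k) → funToFin f ≡ funToFin g
  funToFin-cong {zero}  e = ≡.refl
  funToFin-cong {suc m} e = ≡.cong₂ Fin.combine (e zero) (funToFin-cong (e ∘ suc))

  tuple-injective : ∀ {d} {i j : Fin (q ℕ.^ d)} → (∀ k → tuple {d} i k ≈ tuple {d} j k) → i ≡ j
  tuple-injective {d} {i} {j} e = ≡.trans (≡.sym (Fin.funToFin-finToFin {d} {q} i))
    (≡.trans (funToFin-cong {f = finToFun {q} {d} i} {g = finToFun {q} {d} j} λ k → coefficient-injective (e k))
      (Fin.funToFin-finToFin {d} {q} j))

  spanned : ∀ {d} → Vector Carrierᴹ d → Fin (q ℕ.^ d) → Carrierᴹ
  spanned b i = combination (tuple i) b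

  spanned-untuple : ∀ {d} (b : Vector Carrierᴹ d) c → spanned b (untuple c) ≈ᴹ combination c b
  spanned-untuple b c = combination-cong b (tuple-untuple c)

  spanned-injective : ∀ {d} {b : Vector Carrierᴹ d} → Independent b →
    ∀ {i j} → spanned b i ≈ᴹ spanned b j → i ≡ j
  spanned-injective {d} ind {i} {j} e =
    tuple-injective {d} (combination-injective ind (tuple i) (tuple j) e)

  -- Coordinates enumerate all of `H`, and every cardinality is a sum of indicators over this
  -- enumeration.
  vec : Fin (q ℕ.^ K) → Carrierᴹ
  vec = spanned (proj₁ dimH)

  private
    coordinates : ∀ v → ∃ λ c → combination c (proj₁ dimH) ≈ᴹ v
    coordinates v = IsBasis.spanning (proj₂ dimH) {v} _

  code : Carrierᴹ → Fin (q ℕ.^ K)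
  code v = untuple (proj₁ (coordinates v))

  vec-code : ∀ v → vec (code v) ≈ᴹ v
  vec-code v = ≈ᴹ-trans (spanned-untuple (proj₁ dimH) _) (proj₂ (coordinates v))

  vec-injective : ∀ {i j} → vec i ≈ᴹ vec j → i ≡ j
  vec-injective = spanned-injective (IsBasis.independent (proj₂ dimH))

  code-cong : ∀ {u v} → u ≈ᴹ v → code u ≡ code v
  code-cong {u} {v} u≈v = vec-injective (≈ᴹ-trans (vec-code u) (≈ᴹ-trans u≈v (≈ᴹ-sym (vec-code v))))

  code-vec : ∀ i → code (vec i) ≡ i
  code-vec i = vec-injective (vec-code (vec i))

  infix 4 _≟ᴹ_

  _≟ᴹ_ : ∀ u v → Dec (u ≈ᴹ v)
  u ≟ᴹ v = map′
    (λ e → ≈ᴹ-trans (≈ᴹ-sym (vec-code u)) (≈ᴹ-trans (Setoid.reflexive ≈ᴹ-setoid (≡.cong vec e)) (vec-code v)))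
    code-cong (code u Fin.≟ code v)

  -- A subspace without a chosen basis, because sums, intersections and extensions come with none.
  -- Cardinality replaces dimension until `toSubspace` finds a basis.
  record Linear : Set₁ where
    field
      Member   : Pred Carrierᴹ 0ℓ
      member?  : Decidable Member
      resp     : ∀ {u v} → u ≈ᴹ v → u ∈ Member → v ∈ Member
      0-closed : 0ᴹ ∈ Member
      +-closed : ∀ {u v} → u ∈ Member → v ∈ Member → u +ᴹ v ∈ Member
      *-closed : ∀ a {v} → v ∈ Member → a *ₗ v ∈ Member

    +-cancelʳ : ∀ {u v} → u +ᴹ v ∈ Member → v ∈ Member → u ∈ Member
    +-cancelʳ {u} {v} u+v∈ v∈ = resp (u+v-v≈u u v) (+-closed u+v∈ (*-closed (- 1#) v∈))

    unscale-closed : ∀ {a v} → ¬ a ≈ 0# → a *ₗ v ∈ Member → v ∈ Member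
    unscale-closed {v = v} a≉0 av∈ with unscale a≉0 v
    ... | c , cav≈v = resp cav≈v (*-closed c av∈)

    -- The two vectors differ by a multiple of `v`, and a nonzero multiple would put `v` into the
    -- subspace. So the `q` translates counted in `card-extend` are disjoint.
    coefficient-unique : ∀ {u v a a′} → ¬ v ∈ Member →
      u +ᴹ a *ₗ v ∈ Member → u +ᴹ a′ *ₗ v ∈ Member → a ≈ a′
    coefficient-unique {u} {v} {a} {a′} v∉ p r = decidable-stable (a ≟ a′) λ a≉a′ →
      v∉ (unscale-closed (λ e → a≉a′ (-1*≈0⇒≈ a a′ e))
        (resp (begin
            (u +ᴹ a *ₗ v) +ᴹ - 1# *ₗ (u +ᴹ a′ *ₗ v)            ≈⟨ +ᴹ-congˡ (affine-* (- 1#) u a′ v) ⟩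
            (u +ᴹ a *ₗ v) +ᴹ (- 1# *ₗ u +ᴹ (- 1# * a′) *ₗ v)   ≈⟨ affine-+ u (- 1# *ₗ u) a (- 1# * a′) v ⟩
            (u +ᴹ - 1# *ₗ u) +ᴹ (a + - 1# * a′) *ₗ v           ≈⟨ +ᴹ-congʳ (v-v≈0 u) ⟩
            0ᴹ +ᴹ (a + - 1# * a′) *ₗ v                         ≈⟨ +ᴹ-identityˡ _ ⟩
            (a + - 1# * a′) *ₗ v                               ∎)
          (+-closed p (*-closed (- 1#) r))))
      where open SetoidReasoning ≈ᴹ-setoid

  open Linear using (Member; member?)

  card : Linear → ℕ
  card S = sum λ i → 𝟙 (member? S (vec i))

  card-cong : ∀ S T → (∀ {v} → v ∈ Member S → v ∈ Member T) →
              (∀ {v} → v ∈ Member T → v ∈ Member S) → card S ≡ card T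
  card-cong S T S⊆T T⊆S =
    sum-cong-≗ λ i → 𝟙-cong (member? S (vec i)) (member? T (vec i)) S⊆T T⊆S

  -- A vector of `T` missing from `S` would make the count for `S` strictly smaller. This takes the
  -- place of comparing dimensions.
  card-≡⇒⊇ : ∀ S T → (∀ {v} → v ∈ Member S → v ∈ Member T) → card S ≡ card T →
             ∀ {v} → v ∈ Member T → v ∈ Member S
  card-≡⇒⊇ S T S⊆T e {v} v∈T = decidable-stable (member? S v) λ v∉S →
    ℕ.<-irrefl e (sum-𝟙-< (λ i → member? S (vec i)) (λ i → member? T (vec i)) (λ i → S⊆T) (code v)
      (Linear.resp T (≈ᴹ-sym (vec-code v)) v∈T) (v∉S ∘ Linear.resp S (vec-code v)))

  fromSubspace : Subspace → Linear
  fromSubspace U = record { Subspace U }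

  -- Every member has exactly one tuple of coordinates in the basis, which turns the sum over
  -- vectors into a sum over `q ^ dim` tuples.
  card-fromSubspace : ∀ U → card (fromSubspace U) ≡ q ℕ.^ Subspace.dim U
  card-fromSubspace U = begin
    sum (λ i → 𝟙 (U.member? (vec i)))
      ≡⟨ sum-𝟙-double (λ i → U.member? (vec i)) (λ i j → vec i ≟ᴹ spanned U.basis j)
           (λ i v∈ → untuple (proj₁ (U.spanning v∈)) , ≈ᴹ-sym (lemma v∈) ,
              λ k e → spanned-injective U.independent (≈ᴹ-trans (≈ᴹ-sym e) (≈ᴹ-sym (lemma v∈))))
           (λ i j e → U.resp (≈ᴹ-sym e) (U.combination-closed (tuple j) U.basis U.member)) ⟩
    sum (λ j → sum λ i → 𝟙 (vec i ≟ᴹ spanned U.basis j))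
      ≡⟨ sum-const (λ j → sum-𝟙-unique (λ i → vec i ≟ᴹ spanned U.basis j) (code (spanned U.basis j))
           (vec-code _) λ i e → vec-injective (≈ᴹ-trans e (≈ᴹ-sym (vec-code _)))) ⟩
    q ℕ.^ U.dim ℕ.* 1
      ≡⟨ ℕ.*-identityʳ _ ⟩
    q ℕ.^ U.dim ∎
    where
    open ≡.≡-Reasoning
    module U = Subspace U
    lemma : ∀ {v} (v∈ : v ∈ U.Member) → spanned U.basis (untuple (proj₁ (U.spanning v∈))) ≈ᴹ v
    lemma v∈ = ≈ᴹ-trans (spanned-untuple U.basis _) (proj₂ (U.spanning v∈))

  card-translate : ∀ S w → sum (λ i → 𝟙 (member? S (vec i +ᴹ w))) ≡ card S
  card-translate S w = ≡.sym (≡.trans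
    (sum-permute (λ i → 𝟙 (member? S (vec i))) (mk↔ₛ′ (shift w) (shift (- 1# *ₗ w))
      (λ i → undo (- 1# *ₗ w) w i (u-v+v≈u (vec i) w)) (λ i → undo w (- 1# *ₗ w) i (u+v-v≈u (vec i) w))))
    (sum-cong-≗ λ i → 𝟙-cong (member? S (vec (shift w i))) (member? S (vec i +ᴹ w))
      (Linear.resp S (vec-code _)) (Linear.resp S (≈ᴹ-sym (vec-code _)))))
    where
    shift : Carrierᴹ → Fin (q ℕ.^ K) → Fin (q ℕ.^ K)
    shift w i = code (vec i +ᴹ w)

    undo : ∀ w w′ i → (vec i +ᴹ w) +ᴹ w′ ≈ᴹ vec i → shift w′ (shift w i) ≡ i
    undo w w′ i e = ≡.trans (code-cong (≈ᴹ-trans (+ᴹ-congʳ (vec-code _)) e)) (code-vec i)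

  -- The span of `S` and `v`: some multiple of `v` moves `u` into `S`. The search over enumerated
  -- coefficients makes membership decidable.
  extend : Linear → Carrierᴹ → Linear
  extend S v = record
    { Member   = λ u → ∃ λ j → u +ᴹ coefficient j *ₗ v ∈ S.Member
    ; member?  = λ u → Fin.any? λ j → S.member? (u +ᴹ coefficient j *ₗ v)
    ; resp     = λ u≈u′ (j , p) → j , S.resp (+ᴹ-congʳ u≈u′) p
    ; 0-closed = intro 0# (S.resp (≈ᴹ-sym (≈ᴹ-trans (+ᴹ-congˡ (*ₗ-zeroˡ v)) (+ᴹ-identityʳ 0ᴹ))) S.0-closed)
    ; +-closed = λ (j , p) (j′ , p′) →
        intro (coefficient j + coefficient j′) (S.resp (affine-+ _ _ _ _ v) (S.+-closed p p′))
    ; *-closed = λ a (j , p) → intro (a * coefficient j) (S.resp (affine-* a _ _ v) (S.*-closed a p))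
    }
    where
    module S = Linear S
    intro : ∀ {u} a → u +ᴹ a *ₗ v ∈ S.Member → ∃ λ j → u +ᴹ coefficient j *ₗ v ∈ S.Member
    intro a p = index a , S.resp (+ᴹ-congˡ (*ₗ-congʳ (sym (coefficient-index a)))) p

  module _ (S : Linear) (v : Carrierᴹ) where
    private module S = Linear S

    extend-intro : ∀ {u} a → u +ᴹ a *ₗ v ∈ S.Member → u ∈ Member (extend S v)
    extend-intro a p = index a , S.resp (+ᴹ-congˡ (*ₗ-congʳ (sym (coefficient-index a)))) p

    ⊆-extend : ∀ {u} → u ∈ S.Member → u ∈ Member (extend S v)
    ⊆-extend u∈ = extend-intro 0#
      (S.resp (≈ᴹ-sym (≈ᴹ-trans (+ᴹ-congˡ (*ₗ-zeroˡ v)) (+ᴹ-identityʳ _))) u∈)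

    ∈-extend : v ∈ Member (extend S v)
    ∈-extend = extend-intro (- 1#) (S.resp (≈ᴹ-sym (v-v≈0 v)) S.0-closed)

    extend-⊆ : ∀ T → (∀ {u} → u ∈ S.Member → u ∈ Member T) → v ∈ Member T →
               ∀ {u} → u ∈ Member (extend S v) → u ∈ Member T
    extend-⊆ T S⊆T v∈T (j , p) = Linear.+-cancelʳ T (S⊆T p) (Linear.*-closed T (coefficient j) v∈T)

    card-extend : ¬ v ∈ S.Member → card (extend S v) ≡ q ℕ.* card S
    card-extend v∉ = ≡.trans
      (sum-𝟙-double (λ i → member? (extend S v) (vec i)) (λ i j → S.member? (vec i +ᴹ coefficient j *ₗ v))
        (λ i (j , p) → j , p , λ k r → coefficient-injective (S.coefficient-unique v∉ r p))
        (λ i j p → j , p))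
      (sum-const λ j → card-translate S (coefficient j *ₗ v))

  _∩_ : Linear → Linear → Linear
  S ∩ T = record
    { Member   = λ u → u ∈ S.Member × u ∈ T.Member
    ; member?  = λ u → S.member? u ×-dec T.member? u
    ; resp     = λ e (p , r) → S.resp e p , T.resp e r
    ; 0-closed = S.0-closed , T.0-closed
    ; +-closed = λ (p , r) (p′ , r′) → S.+-closed p p′ , T.+-closed r r′
    ; *-closed = λ a (p , r) → S.*-closed a p , T.*-closed a r
    }
    where
    module S = Linear S
    module T = Linear T

  _⊞_ : Linear → Linear → Linear
  S ⊞ T = record
    { Member   = λ u → ∃ λ i → vec i ∈ T.Member × u +ᴹ vec i ∈ S.Member
    ; member?  = λ u → Fin.any? λ i → T.member? (vec i) ×-dec S.member? (u +ᴹ vec i)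
    ; resp     = λ e (i , p , r) → i , p , S.resp (+ᴹ-congʳ e) r
    ; 0-closed = intro T.0-closed (S.resp (≈ᴹ-sym (+ᴹ-identityʳ 0ᴹ)) S.0-closed)
    ; +-closed = λ (i , p , r) (i′ , p′ , r′) →
        intro (T.+-closed p p′) (S.resp (interchange _ _ _ _) (S.+-closed r r′))
    ; *-closed = λ a (i , p , r) → intro (T.*-closed a p) (S.resp (*ₗ-distribˡ a _ _) (S.*-closed a r))
    }
    where
    module S = Linear S
    module T = Linear T
    intro : ∀ {u t} → t ∈ T.Member → u +ᴹ t ∈ S.Member →
            ∃ λ i → vec i ∈ T.Member × u +ᴹ vec i ∈ S.Member
    intro {t = t} p r = code t , T.resp (≈ᴹ-sym (vec-code t)) p , S.resp (+ᴹ-congˡ (≈ᴹ-sym (vec-code t))) r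

  -- T being closed under negation, u + t ∈ S serves as well as u - t ∈ S.
  ⊞-intro : ∀ S T {u t} → t ∈ Member T → u +ᴹ t ∈ Member S → u ∈ Member (S ⊞ T)
  ⊞-intro S T {t = t} p r =
    code t , Linear.resp T (≈ᴹ-sym (vec-code t)) p , Linear.resp S (+ᴹ-congˡ (≈ᴹ-sym (vec-code t))) r

  span? : ∀ {d} (b : Vector Carrierᴹ d) v → Dec (∃ λ c → combination c b ≈ᴹ v)
  span? b v = map′ (λ (i , e) → tuple i , e)
    (λ (c , e) → untuple c , ≈ᴹ-trans (spanned-untuple b c) e)
    (Fin.any? λ i → spanned b i ≟ᴹ v)

  independent-∷ : ∀ {d} (b : Vector Carrierᴹ d) → Independent b → ∀ v →
                  ¬ (∃ λ c → combination c b ≈ᴹ v) → Independent (v Vector.∷ b)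
  independent-∷ b ind v v∉ c e = λ { zero → c₀≈0 ; (suc k) → ind (c ∘ suc) tail≈0 k }
    where
    w = combination (c ∘ suc) b

    c₀≈0 : c zero ≈ 0#
    c₀≈0 = decidable-stable (c zero ≟ 0#) λ c₀≉0 →
      let a , acv≈v = unscale c₀≉0 v in v∉ ((λ k → a * (- 1# * c (suc k))) , (begin
        combination (λ k → a * (- 1# * c (suc k))) b  ≈⟨ combination-* a _ b ⟩
        a *ₗ combination (λ k → - 1# * c (suc k)) b   ≈⟨ *ₗ-congˡ (combination-* (- 1#) (c ∘ suc) b) ⟩
        a *ₗ - 1# *ₗ w                                ≈⟨ *ₗ-congˡ (+ᴹ-identityˡ _) ⟨
        a *ₗ (0ᴹ +ᴹ - 1# *ₗ w)                        ≈⟨ *ₗ-congˡ (+ᴹ-congʳ e) ⟨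
        a *ₗ ((c zero *ₗ v +ᴹ w) +ᴹ - 1# *ₗ w)        ≈⟨ *ₗ-congˡ (u+v-v≈u _ w) ⟩
        a *ₗ c zero *ₗ v                              ≈⟨ acv≈v ⟩
        v                                             ∎))
      where open SetoidReasoning ≈ᴹ-setoid

    tail≈0 : w ≈ᴹ 0ᴹ
    tail≈0 = begin
      w                   ≈⟨ +ᴹ-identityˡ w ⟨
      0ᴹ +ᴹ w             ≈⟨ +ᴹ-congʳ (≈ᴹ-trans (*ₗ-congʳ c₀≈0) (*ₗ-zeroˡ v)) ⟨
      c zero *ₗ v +ᴹ w    ≈⟨ e ⟩
      0ᴹ                  ∎
      where open SetoidReasoning ≈ᴹ-setoid

  independent⇒≤ : ∀ {d} {b : Vector Carrierᴹ d} → Independent b → q ℕ.^ d ℕ.≤ q ℕ.^ K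
  independent⇒≤ {b = b} ind = Fin.injective⇒≤ {f = code ∘ spanned b} λ {i} {j} e →
    spanned-injective ind (≈ᴹ-trans (≈ᴹ-sym (vec-code _))
      (≈ᴹ-trans (Setoid.reflexive ≈ᴹ-setoid (≡.cong vec e)) (vec-code _)))

  module _ (S : Linear) where
    private module S = Linear S

    -- Vectors of `S` outside the span are added as long as there are any. The fuel `m` is never
    -- exhausted, as `suc K` independent vectors would have more combinations than `H` has vectors.
    grow : ∀ m {d} (b : Vector Carrierᴹ d) → (∀ k → b k ∈ S.Member) → Independent b →
           d ℕ.+ m ≡ suc K → ∃ λ d → ∃ λ (b : Vector Carrierᴹ d) → IsBasis S.Member b
    grow zero {d} b b∈ ind e = contradiction (independent⇒≤ ind)
      (ℕ.<⇒≱ (ℕ.^-monoʳ-< q (1<q F) (ℕ.≤-reflexive (≡.trans (≡.sym e) (ℕ.+-identityʳ d)))))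
    grow (suc m) {d} b b∈ ind e
      with Fin.any? (λ i → S.member? (vec i) ×-dec ¬? (span? b (vec i)))
    ... | yes (i , v∈ , v∉) = grow m (vec i Vector.∷ b) (λ { zero → v∈ ; (suc k) → b∈ k })
      (independent-∷ b ind (vec i) v∉) (≡.trans (≡.sym (ℕ.+-suc d m)) e)
    ... | no none = d , b , record
      { member      = b∈
      ; spanning    = λ {v} v∈ → decidable-stable (span? b v) λ v∉ → none
          (code v , S.resp (≈ᴹ-sym (vec-code v)) v∈ , λ (c , e) → v∉ (c , ≈ᴹ-trans e (vec-code v)))
      ; independent = ind
      }

    toSubspace : Subspace
    toSubspace = let d , b , isBasis = grow (suc K) {0} (λ ()) (λ ()) (λ _ _ ()) ≡.refl in record
      { Member   = S.Member
      ; member?  = S.member?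
      ; resp     = S.resp
      ; 0-closed = S.0-closed
      ; +-closed = S.+-closed
      ; *-closed = S.*-closed
      ; dim      = d
      ; basis    = b
      ; isBasis  = isBasis
      }

-- Covers, meets and intervals in the poset

module AttenuatedSpace {q} (F : FiniteField q) (H : VectorSpace F)
                       {K} (dimH : Subspaces.HasDimension F H K) (h : Subspaces.Subspace F H)
                       {n} (X : Enumeration (Subspaces.pointSetoid F H h) n) where

  open Counting
  open FiniteField F using (0#)
  open Module H
  open Subspaces F H using (Subspace; Point; dimₓ; point; pointSetoid; _covers_; _covers?_; _≤ₓ?_)
  open LinearAlgebra F H dimH
  open Linear using (Member; member?)

  private instance
    q-nonZero : ℕ.NonZero q
    q-nonZero = q≢0 F

    q-1-nonZero : ℕ.NonZero (q ℕ.∸ 1)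
    q-1-nonZero = q-1≢0 F

  q≡1+[q-1] : q ≡ suc (q ℕ.∸ 1)
  q≡1+[q-1] = ≡.sym (ℕ.m+[n∸m]≡n (ℕ.<⇒≤ (1<q F)))

  q^-injective : ∀ {k l} → q ℕ.^ k ≡ q ℕ.^ l → k ≡ l
  q^-injective {k} {l} e with ℕ.<-cmp k l
  ... | tri< k<l _ _ = contradiction e (ℕ.<⇒≢ (ℕ.^-monoʳ-< q (1<q F) k<l))
  ... | tri≈ _ k≡l _ = k≡l
  ... | tri> _ _ l<k = contradiction (≡.sym e) (ℕ.<⇒≢ (ℕ.^-monoʳ-< q (1<q F) l<k))

  linear : Fin n → Linear
  linear y = fromSubspace (Point.space (point h X y))

  module P y = Linear (linear y)

  h′ : Linear
  h′ = fromSubspace h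

  d : Fin n → ℕ
  d y = dimₓ h (point h X y)

  infix 4 _∈ₚ_ _∉ₚ_ _⊑_ _⊑?_ _⋗_ _⋗?_

  _∈ₚ_ _∉ₚ_ : Carrierᴹ → Fin n → Set
  v ∈ₚ y = v ∈ Member (linear y)
  v ∉ₚ y = ¬ v ∈ₚ y

  _⊑_ : Fin n → Fin n → Set
  y ⊑ z = ∀ {v} → v ∈ₚ y → v ∈ₚ z

  _⋗_ : Fin n → Fin n → Set
  z ⋗ y = _covers_ h (point h X z) (point h X y)

  _⋗?_ : ∀ z y → Dec (z ⋗ y)
  z ⋗? y = _covers?_ h (point h X z) (point h X y)

  _⊑?_ : ∀ y z → Dec (y ⊑ z)
  y ⊑? z = _≤ₓ?_ h (point h X y) (point h X z)

  ∩h≈0 : ∀ y {v} → v ∈ₚ y → v ∈ Member h′ → v ≈ᴹ 0ᴹ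
  ∩h≈0 y = Point.y∩h≈0 (point h X y)

  card-point : ∀ y → card (linear y) ≡ q ℕ.^ d y
  card-point y = card-fromSubspace (Point.space (point h X y))

  ⊑-antisym : ∀ {y z} → y ⊑ z → z ⊑ y → y ≡ z
  ⊑-antisym {y} {z} y⊑z z⊑y = ≡.trans
    (≡.sym (Inverse.inverseˡ X {x = y} {y = point h X z} ((λ {_} → z⊑y) , (λ {_} → y⊑z))))
    (Inverse.inverseˡ X {x = z} (Setoid.refl (pointSetoid h) {point h X z}))

  -- A search through the finitely many vectors turns the failure of an inclusion into a witness.
  separate : ∀ y z → (∃ λ u → u ∈ₚ y × u ∉ₚ z) ⊎ (y ⊑ z)
  separate y z with Fin.any? (λ i → P.member? y (vec i) ×-dec ¬? (P.member? z (vec i)))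
  ... | yes (i , u∈ , u∉) = inj₁ (vec i , u∈ , u∉)
  ... | no none = inj₂ λ {v} v∈ → decidable-stable (P.member? z v) λ v∉ → none
    (code v , P.resp y (≈ᴹ-sym (vec-code v)) v∈ , λ r → v∉ (P.resp z (vec-code v) r))

  ⋢⇒∃ : ∀ {y z} → ¬ (y ⊑ z) → ∃ λ u → u ∈ₚ y × u ∉ₚ z
  ⋢⇒∃ {y} {z} y⋢z with separate y z
  ... | inj₁ u   = u
  ... | inj₂ y⊑z = ⊥-elim (y⋢z y⊑z)

  ⊑-≡ : ∀ {y z} → y ⊑ z → d y ≡ d z → y ≡ z
  ⊑-≡ {y} {z} y⊑z e = ⊑-antisym y⊑z (card-≡⇒⊇ (linear y) (linear z) y⊑z
    (≡.trans (card-point y) (≡.trans (≡.cong (q ℕ.^_) e) (≡.sym (card-point z)))))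

  ≢⇒∃ : ∀ {y z} → d y ≡ d z → y ≢ z → ∃ λ u → u ∈ₚ y × u ∉ₚ z
  ≢⇒∃ e y≢z = ⋢⇒∃ λ y⊑z → y≢z (⊑-≡ y⊑z e)

  ⋗⇒⊑ : ∀ {y z} → z ⋗ y → y ⊑ z
  ⋗⇒⊑ z⋗y v∈ = proj₁ z⋗y v∈

  ⋗⇒d : ∀ {y z} → z ⋗ y → d z ≡ suc (d y)
  ⋗⇒d = proj₂

  ⋗⇒∃ : ∀ {y z} → z ⋗ y → ∃ λ u → u ∈ₚ z × u ∉ₚ y
  ⋗⇒∃ {y} {z} z⋗y = ⋢⇒∃ λ z⊑y → contradiction
    (≡.trans (≡.sym (⋗⇒d z⋗y)) (≡.cong d (⊑-antisym z⊑y (⋗⇒⊑ z⋗y)))) ℕ.1+n≢n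

  -- The way from a subspace built by hand to an index: `toSubspace` provides a basis, and `X`
  -- enumerates the points up to mutual inclusion.
  realise : ∀ S → (∀ {v} → v ∈ Member S → v ∈ Member h′ → v ≈ᴹ 0ᴹ) →
            ∃ λ y → (∀ {v} → v ∈ Member S → v ∈ₚ y) × (∀ {v} → v ∈ₚ y → v ∈ Member S) ×
                    q ℕ.^ d y ≡ card S
  realise S S∩h≈0 = y , proj₂ y≈p , proj₁ y≈p ,
    ≡.trans (≡.sym (card-point y)) (card-cong (linear y) S (proj₁ y≈p) (proj₂ y≈p))
    where
    p : Point h
    p = record { space = toSubspace S ; y∩h≈0 = S∩h≈0 }
    y = Inverse.to X p
    y≈p : Setoid._≈_ (pointSetoid h) (point h X y) p
    y≈p = Inverse.inverseʳ X {x = p} ≡.refl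

  -- The span of `y` and `u` lies in `x` and has `q` times as many vectors as `y`, which is already
  -- the size of `x`.
  hyperplane-generates : ∀ {x y u p} → x ⋗ y → u ∈ₚ x → u ∉ₚ y → p ∈ₚ x → p ∈ Member (extend (linear y) u)
  hyperplane-generates {x} {y} {u} x⋗y u∈ u∉ = card-≡⇒⊇ (extend (linear y) u) (linear x)
    (extend-⊆ (linear y) u (linear x) (⋗⇒⊑ x⋗y) u∈) (begin
      card (extend (linear y) u)  ≡⟨ card-extend (linear y) u u∉ ⟩
      q ℕ.* card (linear y)       ≡⟨ ≡.cong (q ℕ.*_) (card-point y) ⟩
      q ℕ.^ suc (d y)             ≡⟨ ≡.cong (q ℕ.^_) (⋗⇒d x⋗y) ⟨
      q ℕ.^ d x                   ≡⟨ card-point x ⟨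
      card (linear x)             ∎)
    where open ≡.≡-Reasoning

  cover-⊑ : ∀ {x y z u} → x ⋗ y → u ∈ₚ x → u ∉ₚ y → y ⊑ z → u ∈ₚ z → x ⊑ z
  cover-⊑ {y = y} {z} {u} x⋗y u∈ u∉ y⊑z u∈z p∈ =
    extend-⊆ (linear y) u (linear z) y⊑z u∈z (hyperplane-generates x⋗y u∈ u∉ p∈)

  cover-unique : ∀ {w w′ y u} → w ⋗ y → w′ ⋗ y → u ∈ₚ w → u ∈ₚ w′ → u ∉ₚ y → w ≡ w′
  cover-unique w⋗y w′⋗y u∈ u∈′ u∉ =
    ⊑-antisym (cover-⊑ w⋗y u∈ u∉ (⋗⇒⊑ w′⋗y) u∈′) (cover-⊑ w′⋗y u∈′ u∉ (⋗⇒⊑ w⋗y) u∈)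

  -- A vector of `a` outside `b` exists because the dimensions agree, and with `b` it generates both
  -- covers. This gives uniqueness of joins and, by contraposition, of meets.
  square-degenerate : ∀ {a b x w} → x ⋗ a → x ⋗ b → w ⋗ a → w ⋗ b → a ≢ b → x ≡ w
  square-degenerate x⋗a x⋗b w⋗a w⋗b a≢b
    with ≢⇒∃ (ℕ.suc-injective (≡.trans (≡.sym (⋗⇒d x⋗a)) (⋗⇒d x⋗b))) a≢b
  ... | u , u∈a , u∉b = cover-unique x⋗b w⋗b (⋗⇒⊑ x⋗a u∈a) (⋗⇒⊑ w⋗a u∈a) u∉b

  infix 5 _+h

  _+h : Fin n → Linear
  y +h = linear y ⊞ h′

  -- If `u + t` lies in `y` with `t` in `h`, then `t` lies in both `z` and `h` and is zero, so `u`
  -- would lie in `y`. `cover-exists` is a converse.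
  above⇒∉+h : ∀ {y z u} → y ⊑ z → u ∈ₚ z → u ∉ₚ y → ¬ u ∈ Member (y +h)
  above⇒∉+h {y} {z} {u} y⊑z u∈ u∉ (i , t∈h , u+t∈y) =
    u∉ (P.resp y (≈ᴹ-trans (+ᴹ-congˡ t≈0) (+ᴹ-identityʳ u)) u+t∈y)
    where
    t≈0 : vec i ≈ᴹ 0ᴹ
    t≈0 = ∩h≈0 z (P.+-cancelʳ z (P.resp z (+ᴹ-comm u (vec i)) (y⊑z u+t∈y)) u∈) t∈h

  -- The span of `y` and `u` avoids `h`: a vector of `h` in it lies in `y`, and is zero, or involves
  -- a nonzero multiple of `u`, which would put `u` into `y + h`.
  cover-exists : ∀ {y u} → ¬ u ∈ Member (y +h) → ∃ λ w → w ⋗ y × u ∈ₚ w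
  cover-exists {y} {u} u∉+h = w , ((λ {_} p → S⊆w (⊆-extend (linear y) u p)) , q^-injective (begin
      q ℕ.^ d w                   ≡⟨ card-w ⟩
      card (extend (linear y) u)  ≡⟨ card-extend (linear y) u u∉ ⟩
      q ℕ.* card (linear y)       ≡⟨ ≡.cong (q ℕ.*_) (card-point y) ⟩
      q ℕ.^ suc (d y)             ∎)) , S⊆w (∈-extend (linear y) u)
    where
    open ≡.≡-Reasoning
    u∉ : u ∉ₚ y
    u∉ u∈ = u∉+h (⊞-intro (linear y) h′ (Linear.0-closed h′) (P.resp y (≈ᴹ-sym (+ᴹ-identityʳ u)) u∈))

    disjoint : ∀ {v} → v ∈ Member (extend (linear y) u) → v ∈ Member h′ → v ≈ᴹ 0ᴹ
    disjoint {v} (j , v+au∈y) v∈h with coefficient j ≟ 0#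
    ... | yes a≈0 = ∩h≈0 y (P.resp y
      (≈ᴹ-trans (+ᴹ-congˡ (≈ᴹ-trans (*ₗ-congʳ a≈0) (*ₗ-zeroˡ u))) (+ᴹ-identityʳ v)) v+au∈y) v∈h
    ... | no a≉0 = ⊥-elim (u∉+h (Linear.unscale-closed (y +h) a≉0
      (⊞-intro (linear y) h′ v∈h (P.resp y (+ᴹ-comm v _) v+au∈y))))

    r = realise (extend (linear y) u) disjoint
    w = proj₁ r
    S⊆w = proj₁ (proj₂ r)
    card-w = proj₂ (proj₂ (proj₂ r))

  -- The witness is the intersection of `y` and `x`. With any `u` in `y` outside `x`, `x` generates
  -- `z`, so the intersection and `u` generate `y`.
  meet-exists : ∀ {x y z} → z ⋗ x → y ⊑ z → ¬ (y ⊑ x) → ∃ λ v → y ⋗ v × v ⊑ x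
  meet-exists {x} {y} {z} z⋗x y⊑z y⋢x with ⋢⇒∃ y⋢x
  ... | u , u∈y , u∉x = v , ((λ {_} p → proj₁ (v⊆S p)) , q^-injective (begin
      q ℕ.^ d y          ≡⟨ card-point y ⟨
      card (linear y)    ≡⟨ card-cong (linear y) (extend S u) y⊆ (extend-⊆ S u (linear y) proj₁ u∈y) ⟩
      card (extend S u)  ≡⟨ card-extend S u (u∉x ∘ proj₂) ⟩
      q ℕ.* card S       ≡⟨ ≡.cong (q ℕ.*_) card-v ⟨
      q ℕ.^ suc (d v)    ∎)) , (λ p → proj₂ (v⊆S p))
    where
    open ≡.≡-Reasoning
    S = linear y ∩ linear x
    r = realise S λ v∈S → ∩h≈0 y (proj₁ v∈S)
    v = proj₁ r
    v⊆S = proj₁ (proj₂ (proj₂ r))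
    card-v = proj₂ (proj₂ (proj₂ r))

    y⊆ : ∀ {p} → p ∈ₚ y → p ∈ Member (extend S u)
    y⊆ p∈ with hyperplane-generates z⋗x (y⊑z u∈y) u∉x (y⊑z p∈)
    ... | j , p+au∈x = j , P.+-closed y p∈ (P.*-closed y (coefficient j) u∈y) , p+au∈x

  ι : Fin n → Fin n → ℕ
  ι z y = 𝟙 (z ⋗? y)

  ι-yes : ∀ {z y} → z ⋗ y → ι z y ≡ 1
  ι-yes {z} {y} = 𝟙-yes (z ⋗? y)

  ι-no : ∀ {z y} → ¬ z ⋗ y → ι z y ≡ 0
  ι-no {z} {y} = 𝟙-no (z ⋗? y)

  ∖-member? : ∀ (S T : Linear) v → Dec (v ∈ Member T × ¬ v ∈ Member S)
  ∖-member? S T v = member? T v ×-dec ¬? (member? S v)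

  card-∖ : ∀ S T → (∀ {v} → v ∈ Member S → v ∈ Member T) →
           sum (λ i → 𝟙 (∖-member? S T (vec i))) ℕ.+ card S ≡ card T
  card-∖ S T S⊆T = ≡.trans
    (≡.sym (∑-distrib-+ (λ i → 𝟙 (∖-member? S T (vec i))) (λ i → 𝟙 (member? S (vec i)))))
    (sum-cong-≗ λ i → pointwise (member? S (vec i)) (member? T (vec i)) S⊆T)
    where
    pointwise : ∀ {a b} {A : Set a} {B : Set b} (A? : Dec A) (B? : Dec B) → (A → B) →
                𝟙 (B? ×-dec ¬? A?) ℕ.+ 𝟙 A? ≡ 𝟙 B?
    pointwise (yes a) B? A⇒B
      rewrite 𝟙-no (B? ×-dec ¬? (yes a)) (λ (_ , ¬a) → ¬a a) | 𝟙-yes B? (A⇒B a) = ≡.refl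
    pointwise (no ¬a) (yes b) A⇒B = ≡.refl
    pointwise (no ¬a) (no ¬b) A⇒B = ≡.refl

  k+[q-1]k≡qk : ∀ k → (q ℕ.∸ 1) ℕ.* k ℕ.+ k ≡ q ℕ.* k
  k+[q-1]k≡qk k = ≡.trans (ℕ.+-comm _ k) (≡.cong (ℕ._* k) (≡.sym q≡1+[q-1]))

  card-cover-∖ : ∀ {w y} → w ⋗ y →
    sum (λ i → 𝟙 (∖-member? (linear y) (linear w) (vec i))) ≡ (q ℕ.∸ 1) ℕ.* q ℕ.^ d y
  card-cover-∖ {w} {y} w⋗y = ℕ.+-cancelʳ-≡ (q ℕ.^ d y) _ _ (begin
    s ℕ.+ q ℕ.^ d y                            ≡⟨ ≡.cong (s ℕ.+_) (card-point y) ⟨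
    s ℕ.+ card (linear y)                      ≡⟨ card-∖ (linear y) (linear w) (⋗⇒⊑ w⋗y) ⟩
    card (linear w)                            ≡⟨ card-point w ⟩
    q ℕ.^ d w                                  ≡⟨ ≡.cong (q ℕ.^_) (⋗⇒d w⋗y) ⟩
    q ℕ.* q ℕ.^ d y                            ≡⟨ k+[q-1]k≡qk (q ℕ.^ d y) ⟨
    (q ℕ.∸ 1) ℕ.* q ℕ.^ d y ℕ.+ q ℕ.^ d y      ∎)
    where
    open ≡.≡-Reasoning
    s = sum (λ i → 𝟙 (∖-member? (linear y) (linear w) (vec i)))

  -- The covers w in D partition T, each of them contributing the vectors in w but not in y.
  cover-count : ∀ {a b} {D : Fin n → Set a} {T : Carrierᴹ → Set b} y
                (D? : ∀ w → Dec (D w)) (T? : ∀ v → Dec (T v)) →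
                (∀ {w} → D w → w ⋗ y) →
                (∀ {u} → T u → ∃ λ w → D w × u ∈ₚ w × u ∉ₚ y) →
                (∀ {w u} → D w → u ∈ₚ w → u ∉ₚ y → T u) →
                sum (λ w → 𝟙 (D? w)) ℕ.* ((q ℕ.∸ 1) ℕ.* q ℕ.^ d y) ≡ sum λ i → 𝟙 (T? (vec i))
  cover-count {D = D} y D? T? D⇒⋗ T⇒D D⇒T = ≡.sym (begin
    sum (λ i → 𝟙 (T? (vec i)))
      ≡⟨ sum-𝟙-double (λ i → T? (vec i)) (λ i w → D? w ×-dec new? w (vec i))
           (λ i t → let w , δ , u∈ , u∉ = T⇒D t in w , (δ , u∈ , u∉) ,
              λ w′ (δ′ , u∈′ , _) → cover-unique (D⇒⋗ δ′) (D⇒⋗ δ) u∈′ u∈ u∉)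
           (λ i w (δ , u∈ , u∉) → D⇒T δ u∈ u∉) ⟩
    sum (λ w → sum λ i → 𝟙 (D? w ×-dec new? w (vec i)))
      ≡⟨ sum-cong-≗ (λ w → pointwise w (D? w)) ⟩
    sum (λ w → 𝟙 (D? w) ℕ.* k)
      ≡⟨ *-distribʳ-sum k (λ w → 𝟙 (D? w)) ⟨
    sum (λ w → 𝟙 (D? w)) ℕ.* k ∎)
    where
    open ≡.≡-Reasoning
    k = (q ℕ.∸ 1) ℕ.* q ℕ.^ d y
    new? : ∀ w → ∀ v → Dec (v ∈ₚ w × v ∉ₚ y)
    new? w = ∖-member? (linear y) (linear w)
    pointwise : ∀ w (D? : Dec (D w)) → sum (λ i → 𝟙 (D? ×-dec new? w (vec i))) ≡ 𝟙 D? ℕ.* k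
    pointwise w (yes δ) = ≡.trans (card-cover-∖ (D⇒⋗ δ)) (≡.sym (ℕ.+-identityʳ k))
    pointwise w (no ¬δ) = sum-zero {q ℕ.^ K} λ _ → ≡.refl

  private instance
    gain-nonZero : ∀ {y} → ℕ.NonZero ((q ℕ.∸ 1) ℕ.* q ℕ.^ d y)
    gain-nonZero {y} = ℕ.m*n≢0 (q ℕ.∸ 1) (q ℕ.^ d y) {{q-1-nonZero}} {{ℕ.m^n≢0 q (d y)}}

  -- Every vector of `z` outside `y` generates with `y` a point between them. There are
  -- `(q² - 1) q ^ d y` such vectors, and each intermediate point uses up `(q - 1) q ^ d y` of them.
  interval-count : ∀ {y z} → y ⊑ z → d z ≡ suc (suc (d y)) → sum (λ w → ι z w ℕ.* ι w y) ≡ suc q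
  interval-count {y} {z} y⊑z e = ≡.trans (sum-cong-≗ λ w → ≡.sym (𝟙-× (z ⋗? w) (w ⋗? y)))
    (ℕ.*-cancelʳ-≡ _ (suc q) ((q ℕ.∸ 1) ℕ.* k) {{gain-nonZero {y}}} (≡.trans
      (cover-count y (λ w → (z ⋗? w) ×-dec (w ⋗? y)) (∖-member? (linear y) (linear z)) proj₂
        (λ (u∈ , u∉) → let w , w⋗y , u∈w = cover-exists (above⇒∉+h y⊑z u∈ u∉) in
          w , (((λ {_} → cover-⊑ w⋗y u∈w u∉ y⊑z u∈) , ≡.trans e (≡.cong suc (≡.sym (⋗⇒d w⋗y)))) , w⋗y) , u∈w , u∉)
        (λ (z⋗w , _) u∈w u∉ → ⋗⇒⊑ z⋗w u∈w , u∉))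
      (ℕ.+-cancelʳ-≡ k _ _ (begin
        s ℕ.+ k                                                ≡⟨ ≡.cong (s ℕ.+_) (card-point y) ⟨
        s ℕ.+ card (linear y)                                  ≡⟨ card-∖ (linear y) (linear z) y⊑z ⟩
        card (linear z)                                        ≡⟨ card-point z ⟩
        q ℕ.^ d z                                              ≡⟨ ≡.cong (q ℕ.^_) e ⟩
        q ℕ.* (q ℕ.* k)                                        ≡⟨ ≡.cong (q ℕ.*_) (k+[q-1]k≡qk k) ⟨
        q ℕ.* (r ℕ.* k ℕ.+ k)                                  ≡⟨ ℕ.*-distribˡ-+ q (r ℕ.* k) k ⟩
        q ℕ.* (r ℕ.* k) ℕ.+ q ℕ.* k                            ≡⟨ ≡.cong (q ℕ.* (r ℕ.* k) ℕ.+_) (k+[q-1]k≡qk k) ⟨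
        q ℕ.* (r ℕ.* k) ℕ.+ (r ℕ.* k ℕ.+ k)                    ≡⟨ ℕ.+-assoc (q ℕ.* (r ℕ.* k)) (r ℕ.* k) k ⟨
        q ℕ.* (r ℕ.* k) ℕ.+ r ℕ.* k ℕ.+ k                      ≡⟨ ≡.cong (ℕ._+ k) (ℕ.+-comm (q ℕ.* (r ℕ.* k)) (r ℕ.* k)) ⟩
        suc q ℕ.* (r ℕ.* k) ℕ.+ k                              ∎))))
    where
    open ≡.≡-Reasoning
    k = q ℕ.^ d y
    r = q ℕ.∸ 1
    s = sum λ i → 𝟙 (∖-member? (linear y) (linear z) (vec i))

  upper lower : Fin n → ℕ
  upper y = sum λ z → ι z y
  lower y = sum λ v → ι y v

  -- The covers of `y` partition the vectors outside `y + h`; adding those inside gives all of `H`.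
  upper-count : ∀ y → upper y ℕ.* ((q ℕ.∸ 1) ℕ.* q ℕ.^ d y) ℕ.+ card (y +h) ≡ q ℕ.^ K
  upper-count y = begin
    upper y ℕ.* ((q ℕ.∸ 1) ℕ.* q ℕ.^ d y) ℕ.+ card (y +h)
      ≡⟨ ≡.cong (ℕ._+ card (y +h)) (cover-count y (_⋗? y) (λ v → ¬? (member? (y +h) v)) (λ w⋗y → w⋗y)
           (λ {u} u∉+h → let w , w⋗y , u∈w = cover-exists u∉+h in w , w⋗y , u∈w ,
              λ u∈y → u∉+h (⊞-intro (linear y) h′ (Linear.0-closed h′) (P.resp y (≈ᴹ-sym (+ᴹ-identityʳ u)) u∈y)))
           (λ w⋗y u∈w u∉y → above⇒∉+h (⋗⇒⊑ w⋗y) u∈w u∉y)) ⟩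
    sum (λ i → 𝟙 (¬? (member? (y +h) (vec i)))) ℕ.+ card (y +h)
      ≡⟨ ∑-distrib-+ (λ i → 𝟙 (¬? (member? (y +h) (vec i)))) (λ i → 𝟙 (member? (y +h) (vec i))) ⟨
    sum (λ i → 𝟙 (¬? (member? (y +h) (vec i))) ℕ.+ 𝟙 (member? (y +h) (vec i)))
      ≡⟨ sum-const (λ i → complement (member? (y +h) (vec i))) ⟩
    q ℕ.^ K ℕ.* 1
      ≡⟨ ℕ.*-identityʳ _ ⟩
    q ℕ.^ K ∎
    where
    open ≡.≡-Reasoning
    complement : ∀ {a} {A : Set a} (A? : Dec A) → 𝟙 (¬? A?) ℕ.+ 𝟙 A? ≡ 1
    complement (yes _) = ≡.refl
    complement (no _)  = ≡.refl

  -- A vector `u` of `x` outside `y` generates `x` with `y`, hence `x + h` with `y + h`, and it does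
  -- not lie in `y + h`.
  card-cover-+h : ∀ {x y} → x ⋗ y → card (x +h) ≡ q ℕ.* card (y +h)
  card-cover-+h {x} {y} x⋗y with ⋗⇒∃ x⋗y
  ... | u , u∈ , u∉ = ≡.trans (card-cong (x +h) (extend (y +h) u) to from)
    (card-extend (y +h) u (above⇒∉+h (⋗⇒⊑ x⋗y) u∈ u∉))
    where
    open import Algebra.Properties.CommutativeSemigroup
      (CommutativeMonoid.commutativeSemigroup +ᴹ-commutativeMonoid) using (xy∙z≈xz∙y)
    to : ∀ {v} → v ∈ Member (x +h) → v ∈ Member (extend (y +h) u)
    to {v} (i , t∈h , v+t∈x) with hyperplane-generates x⋗y u∈ u∉ v+t∈x
    ... | j , r = j , i , t∈h , P.resp y (xy∙z≈xz∙y v _ _) r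
    from : ∀ {v} → v ∈ Member (extend (y +h) u) → v ∈ Member (x +h)
    from {v} (j , i , t∈h , r) = i , t∈h ,
      P.+-cancelʳ x (P.resp x (xy∙z≈xz∙y v _ _) (⋗⇒⊑ x⋗y r)) (P.*-closed x (coefficient j) u∈)

-- The linear relation between the path counts

module PathCounts {q} (F : FiniteField q) (H : VectorSpace F)
                  {K} (dimH : Subspaces.HasDimension F H K) (h : Subspaces.Subspace F H)
                  {n} (X : Enumeration (Subspaces.pointSetoid F H h) n) where

  open Counting
  open FiniteField F using (1#; -_)
  open Module H
  open LinearAlgebra F H dimH
  open Linear using (Member; member?)
  open AttenuatedSpace F H dimH h X

  private instance
    q-1-nonZero : ℕ.NonZero (q ℕ.∸ 1)
    q-1-nonZero = q-1≢0 F

  open Arithmetic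

  -- Subtracting `upper-count` at `x` from `q` times `upper-count` at `y` removes the size of
  -- `x + h` and leaves `(q - 1) q ^ K`. This is the source of `q ^ (N + M)` in the matrix relation.
  upper-cover : ∀ {x y} → x ⋗ y → q ℕ.^ d x ℕ.* upper y ≡ q ℕ.^ d x ℕ.* upper x ℕ.+ q ℕ.^ K
  upper-cover {x} {y} x⋗y = ℕ.*-cancelˡ-≡ _ _ r (ℕ.+-cancelʳ-≡ (card (x +h)) _ _ (begin
    r ℕ.* (D ℕ.* upper y) ℕ.+ card (x +h)
      ≡⟨ ≡.cong₂ (λ D c → r ℕ.* (D ℕ.* upper y) ℕ.+ c) Dx (card-cover-+h x⋗y) ⟩
    r ℕ.* (q ℕ.* k ℕ.* upper y) ℕ.+ q ℕ.* card (y +h)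
      ≡⟨ factor-q r q k (upper y) (card (y +h)) ⟩
    q ℕ.* (upper y ℕ.* (r ℕ.* k) ℕ.+ card (y +h))
      ≡⟨ ≡.cong (q ℕ.*_) (upper-count y) ⟩
    q ℕ.* q ℕ.^ K
      ≡⟨ k+[q-1]k≡qk (q ℕ.^ K) ⟨
    r ℕ.* q ℕ.^ K ℕ.+ q ℕ.^ K
      ≡⟨ ≡.cong (r ℕ.* q ℕ.^ K ℕ.+_) (upper-count x) ⟨
    r ℕ.* q ℕ.^ K ℕ.+ (upper x ℕ.* (r ℕ.* D) ℕ.+ card (x +h))
      ≡⟨ factor-r r (q ℕ.^ K) (upper x) D (card (x +h)) ⟩
    r ℕ.* (D ℕ.* upper x ℕ.+ q ℕ.^ K) ℕ.+ card (x +h) ∎))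
    where
    open ≡.≡-Reasoning
    r = q ℕ.∸ 1
    k = q ℕ.^ d y
    D = q ℕ.^ d x
    Dx : D ≡ q ℕ.* k
    Dx = ≡.cong (q ℕ.^_) (⋗⇒d x⋗y)

  ∑-ι-unique : ∀ {a b} {P : Fin n → Set a} {Q : Fin n → Set b} (P? : ∀ i → Dec (P i)) (Q? : ∀ i → Dec (Q i)) i →
               P i → Q i → (∀ j → P j → Q j → j ≡ i) → sum (λ j → 𝟙 (P? j) ℕ.* 𝟙 (Q? j)) ≡ 1
  ∑-ι-unique P? Q? i p r unique = ≡.trans (sum-cong-≗ λ j → ≡.sym (𝟙-× (P? j) (Q? j)))
    (sum-𝟙-unique (λ j → P? j ×-dec Q? j) i (p , r) λ j (p , r) → unique j p r)

  ∑-ι-none : ∀ {a b} {P : Fin n → Set a} {Q : Fin n → Set b} (P? : ∀ i → Dec (P i)) (Q? : ∀ i → Dec (Q i)) →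
             (∀ j → P j → ¬ Q j) → sum (λ j → 𝟙 (P? j) ℕ.* 𝟙 (Q? j)) ≡ 0
  ∑-ι-none P? Q? none = ≡.trans (sum-cong-≗ λ j → ≡.sym (𝟙-× (P? j) (Q? j)))
    (sum-𝟙-none (λ j → P? j ×-dec Q? j) λ j (p , r) → none j p r)

  𝟙-weight : ∀ {a} {P : Set a} (P? : Dec P) {k l} → (P → k ≡ l) → 𝟙 P? ℕ.* k ≡ 𝟙 P? ℕ.* l
  𝟙-weight (yes p) k≡l = ≡.cong (1 ℕ.*_) (k≡l p)
  𝟙-weight (no _)  k≡l = ≡.refl

  𝟙-idem : ∀ {a} {P : Set a} (P? : Dec P) → 𝟙 P? ℕ.* 𝟙 P? ≡ 𝟙 P?
  𝟙-idem (yes _) = ≡.refl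
  𝟙-idem (no _)  = ≡.refl

  -- The paths x ← z ← w ← y of type up-up-down, up-down-up and down-up-up read from y.
  UUD UDU DUU : Fin n → Fin n → ℕ
  UUD x y = sum λ z → ι z x ℕ.* sum λ w → ι z w ℕ.* ι w y
  UDU x y = sum λ z → ι x z ℕ.* sum λ w → ι w z ℕ.* ι w y
  DUU x y = sum λ z → ι x z ℕ.* sum λ w → ι z w ℕ.* ι y w

  ∑-weight-swap : ∀ (f g : Fin n → ℕ) (e : Fin n → Fin n → ℕ) →
    sum (λ z → f z ℕ.* sum λ w → e z w ℕ.* g w) ≡ sum λ w → g w ℕ.* sum λ z → f z ℕ.* e z w
  ∑-weight-swap f g e = begin
    sum (λ z → f z ℕ.* sum λ w → e z w ℕ.* g w)
      ≡⟨ sum-cong-≗ (λ z → *-distribˡ-sum (f z) (λ w → e z w ℕ.* g w)) ⟩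
    sum (λ z → sum λ w → f z ℕ.* (e z w ℕ.* g w))
      ≡⟨ ∑-comm (λ z w → f z ℕ.* (e z w ℕ.* g w)) ⟩
    sum (λ w → sum λ z → f z ℕ.* (e z w ℕ.* g w))
      ≡⟨ sum-cong-≗ (λ w → sum-cong-≗ λ z → ≡.trans (≡.sym (ℕ.*-assoc (f z) (e z w) (g w))) (ℕ.*-comm _ (g w))) ⟩
    sum (λ w → sum λ z → g w ℕ.* (f z ℕ.* e z w))
      ≡⟨ sum-cong-≗ (λ w → *-distribˡ-sum (g w) (λ z → f z ℕ.* e z w)) ⟨
    sum (λ w → g w ℕ.* sum λ z → f z ℕ.* e z w) ∎
    where open ≡.≡-Reasoning

  private
    d-step : ∀ {x y w} → x ⋗ y → w ⋗ x → d w ≡ suc (suc (d y))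
    d-step x⋗y w⋗x = ≡.trans (⋗⇒d w⋗x) (≡.cong suc (⋗⇒d x⋗y))

  module _ {x y} (x⋗y : x ⋗ y) where

    UUD-cover : UUD x y ≡ upper x ℕ.* suc q
    UUD-cover = ≡.trans
      (sum-cong-≗ λ z → 𝟙-weight (z ⋗? x) λ z⋗x →
        interval-count (λ p → ⋗⇒⊑ z⋗x (⋗⇒⊑ x⋗y p)) (d-step x⋗y z⋗x))
      (≡.sym (*-distribʳ-sum (suc q) λ z → ι z x))

    DUU-cover : DUU x y ≡ lower y ℕ.* suc q
    DUU-cover = ≡.trans (∑-weight-swap (ι x) (ι y) ι) (≡.trans
      (sum-cong-≗ λ w → 𝟙-weight (y ⋗? w) λ y⋗w →
        interval-count (λ p → ⋗⇒⊑ x⋗y (⋗⇒⊑ y⋗w p)) (d-step y⋗w x⋗y))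
      (≡.sym (*-distribʳ-sum (suc q) λ w → ι y w)))

    -- A second count of the same paths: a `z` below `x` other than `y` meets `y` in exactly one
    -- point, whereas `z = y` allows every point below `y`. Comparison with `DUU-cover` gives the
    -- recursion `lower x = q * lower y + 1`.
    lower-sum : DUU x y ℕ.+ 1 ≡ lower x ℕ.+ lower y
    lower-sum = ≡.trans
      (sum-exchange {g = ι x} {m = λ z → sum λ w → ι z w ℕ.* ι y w} y (ι-yes x⋗y) λ z z≢y →
        ≡.trans (𝟙-weight (x ⋗? z) (unique z z≢y)) (ℕ.*-identityʳ (ι x z)))
      (≡.cong (lower x ℕ.+_) (sum-cong-≗ λ w → 𝟙-idem (y ⋗? w)))
      where
      unique : ∀ z → z ≢ y → x ⋗ z → sum (λ w → ι z w ℕ.* ι y w) ≡ 1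
      unique z z≢y x⋗z = fromMeet (meet-exists x⋗z (⋗⇒⊑ x⋗y) λ y⊑z → z≢y (≡.sym (⊑-≡ y⊑z dy≡dz)))
        where
        dy≡dz : d y ≡ d z
        dy≡dz = ℕ.suc-injective (≡.trans (≡.sym (⋗⇒d x⋗y)) (⋗⇒d x⋗z))

        fromMeet : (∃ λ v → y ⋗ v × v ⊑ z) → sum (λ w → ι z w ℕ.* ι y w) ≡ 1
        fromMeet (v , y⋗v , v⊑z) = ∑-ι-unique (z ⋗?_) (y ⋗?_) v z⋗v y⋗v λ w z⋗w y⋗w →
          decidable-stable (w Fin.≟ v) λ w≢v → z≢y (square-degenerate z⋗w z⋗v y⋗w y⋗v w≢v)
          where
          z⋗v : z ⋗ v
          z⋗v = (λ {_} → v⊑z) , ℕ.suc-injective (≡.trans (≡.sym (⋗⇒d x⋗z)) (d-step y⋗v x⋗y))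

    -- For a cover `w` of `y` other than `x`, the only point below both `w` and `x` is `y`, so there
    -- is one path; `w = x` allows every `z` below `x`.
    UDU-cover : UDU x y ℕ.+ 1 ≡ upper y ℕ.+ lower x
    UDU-cover = ≡.trans (≡.cong (ℕ._+ 1) (∑-weight-swap (ι x) (λ w → ι w y) (λ z w → ι w z))) (≡.trans
      (sum-exchange {g = λ w → ι w y} {m = λ w → sum λ z → ι x z ℕ.* ι w z} x (ι-yes x⋗y) λ w w≢x →
        ≡.trans (𝟙-weight (w ⋗? y) (unique w w≢x)) (ℕ.*-identityʳ (ι w y)))
      (≡.cong (upper y ℕ.+_) (sum-cong-≗ λ z → 𝟙-idem (x ⋗? z))))
      where
      unique : ∀ w → w ≢ x → w ⋗ y → sum (λ z → ι x z ℕ.* ι w z) ≡ 1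
      unique w w≢x w⋗y = ∑-ι-unique (x ⋗?_) (w ⋗?_) y x⋗y w⋗y λ z x⋗z w⋗z →
        decidable-stable (z Fin.≟ y) λ z≢y → w≢x (square-degenerate w⋗z w⋗y x⋗z x⋗y z≢y)

    path-relation-cover :
      q ℕ.^ d x ℕ.* (UUD x y ℕ.+ q ℕ.* DUU x y) ℕ.+ suc q ℕ.* q ℕ.^ K ℕ.* ι x y ≡
      q ℕ.^ d x ℕ.* (suc q ℕ.* UDU x y)
    path-relation-cover = begin
      D ℕ.* (UUD x y ℕ.+ q ℕ.* DUU x y) ℕ.+ suc q ℕ.* q ℕ.^ K ℕ.* ι x y
        ≡⟨ ≡.cong₂ ℕ._+_ (≡.cong (D ℕ.*_) (≡.cong₂ (λ a b → a ℕ.+ q ℕ.* b) UUD-cover DUU-cover))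
             (≡.cong (suc q ℕ.* q ℕ.^ K ℕ.*_) (ι-yes x⋗y)) ⟩
      D ℕ.* (upper x ℕ.* suc q ℕ.+ q ℕ.* (lower y ℕ.* suc q)) ℕ.+ suc q ℕ.* q ℕ.^ K ℕ.* 1
        ≡⟨ cover-total D q (upper x) (lower y) (q ℕ.^ K) ⟩
      suc q ℕ.* (D ℕ.* upper x ℕ.+ q ℕ.^ K) ℕ.+ D ℕ.* (suc q ℕ.* (q ℕ.* lower y))
        ≡⟨ ≡.cong (λ a → suc q ℕ.* a ℕ.+ D ℕ.* (suc q ℕ.* (q ℕ.* lower y))) (upper-cover x⋗y) ⟨
      suc q ℕ.* (D ℕ.* upper y) ℕ.+ D ℕ.* (suc q ℕ.* (q ℕ.* lower y))
        ≡⟨ cover-factor D q (upper y) (lower y) ⟩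
      D ℕ.* (suc q ℕ.* (upper y ℕ.+ q ℕ.* lower y))
        ≡⟨ ≡.cong (λ a → D ℕ.* (suc q ℕ.* a)) UDU≡ ⟨
      D ℕ.* (suc q ℕ.* UDU x y) ∎
      where
      open ≡.≡-Reasoning
      D = q ℕ.^ d x

      lower≡ : lower x ≡ q ℕ.* lower y ℕ.+ 1
      lower≡ = ℕ.+-cancelʳ-≡ (lower y) _ _ (begin
        lower x ℕ.+ lower y                ≡⟨ lower-sum ⟨
        DUU x y ℕ.+ 1                      ≡⟨ ≡.cong (ℕ._+ 1) DUU-cover ⟩
        lower y ℕ.* suc q ℕ.+ 1            ≡⟨ lower-total q (lower y) ⟩
        q ℕ.* lower y ℕ.+ 1 ℕ.+ lower y    ∎)

      UDU≡ : UDU x y ≡ upper y ℕ.+ q ℕ.* lower y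
      UDU≡ = ℕ.+-cancelʳ-≡ 1 _ _ (≡.trans UDU-cover
        (≡.trans (≡.cong (upper y ℕ.+_) lower≡) (≡.sym (ℕ.+-assoc (upper y) _ 1))))

  ∑-weight-zero : ∀ {a} {P : Fin n → Set a} (P? : ∀ i → Dec (P i)) {f : Fin n → ℕ} →
                  (∀ i → P i → f i ≡ 0) → sum (λ i → 𝟙 (P? i) ℕ.* f i) ≡ 0
  ∑-weight-zero P? f≡0 = sum-zero λ i → ≡.trans (𝟙-weight (P? i) (f≡0 i)) (ℕ.*-zeroʳ (𝟙 (P? i)))

  module _ {x y} (dx≡1+dy : d x ≡ suc (d y)) (y⋢x : ¬ (y ⊑ x)) where

    -- Two different hyperplanes of `y` generate `y`, which does not lie in `x`. So `v` can only be
    -- the intersection of `x` and `y`.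
    hyperplane-unique : ∀ {v v′} → y ⋗ v → v ⊑ x → y ⋗ v′ → v′ ⊑ x → v ≡ v′
    hyperplane-unique {v} {v′} y⋗v v⊑x y⋗v′ v′⊑x = decidable-stable (v Fin.≟ v′) λ v≢v′ →
      let u , u∈v , u∉v′ = ≢⇒∃ (ℕ.suc-injective (≡.trans (≡.sym (⋗⇒d y⋗v)) (⋗⇒d y⋗v′))) v≢v′
      in y⋢x (cover-⊑ y⋗v′ (⋗⇒⊑ y⋗v u∈v) u∉v′ v′⊑x (v⊑x u∈v))

    meet-below : ∀ {z w} → x ⋗ z → w ⋗ z → w ⋗ y → ∃ λ v → y ⋗ v × v ⊑ z
    meet-below x⋗z w⋗z w⋗y = meet-exists w⋗z (⋗⇒⊑ w⋗y) λ y⊑z → y⋢x λ p → ⋗⇒⊑ x⋗z (y⊑z p)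

    -- Each of the three types of path produces a hyperplane of `y` inside `x`, so without such a
    -- hyperplane there are no paths.
    module NoMeet (none : ∀ v → y ⋗ v → ¬ (v ⊑ x)) where

      UUD≡0 : UUD x y ≡ 0
      UUD≡0 = ∑-weight-zero (_⋗? x) λ z z⋗x → ∑-ι-none (z ⋗?_) (_⋗? y) λ w z⋗w w⋗y →
        let v , y⋗v , v⊑x = meet-exists z⋗x (λ p → ⋗⇒⊑ z⋗w (⋗⇒⊑ w⋗y p)) y⋢x in none v y⋗v v⊑x

      UDU≡0 : UDU x y ≡ 0
      UDU≡0 = ∑-weight-zero (x ⋗?_) λ z x⋗z → ∑-ι-none (_⋗? z) (_⋗? y) λ w w⋗z w⋗y →
        let v , y⋗v , v⊑z = meet-below x⋗z w⋗z w⋗y in none v y⋗v λ p → ⋗⇒⊑ x⋗z (v⊑z p)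

      DUU≡0 : DUU x y ≡ 0
      DUU≡0 = ∑-weight-zero (x ⋗?_) λ z x⋗z → ∑-ι-none (z ⋗?_) (y ⋗?_) λ w z⋗w y⋗w →
        none w y⋗w λ p → ⋗⇒⊑ x⋗z (⋗⇒⊑ z⋗w p)

    -- Here `x + y` has one dimension more than `x`, and the counts depend on whether it avoids `h`
    -- (`Join`) or not (`NoJoin`).
    module Meet {v} (y⋗v : y ⋗ v) (v⊑x : v ⊑ x) where

      private
        dx≡2+dv : d x ≡ suc (suc (d v))
        dx≡2+dv = ≡.trans dx≡1+dy (≡.cong suc (⋗⇒d y⋗v))

        between-d : ∀ {z} → x ⋗ z → d z ≡ suc (d v)
        between-d x⋗z = ℕ.suc-injective (≡.trans (≡.sym (⋗⇒d x⋗z)) dx≡2+dv)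

      DUU≡ : DUU x y ≡ suc q
      DUU≡ = ≡.trans (∑-weight-swap (ι x) (ι y) ι) (≡.trans
        (sum-single v λ w w≢v → ≡.trans
          (𝟙-weight (y ⋗? w) λ y⋗w → ∑-ι-none (x ⋗?_) (_⋗? w) λ z x⋗z z⋗w →
            w≢v (hyperplane-unique y⋗w (λ p → ⋗⇒⊑ x⋗z (⋗⇒⊑ z⋗w p)) y⋗v v⊑x))
          (ℕ.*-zeroʳ (ι y w)))
        (≡.trans (≡.cong₂ ℕ._*_ (ι-yes y⋗v) (interval-count v⊑x dx≡2+dv)) (ℕ.+-identityʳ (suc q))))

      -- Over `v`, the point `z` is generated by `p`, so the cover of `y` through `p` contains `z`.
      -- Any other common cover is equal to it by `square-degenerate`.
      joins-yes : ∀ {z p} → x ⋗ z → z ⋗ v → p ∈ₚ z → p ∉ₚ v → ¬ p ∈ Member (y +h) →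
                  sum (λ w → ι w z ℕ.* ι w y) ≡ 1
      joins-yes {z} {p} x⋗z z⋗v p∈z p∉v p∉y+h = fromCover (cover-exists p∉y+h)
        where
        fromCover : (∃ λ w → w ⋗ y × p ∈ₚ w) → sum (λ w → ι w z ℕ.* ι w y) ≡ 1
        fromCover (w , w⋗y , p∈w) = ∑-ι-unique (_⋗? z) (_⋗? y) w w⋗z w⋗y λ w′ w′⋗z w′⋗y →
          square-degenerate w′⋗z w′⋗y w⋗z w⋗y λ { ≡.refl → y⋢x (⋗⇒⊑ x⋗z) }
          where
          w⋗z : w ⋗ z
          w⋗z = (λ {_} → cover-⊑ z⋗v p∈z p∉v (λ r → ⋗⇒⊑ w⋗y (⋗⇒⊑ y⋗v r)) p∈w) ,
            ≡.trans (⋗⇒d w⋗y) (≡.cong suc (≡.trans (⋗⇒d y⋗v) (≡.sym (⋗⇒d z⋗v))))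

      -- A common cover of `z` and `y` would yield a hyperplane of `y` inside `z`; it could only be
      -- `v`, and then `z` would cover `v`.
      joins-no : ∀ {z} → x ⋗ z → ¬ z ⋗ v → sum (λ w → ι w z ℕ.* ι w y) ≡ 0
      joins-no {z} x⋗z ¬z⋗v = ∑-ι-none (_⋗? z) (_⋗? y) λ w w⋗z w⋗y → fromMeet (meet-below x⋗z w⋗z w⋗y)
        where
        fromMeet : ¬ (∃ λ v′ → y ⋗ v′ × v′ ⊑ z)
        fromMeet (v′ , y⋗v′ , v′⊑z) = ¬z⋗v
          ((λ {u} u∈v → v′⊑z (≡.subst (u ∈ₚ_) v≡v′ u∈v)) , between-d x⋗z)
          where
          v≡v′ : v ≡ v′
          v≡v′ = hyperplane-unique y⋗v v⊑x y⋗v′ λ p → ⋗⇒⊑ x⋗z (v′⊑z p)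

      module _ {u} (u∈y : u ∈ₚ y) (u∉x : u ∉ₚ x) where

        private
          u∉v : u ∉ₚ v
          u∉v r = u∉x (v⊑x r)

        -- `z₀` is the sum of `x` and `y`. Every path stays between `v` and `z₀`, where the poset
        -- consists of all subspaces.
        module Join (u∉x+h : ¬ u ∈ Member (x +h)) where

          private
            cover = cover-exists u∉x+h

            z₀ : Fin n
            z₀ = proj₁ cover

            z₀⋗x : z₀ ⋗ x
            z₀⋗x = proj₁ (proj₂ cover)

            u∈z₀ : u ∈ₚ z₀
            u∈z₀ = proj₂ (proj₂ cover)

            y⊑z₀ : y ⊑ z₀
            y⊑z₀ = cover-⊑ y⋗v u∈y u∉v (λ r → ⋗⇒⊑ z₀⋗x (v⊑x r)) u∈z₀

          UUD≡ : UUD x y ≡ suc q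
          UUD≡ = ≡.trans
            (sum-single z₀ λ z z≢z₀ → ≡.trans
              (𝟙-weight (z ⋗? x) λ z⋗x → ∑-ι-none (z ⋗?_) (_⋗? y) λ w z⋗w w⋗y →
                z≢z₀ (cover-unique z⋗x z₀⋗x (⋗⇒⊑ z⋗w (⋗⇒⊑ w⋗y u∈y)) u∈z₀ u∉x))
              (ℕ.*-zeroʳ (ι z x)))
            (≡.trans (≡.cong₂ ℕ._*_ (ι-yes z₀⋗x)
                (interval-count y⊑z₀ (≡.trans (⋗⇒d z₀⋗x) (≡.cong suc dx≡1+dy))))
              (ℕ.+-identityʳ (suc q)))

          UDU≡ : UDU x y ≡ suc q
          UDU≡ = ≡.trans
            (sum-cong-≗ λ z → 𝟙-weight (x ⋗? z) (pointwise z (z ⋗? v)))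
            (interval-count v⊑x dx≡2+dv)
            where
            pointwise : ∀ z (z⋗?v : Dec (z ⋗ v)) → x ⋗ z → sum (λ w → ι w z ℕ.* ι w y) ≡ 𝟙 z⋗?v
            pointwise z (no ¬z⋗v) x⋗z = joins-no x⋗z ¬z⋗v
            pointwise z (yes z⋗v) x⋗z = fromVector (⋗⇒∃ z⋗v)
              where
              fromVector : (∃ λ p → p ∈ₚ z × p ∉ₚ v) → sum (λ w → ι w z ℕ.* ι w y) ≡ 1
              fromVector (p , p∈z , p∉v) = joins-yes x⋗z z⋗v p∈z p∉v
                (above⇒∉+h y⊑z₀ (⋗⇒⊑ z₀⋗x (⋗⇒⊑ x⋗z p∈z))
                  λ p∈y → y⋢x (cover-⊑ y⋗v p∈y p∉v v⊑x (⋗⇒⊑ x⋗z p∈z)))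

        -- No point contains both `u` and `a`, since their difference `t` lies in `h` and is
        -- nonzero. Thus no point lies above `x` and `y`, and of the `q + 1` points between `v` and
        -- `x` exactly `v₀`, generated by `v` and `a`, has no common cover with `y`.
        module NoJoin {t} (t∈h : t ∈ Member h′) (u+t∈x : u +ᴹ t ∈ₚ x) where

          private
            a : Carrierᴹ
            a = u +ᴹ t

            t∉ : ∀ {w} → u ∈ₚ w → ¬ (a ∈ₚ w)
            t∉ {w} u∈w a∈w = u∉x (P.resp x (≈ᴹ-trans (+ᴹ-congˡ t≈0) (+ᴹ-identityʳ u)) u+t∈x)
              where
              t≈0 : t ≈ᴹ 0ᴹ
              t≈0 = ∩h≈0 w (P.+-cancelʳ w (P.resp w (+ᴹ-comm u t) a∈w) u∈w) t∈h

            a∉v : a ∉ₚ v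
            a∉v a∈v = t∉ u∈y (⋗⇒⊑ y⋗v a∈v)

            cover = cover-exists (above⇒∉+h v⊑x u+t∈x a∉v)

            v₀ : Fin n
            v₀ = proj₁ cover

            v₀⋗v : v₀ ⋗ v
            v₀⋗v = proj₁ (proj₂ cover)

            a∈v₀ : a ∈ₚ v₀
            a∈v₀ = proj₂ (proj₂ cover)

            x⋗v₀ : x ⋗ v₀
            x⋗v₀ = (λ {_} → cover-⊑ v₀⋗v a∈v₀ a∉v v⊑x u+t∈x) ,
              ≡.trans dx≡2+dv (≡.cong suc (≡.sym (⋗⇒d v₀⋗v)))

          UUD≡ : UUD x y ≡ 0
          UUD≡ = ∑-weight-zero (_⋗? x) λ z z⋗x → ∑-ι-none (z ⋗?_) (_⋗? y) λ w z⋗w w⋗y →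
            t∉ (⋗⇒⊑ z⋗w (⋗⇒⊑ w⋗y u∈y)) (⋗⇒⊑ z⋗x u+t∈x)

          -- If p + t′ lies in y then, modulo v, it is a multiple - c u of u, and t′ - c t
          -- lies in both x and h; hence p + c a lies in v.
          off-v₀ : ∀ {z p} → x ⋗ z → z ⋗ v → z ≢ v₀ → p ∈ₚ z → p ∉ₚ v → ¬ p ∈ Member (y +h)
          off-v₀ {z} {p} x⋗z z⋗v z≢v₀ p∈z p∉v (k , t′∈h , p+t′∈y) =
            fromCoefficient (hyperplane-generates y⋗v u∈y u∉v p+t′∈y)
            where
            t′ = vec k
            fromCoefficient : ¬ (p +ᴹ t′ ∈ Member (extend (linear v) u))
            fromCoefficient (j , r) = z≢v₀ (cover-unique z⋗v v₀⋗v p∈z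
              (P.+-cancelʳ v₀ (⋗⇒⊑ v₀⋗v p+ca∈v) (P.*-closed v₀ c a∈v₀)) p∉v)
              where
              c = coefficient j
              s = t′ +ᴹ - 1# *ₗ c *ₗ t

              s+p+ca : s +ᴹ (p +ᴹ c *ₗ a) ≈ᴹ (p +ᴹ t′) +ᴹ c *ₗ u
              s+p+ca = begin
                s +ᴹ (p +ᴹ c *ₗ a)
                  ≈⟨ +ᴹ-congˡ (+ᴹ-congˡ (*ₗ-distribˡ c u t)) ⟩
                (t′ +ᴹ - 1# *ₗ c *ₗ t) +ᴹ (p +ᴹ (c *ₗ u +ᴹ c *ₗ t))
                  ≈⟨ solve 5 (λ t′ -ct p cu ct → (t′ ⊕ -ct) ⊕ (p ⊕ (cu ⊕ ct)) ⊜ (((p ⊕ t′) ⊕ cu) ⊕ ct) ⊕ -ct)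
                       ≈ᴹ-refl t′ (- 1# *ₗ c *ₗ t) p (c *ₗ u) (c *ₗ t) ⟩
                (((p +ᴹ t′) +ᴹ c *ₗ u) +ᴹ c *ₗ t) +ᴹ - 1# *ₗ c *ₗ t
                  ≈⟨ u+v-v≈u _ (c *ₗ t) ⟩
                (p +ᴹ t′) +ᴹ c *ₗ u ∎
                where
                open SetoidReasoning ≈ᴹ-setoid
                open import Algebra.Solver.CommutativeMonoid +ᴹ-commutativeMonoid

              s≈0 : s ≈ᴹ 0ᴹ
              s≈0 = ∩h≈0 x
                (P.+-cancelʳ x (P.resp x (≈ᴹ-sym s+p+ca) (v⊑x r))
                  (P.+-closed x (⋗⇒⊑ x⋗z p∈z) (P.*-closed x c u+t∈x)))
                (Linear.+-closed h′ t′∈h (Linear.*-closed h′ (- 1#) (Linear.*-closed h′ c t∈h)))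

              p+ca∈v : p +ᴹ c *ₗ a ∈ₚ v
              p+ca∈v = P.resp v (≈ᴹ-trans (≈ᴹ-sym s+p+ca) (≈ᴹ-trans (+ᴹ-congʳ s≈0) (+ᴹ-identityˡ _))) r

          UDU≡ : UDU x y ≡ q
          -- The indicator of `v₀` fills in the one missing term, so that the sum runs over the
          -- whole interval.
          UDU≡ = ℕ.+-cancelʳ-≡ 1 _ _ (begin
            UDU x y ℕ.+ 1
              ≡⟨ ≡.cong (UDU x y ℕ.+_) (sum-𝟙-unique (Fin._≟ v₀) v₀ ≡.refl λ _ e → e) ⟨
            UDU x y ℕ.+ sum (λ z → 𝟙 (z Fin.≟ v₀))
              ≡⟨ ∑-distrib-+ (λ z → ι x z ℕ.* joins z) (λ z → 𝟙 (z Fin.≟ v₀)) ⟨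
            sum (λ z → ι x z ℕ.* joins z ℕ.+ 𝟙 (z Fin.≟ v₀))
              ≡⟨ sum-cong-≗ (λ z → pointwise z (z Fin.≟ v₀)) ⟩
            sum (λ z → ι x z ℕ.* ι z v)
              ≡⟨ interval-count v⊑x dx≡2+dv ⟩
            suc q
              ≡⟨ ℕ.+-comm 1 q ⟩
            q ℕ.+ 1 ∎)
            where
            open ≡.≡-Reasoning
            joins : Fin n → ℕ
            joins z = sum λ w → ι w z ℕ.* ι w y

            joins-other : ∀ z → z ≢ v₀ → (z⋗?v : Dec (z ⋗ v)) → x ⋗ z → joins z ≡ 𝟙 z⋗?v
            joins-other z z≢v₀ (no ¬z⋗v) x⋗z = joins-no x⋗z ¬z⋗v
            joins-other z z≢v₀ (yes z⋗v) x⋗z = fromVector (⋗⇒∃ z⋗v)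
              where
              fromVector : (∃ λ p → p ∈ₚ z × p ∉ₚ v) → joins z ≡ 1
              fromVector (p , p∈z , p∉v) = joins-yes x⋗z z⋗v p∈z p∉v (off-v₀ x⋗z z⋗v z≢v₀ p∈z p∉v)

            pointwise : ∀ z (z≟v₀ : Dec (z ≡ v₀)) → ι x z ℕ.* joins z ℕ.+ 𝟙 z≟v₀ ≡ ι x z ℕ.* ι z v
            pointwise z (no z≢v₀) = ≡.trans (ℕ.+-identityʳ _)
              (𝟙-weight (x ⋗? z) (joins-other z z≢v₀ (z ⋗? v)))
            pointwise .v₀ (yes ≡.refl) = ≡.trans
              (≡.cong₂ (λ a b → a ℕ.* b ℕ.+ 1) (ι-yes x⋗v₀)
                (∑-ι-none (_⋗? v₀) (_⋗? y) λ w w⋗v₀ w⋗y → t∉ (⋗⇒⊑ w⋗y u∈y) (⋗⇒⊑ w⋗v₀ a∈v₀)))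
              (≡.sym (≡.cong₂ ℕ._*_ (ι-yes x⋗v₀) (ι-yes v₀⋗v)))

  -- When `x` does not cover `y` the term with `ι x y` vanishes, and the counts of `UUD`, `DUU`,
  -- `UDU` are `(0 , 0 , 0)`, `(q + 1 , q + 1 , q + 1)` or `(0 , q + 1 , q)`. Each triple satisfies
  -- `UUD + q DUU = (q + 1) UDU`.
  path-relation : ∀ x y → d x ≡ suc (d y) →
    q ℕ.^ d x ℕ.* (UUD x y ℕ.+ q ℕ.* DUU x y) ℕ.+ suc q ℕ.* q ℕ.^ K ℕ.* ι x y ≡
    q ℕ.^ d x ℕ.* (suc q ℕ.* UDU x y)
  path-relation x y dx≡1+dy = byInclusion (separate y x)
    where
    Goal : Set
    Goal = q ℕ.^ d x ℕ.* (UUD x y ℕ.+ q ℕ.* DUU x y) ℕ.+ suc q ℕ.* q ℕ.^ K ℕ.* ι x y ≡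
           q ℕ.^ d x ℕ.* (suc q ℕ.* UDU x y)

    fromCounts : ∀ {a b c} → UUD x y ≡ a → DUU x y ≡ b → UDU x y ≡ c → ¬ x ⋗ y →
                 a ℕ.+ q ℕ.* b ≡ suc q ℕ.* c → Goal
    fromCounts {a} {b} {c} ea eb ec ¬x⋗y e = begin
      q ℕ.^ d x ℕ.* (UUD x y ℕ.+ q ℕ.* DUU x y) ℕ.+ suc q ℕ.* q ℕ.^ K ℕ.* ι x y
        ≡⟨ ≡.cong₂ (λ a i → q ℕ.^ d x ℕ.* a ℕ.+ suc q ℕ.* q ℕ.^ K ℕ.* i)
             (≡.cong₂ (λ a b → a ℕ.+ q ℕ.* b) ea eb) (ι-no ¬x⋗y) ⟩
      q ℕ.^ d x ℕ.* (a ℕ.+ q ℕ.* b) ℕ.+ suc q ℕ.* q ℕ.^ K ℕ.* 0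
        ≡⟨ ≡.cong₂ ℕ._+_ (≡.cong (q ℕ.^ d x ℕ.*_) e) (ℕ.*-zeroʳ (suc q ℕ.* q ℕ.^ K)) ⟩
      q ℕ.^ d x ℕ.* (suc q ℕ.* c) ℕ.+ 0
        ≡⟨ ℕ.+-identityʳ _ ⟩
      q ℕ.^ d x ℕ.* (suc q ℕ.* c)
        ≡⟨ ≡.cong (λ c → q ℕ.^ d x ℕ.* (suc q ℕ.* c)) ec ⟨
      q ℕ.^ d x ℕ.* (suc q ℕ.* UDU x y) ∎
      where open ≡.≡-Reasoning

    byJoin : ∀ {v u} → ¬ (y ⊑ x) → y ⋗ v → v ⊑ x → u ∈ₚ y → u ∉ₚ x → Dec (u ∈ Member (x +h)) → Goal
    byJoin {v} y⋢x y⋗v v⊑x u∈y u∉x (no u∉x+h) =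
      fromCounts J.UUD≡ M.DUU≡ J.UDU≡ (λ x⋗y → y⋢x (⋗⇒⊑ x⋗y)) ≡.refl
      where
      module M = Meet dx≡1+dy y⋢x {v} y⋗v v⊑x
      module J = M.Join u∈y u∉x u∉x+h
    byJoin {v} y⋢x y⋗v v⊑x u∈y u∉x (yes (i , t∈h , u+t∈x)) =
      fromCounts J.UUD≡ M.DUU≡ J.UDU≡ (λ x⋗y → y⋢x (⋗⇒⊑ x⋗y)) (ℕ.*-comm q (suc q))
      where
      module M = Meet dx≡1+dy y⋢x {v} y⋗v v⊑x
      module J = M.NoJoin u∈y u∉x {vec i} t∈h u+t∈x

    byMeet : ∀ {u} → ¬ (y ⊑ x) → u ∈ₚ y → u ∉ₚ x → Dec (∃ λ v → y ⋗ v × v ⊑ x) → Goal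
    byMeet {u} y⋢x u∈y u∉x (yes (v , y⋗v , v⊑x)) =
      byJoin y⋢x y⋗v (λ {w} → v⊑x {w}) u∈y u∉x (member? (x +h) u)
    byMeet y⋢x u∈y u∉x (no none) =
      fromCounts N.UUD≡0 N.DUU≡0 N.UDU≡0 (λ x⋗y → y⋢x (⋗⇒⊑ x⋗y)) (≡.trans (ℕ.*-zeroʳ q) (≡.sym (ℕ.*-zeroʳ (suc q))))
      where module N = NoMeet dx≡1+dy y⋢x (λ v y⋗v v⊑x → none (v , y⋗v , λ {w} → v⊑x {w}))

    byInclusion : (∃ λ u → u ∈ₚ y × u ∉ₚ x) ⊎ (y ⊑ x) → Goal
    byInclusion (inj₂ y⊑x) = path-relation-cover ((λ {_} → y⊑x) , dx≡1+dy)
    byInclusion (inj₁ (u , u∈y , u∉x)) = byMeet (λ y⊑x → u∉x (y⊑x u∈y)) u∈y u∉x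
      (Fin.any? λ v → (y ⋗? v) ×-dec (v ⊑? x))

-- Positive reals are cancellable

module Reals where

  open Cancellation ℝ-commutativeRing
  open import Algebra.Properties.Semiring.Exp (CommutativeRing.semiring ℝ-commutativeRing) using (_^_)

  *-pos : ∀ {a b} → 0ℚ ℚ.< a → 0ℚ ℚ.< b → 0ℚ ℚ.< a ℚ.* b
  *-pos {a} {b} 0<a 0<b = ≡.subst (ℚ._< a ℚ.* b) (ℚ.*-zeroʳ a) (ℚ.*-monoʳ-<-pos a {{ℚ.positive 0<a}} 0<b)

  positive-+ : ∀ {x y} → Positive x → Positive y → Positive (x +ℝ y)
  positive-+ (a , 0<a , k , f) (b , 0<b , l , g) =
    a ℚ.+ b , ≡.subst (ℚ._< a ℚ.+ b) (ℚ.+-identityˡ 0ℚ) (ℚ.+-mono-< 0<a 0<b) , k ℕ.⊔ l ,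
    λ n k⊔l≤n → ℚ.+-mono-≤ (f n (ℕ.m⊔n≤o⇒m≤o k l k⊔l≤n)) (g n (ℕ.m⊔n≤o⇒n≤o k l k⊔l≤n))

  positive-* : ∀ {x y} → Positive x → Positive y → Positive (x *ℝ y)
  positive-* {x} {y} (a , 0<a , k , f) (b , 0<b , l , g) =
    a ℚ.* b , *-pos 0<a 0<b , k ℕ.⊔ l , λ n k⊔l≤n →
      let a≤x = f n (ℕ.m⊔n≤o⇒m≤o k l k⊔l≤n) in ℚ.≤-trans
      (ℚ.*-monoˡ-≤-nonNeg a {{ℚ.pos⇒nonNeg a {{ℚ.positive 0<a}}}} (g n (ℕ.m⊔n≤o⇒n≤o k l k⊔l≤n)))
      (ℚ.*-monoʳ-≤-nonNeg (ℝ.seq y n)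
        {{ℚ.nonNegative (ℚ.≤-trans (ℚ.<⇒≤ 0<b) (g n (ℕ.m⊔n≤o⇒n≤o k l k⊔l≤n)))}} a≤x)

  positive-^ : ∀ {x} → Positive x → ∀ k → Positive (x ^ k)
  positive-^ px zero    = 1ℚ , ℚ.positive⁻¹ 1ℚ , 0 , λ _ _ → ℚ.≤-refl
  positive-^ {x} px (suc k) = positive-* {x} {x ^ k} px (positive-^ px k)

  -- With `a` a positive rational lower bound of `x`, the terms far out satisfy
  -- `a |z| ≤ |x z| < a ε`, and dividing by `a` bounds `|z|` by `ε`.
  positive⇒cancellable : ∀ {x} → Positive x → Cancellable x
  positive⇒cancellable {x} (a , 0<a , k , f) z (mk≈ xz~0) = mk≈ (lim bound)
    where
    instance
      a-positive : ℚ.Positive a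
      a-positive = ℚ.positive 0<a

    bound : ∀ ε → 0ℚ ℚ.< ε → ∃ λ k → ∀ m n → k ℕ.≤ m → k ℕ.≤ n → ℚ.∣ ℝ.seq z m ℚ.- 0ℚ ∣ ℚ.< ε
    bound ε 0<ε = k ℕ.⊔ l , λ m n k⊔l≤m k⊔l≤n → estimate m
      (f m (ℕ.m⊔n≤o⇒m≤o k l k⊔l≤m)) (g m n (ℕ.m⊔n≤o⇒n≤o k l k⊔l≤m) (ℕ.m⊔n≤o⇒n≤o k l k⊔l≤n))
      where
      small = _~_.unlim xz~0 (a ℚ.* ε) (*-pos 0<a 0<ε)
      l = proj₁ small
      g = proj₂ small

      estimate : ∀ m → a ℚ.≤ ℝ.seq x m → ℚ.∣ ℝ.seq x m ℚ.* ℝ.seq z m ℚ.- 0ℚ ∣ ℚ.< a ℚ.* ε → ℚ.∣ ℝ.seq z m ℚ.- 0ℚ ∣ ℚ.< ε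
      estimate m a≤x xz<aε = ≡.subst (λ p → ℚ.∣ p ∣ ℚ.< ε) (≡.sym (ℚ.+-identityʳ (ℝ.seq z m)))
        (ℚ.*-cancelˡ-<-nonNeg a {{ℚ.pos⇒nonNeg a}} (ℚ.≤-<-trans
          (ℚ.*-monoʳ-≤-nonNeg ℚ.∣ ℝ.seq z m ∣ {{ℚ.∣-∣-nonNeg (ℝ.seq z m)}} a≤∣x∣)
          (≡.subst (ℚ._< a ℚ.* ε) ∣xz-0∣≡ xz<aε)))
        where
        a≤∣x∣ : a ℚ.≤ ℚ.∣ ℝ.seq x m ∣
        a≤∣x∣ = ≡.subst (a ℚ.≤_) (≡.sym (ℚ.0≤p⇒∣p∣≡p (ℚ.≤-trans (ℚ.<⇒≤ 0<a) a≤x))) a≤x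

        ∣xz-0∣≡ : ℚ.∣ ℝ.seq x m ℚ.* ℝ.seq z m ℚ.- 0ℚ ∣ ≡ ℚ.∣ ℝ.seq x m ∣ ℚ.* ℚ.∣ ℝ.seq z m ∣
        ∣xz-0∣≡ = ≡.trans (≡.cong ℚ.∣_∣ (ℚ.+-identityʳ _)) (ℚ.∣p*q∣≡∣p∣*∣q∣ (ℝ.seq x m) (ℝ.seq z m))

  power-sum-cancellable : ∀ {x} → Positive x → ∀ i j → Cancellable (x ^ i +ℝ x ^ j)
  power-sum-cancellable {x} x>0 i j = positive⇒cancellable {x ^ i +ℝ x ^ j}
    (positive-+ {x ^ i} {x ^ j} (positive-^ {x} x>0 i) (positive-^ {x} x>0 j))

  fromℚ-+ : ∀ p r → fromℚ (p ℚ.+ r) ≈ℝ fromℚ p +ℝ fromℚ r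
  fromℚ-+ p r = mk≈ (ℝ.cauchy (fromℚ (p ℚ.+ r)))

  fromℚ-* : ∀ p r → fromℚ (p ℚ.* r) ≈ℝ fromℚ p *ℝ fromℚ r
  fromℚ-* p r = mk≈ (ℝ.cauchy (fromℚ (p ℚ.* r)))

-- Real scalars among the complex ones

module RealEmbedding (R : CommutativeRing 0ℓ 0ℓ) where

  open AdjoinI R using (real; commutativeRing; _+i_)
  private
    module R = CommutativeRing R
    module C = CommutativeRing commutativeRing
  open import Algebra.Properties.Ring R.ring using (-0#≈0#)
  open import Algebra.Properties.Semiring.Exp R.semiring renaming (_^_ to _^ᴿ_) using ()
  open import Algebra.Properties.Semiring.Exp C.semiring using (_^_)

  real-cong : ∀ {x y} → x R.≈ y → real x C.≈ real y
  real-cong e = e +i R.refl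

  real-+ : ∀ x y → real (x R.+ y) C.≈ real x C.+ real y
  real-+ x y = R.refl +i R.sym (R.+-identityˡ R.0#)

  real-neg : ∀ x → real (R.- x) C.≈ C.- real x
  real-neg x = R.refl +i R.sym -0#≈0#

  real-* : ∀ x y → real (x R.* y) C.≈ real x C.* real y
  real-* x y =
    R.sym (R.trans (R.+-congˡ (R.trans (R.-‿cong (R.zeroˡ R.0#)) -0#≈0#)) (R.+-identityʳ _)) +i
    R.sym (R.trans (R.+-cong (R.zeroʳ x) (R.zeroˡ y)) (R.+-identityˡ R.0#))

  real-^ : ∀ x k → real (x ^ᴿ k) C.≈ real x ^ k
  real-^ x zero    = C.refl
  real-^ x (suc k) = C.trans (real-* x (x ^ᴿ k)) (C.*-congˡ (real-^ x k))

  -- A real factor acts on the real and the imaginary part separately.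
  real-cancellable : ∀ {x} → Cancellation.Cancellable R x → Cancellation.Cancellable commutativeRing (real x)
  real-cancellable {x} cx (a +i b) (re≈ +i im≈) =
    cx a (R.trans (R.sym (R.trans (R.+-congˡ (R.trans (R.-‿cong (R.zeroˡ b)) -0#≈0#)) (R.+-identityʳ _))) re≈) +i
    cx b (R.trans (R.sym (R.trans (R.+-congˡ (R.zeroˡ a)) (R.+-identityʳ _))) im≈)

-- From the relation to the vanishing of the product

module Assembly
  (R : CommutativeRing 0ℓ 0ℓ) (ρ : ℚ → CommutativeRing.Carrier R)
  (ρ-0 : CommutativeRing._≈_ R (ρ 0ℚ) (CommutativeRing.0# R))
  (ρ-1 : CommutativeRing._≈_ R (ρ 1ℚ) (CommutativeRing.1# R))
  (ρ-+ : ∀ p r → CommutativeRing._≈_ R (ρ (p ℚ.+ r)) (CommutativeRing._+_ R (ρ p) (ρ r)))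
  (ρ-* : ∀ p r → CommutativeRing._≈_ R (ρ (p ℚ.* r)) (CommutativeRing._*_ R (ρ p) (ρ r)))
  where

  private
    module R = CommutativeRing R
    C-commutativeRing = AdjoinI.commutativeRing R
    module C = CommutativeRing C-commutativeRing

  open RealEmbedding R
  open Fractions
  open Cancellation C-commutativeRing
  open MatrixAction C-commutativeRing
    using (δ; ·-δ; ·-cong; sum-diagonal; left-eigen; Eigenvector; Complementary; _·ᵛ_; _≋ᵛ_)
  open import Algebra.Properties.Semiring.Sum C.semiring using (sum; sum-cong-≋)
  open import Algebra.Properties.Semiring.Exp C.semiring using (_^_)
  open import Algebra.Properties.Semiring.Exp R.semiring using () renaming (_^_ to _^ᴿ_)

  real : R.Carrier → C.Carrier
  real = AdjoinI.real R

  rational : ℚ → C.Carrier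
  rational p = real (ρ p)

  rational-+ : ∀ {s} p r → s ≡ p ℚ.+ r → rational s C.≈ rational p C.+ rational r
  rational-+ p r ≡.refl = C.trans (real-cong (ρ-+ p r)) (real-+ (ρ p) (ρ r))

  rational-* : ∀ {s} p r → s ≡ p ℚ.* r → rational s C.≈ rational p C.* rational r
  rational-* p r ≡.refl = C.trans (real-cong (ρ-* p r)) (real-* (ρ p) (ρ r))

  φ : ℕ → C.Carrier
  φ m = rational (+ m ℚ./ 1)

  φ-0 : φ 0 C.≈ C.0#
  φ-0 = real-cong ρ-0

  φ-1 : φ 1 C.≈ C.1#
  φ-1 = real-cong ρ-1

  φ-+ : ∀ m k → φ (m ℕ.+ k) C.≈ φ m C.+ φ k
  φ-+ m k = rational-+ (+ m ℚ./ 1) (+ k ℚ./ 1) (ℕ/1-+ m k)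

  φ-* : ∀ m k → φ (m ℕ.* k) C.≈ φ m C.* φ k
  φ-* m k = rational-* (+ m ℚ./ 1) (+ k ℚ./ 1) (ℕ/1-* m k)

  φ⁻¹ : ∀ m .{{_ : NonZero m}} → C.Carrier
  φ⁻¹ m = rational (+ 1 ℚ./ m)

  φ⁻¹-inverse : ∀ m .{{_ : NonZero m}} → φ⁻¹ m C.* φ m C.≈ C.1#
  φ⁻¹-inverse m = C.trans (C.sym (rational-* (+ 1 ℚ./ m) (+ m ℚ./ 1) (≡.sym (reciprocal m)))) (real-cong ρ-1)

  φ-cancellable : ∀ m .{{_ : NonZero m}} → Cancellable (φ m)
  φ-cancellable m = cancellable-factor
    (cancellable-cong (C.sym (C.trans (C.*-comm (φ m) (φ⁻¹ m)) (φ⁻¹-inverse m))) cancellable-1)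

  module Main
    {q} (F : FiniteField q) (N M : ℕ) (H : VectorSpace F)
    (dimH : Subspaces.HasDimension F H (N ℕ.+ M)) (h : Subspaces.Subspace F H)
    {n} (X : Enumeration (Subspaces.pointSetoid F H h) n)
    (√q : R.Carrier) (√q*√q≈q : √q R.* √q R.≈ ρ (+ q ℚ./ 1))
    (√q-sum-cancellable : ∀ i j → Cancellation.Cancellable R (√q ^ᴿ i R.+ √q ^ᴿ j))
    where

    private instance
      q-nonZero : NonZero q
      q-nonZero = q≢0 F

      q-1-nonZero : NonZero (q ℕ.∸ 1)
      q-1-nonZero = q-1≢0 F

    module Space = AttenuatedSpace F H dimH h X
    module Paths = PathCounts F H dimH h X

    a : ℕ → C.Carrier
    a k = φ⁻¹ (q ℕ.^ k) {{ℕ.m^n≢0 q k}}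

    a-suc : ∀ k → φ q C.* a (suc k) C.≈ a k
    a-suc k = cancel (φ-cancellable (q ℕ.^ k) {{ℕ.m^n≢0 q k}}) (begin
      φ (q ℕ.^ k) C.* (φ q C.* a (suc k))    ≈⟨ C.*-assoc (φ (q ℕ.^ k)) (φ q) (a (suc k)) ⟨
      φ (q ℕ.^ k) C.* φ q C.* a (suc k)      ≈⟨ C.*-congʳ (C.trans (C.*-comm (φ (q ℕ.^ k)) (φ q)) (C.sym (φ-* q (q ℕ.^ k)))) ⟩
      φ (q ℕ.^ suc k) C.* a (suc k)          ≈⟨ C.*-comm (φ (q ℕ.^ suc k)) (a (suc k)) ⟩
      a (suc k) C.* φ (q ℕ.^ suc k)          ≈⟨ φ⁻¹-inverse (q ℕ.^ suc k) {{ℕ.m^n≢0 q (suc k)}} ⟩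
      C.1#                                   ≈⟨ φ⁻¹-inverse (q ℕ.^ k) {{ℕ.m^n≢0 q k}} ⟨
      a k C.* φ (q ℕ.^ k)                    ≈⟨ C.*-comm (a k) (φ (q ℕ.^ k)) ⟩
      φ (q ℕ.^ k) C.* a k                    ∎)
      where open SetoidReasoning C.setoid

    cov : Fin n → Fin n → Bool
    cov z y = does (z Space.⋗? y)

    cov-d : ∀ z y → cov z y ≡ true → Space.d z ≡ suc (Space.d y)
    cov-d z y = proof (z Space.⋗? y)
      where
      proof : ∀ (z⋗y? : Dec (z Space.⋗ y)) → does z⋗y? ≡ true → Space.d z ≡ suc (Space.d y)
      proof (yes z⋗y) _ = Space.⋗⇒d z⋗y

    module Weighted = OverRing.WeightedAdjacency C-commutativeRing
      φ φ-0 φ-1 φ-+ φ-* q (q ℕ.^ (N ℕ.+ M)) Space.d cov cov-d a a-suc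

    relation : ∀ x y → Weighted.Relation x y
    relation = Weighted.relation Paths.path-relation (φ-cancellable q)

    σ : C.Carrier
    σ = real √q

    σ-sum-cancellable : ∀ i j → Cancellable (σ ^ i C.+ σ ^ j)
    σ-sum-cancellable i j = cancellable-cong
      (C.trans (real-+ (√q ^ᴿ i) (√q ^ᴿ j)) (C.+-cong (real-^ √q i) (real-^ √q j)))
      (real-cancellable (√q-sum-cancellable i j))

    module Eigen = Spectrum.Eigenvalues C-commutativeRing φ φ-1 φ-+ φ-* (λ k → φ-cancellable (suc k))
      q N M (1<q F) σ (C.trans (C.sym (real-* √q √q)) (real-cong √q*√q≈q)) σ-sum-cancellable
      (φ⁻¹ (q ℕ.∸ 1)) (φ⁻¹-inverse (q ℕ.∸ 1))

    θᶜ : HalfIntegers N → C.Carrier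
    θᶜ k = real (ρ (+ 1 ℚ./ (q ℕ.∸ 1)) R.* (√q ^ᴿ (2 ℕ.* N ℕ.∸ toℕ k) R.+ R.- (√q ^ᴿ toℕ k)) R.* √q ^ᴿ M)

    θ≈ : ∀ k → θᶜ k C.≈ Eigen.θ (toℕ k)
    θ≈ k = begin
      real (c₀ R.* (p R.+ R.- r) R.* m)
        ≈⟨ C.trans (real-* (c₀ R.* (p R.+ R.- r)) m) (C.*-congʳ (real-* c₀ (p R.+ R.- r))) ⟩
      real c₀ C.* real (p R.+ R.- r) C.* real m
        ≈⟨ C.*-cong (C.*-congˡ (C.trans (real-+ p (R.- r)) (C.+-cong (real-^ √q i)
             (C.trans (real-neg r) (C.-‿cong (real-^ √q (toℕ k))))))) (real-^ √q M) ⟩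
      Eigen.θ (toℕ k) ∎
      where
      open SetoidReasoning C.setoid
      i  = 2 ℕ.* N ℕ.∸ toℕ k
      c₀ = ρ (+ 1 ℚ./ (q ℕ.∸ 1))
      p  = √q ^ᴿ i
      r  = √q ^ᴿ toℕ k
      m  = √q ^ᴿ M

    -- The complex operations enter as parameters with laws, since comparing nested products of
    -- concrete matrices would unfold the proofs that sequences are Cauchy.
    module _
      (_✶_ : C.Carrier → C.Carrier → C.Carrier) (✶≈* : ∀ w z → w ✶ z C.≈ w C.* z)
      (∑ : ∀ {m} → (Fin m → C.Carrier) → C.Carrier) (∑≈sum : ∀ {m} (f : Fin m → C.Carrier) → ∑ f C.≈ sum f)
      (_⊙_ : (Fin n → Fin n → C.Carrier) → (Fin n → C.Carrier) → Fin n → C.Carrier)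
      (⊙≈· : ∀ A v x → (A ⊙ v) x C.≈ (A ·ᵛ v) x)
      (_⊗_ : (Fin n → Fin n → C.Carrier) → (Fin n → Fin n → C.Carrier) → Fin n → Fin n → C.Carrier)
      (⊗≈ : ∀ A B x z → (A ⊗ B) x z C.≈ sum λ y → A x y C.* B y z)
      (A A* : Fin n → Fin n → C.Carrier)
      (A≈ : ∀ y z → A y z C.≈ Weighted.A y z)
      (A*≈ : ∀ y z → A* y z C.≈ (if does (y Fin.≟ z) then a (Space.d y) else C.0#))
      (ϑ : HalfIntegers N → C.Carrier) (ϑ≈ : ∀ k → ϑ k C.≈ θᶜ k)
      (E : HalfIntegers N → Fin n → Fin n → C.Carrier)
      (into        : ∀ i v x → (A ⊙ (E i ⊙ v)) x C.≈ ϑ i ✶ (E i ⊙ v) x)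
      (identity    : ∀ i v → (∀ x → (A ⊙ v) x C.≈ ϑ i ✶ v x) → ∀ x → (E i ⊙ v) x C.≈ v x)
      (annihilates : ∀ i v (w : HalfIntegers N → Fin n → C.Carrier) →
                     (∀ k x → (A ⊙ w k) x C.≈ ϑ k ✶ w k x) → (∀ x → w i x C.≈ C.0#) →
                     (∀ x → v x C.≈ ∑ λ k → w k x) → ∀ x → (E i ⊙ v) x C.≈ C.0#)
      (kernel⊆     : ∀ i v → (∀ x → (E i ⊙ v) x C.≈ C.0#) →
                     ∃ λ (w : HalfIntegers N → Fin n → C.Carrier) →
                       (∀ k x → (A ⊙ w k) x C.≈ ϑ k ✶ w k x) × (∀ x → w i x C.≈ C.0#) ×
                       (∀ x → v x C.≈ ∑ λ k → w k x))
      where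

      private
        into′ : ∀ i v → Eigenvector A ϑ i (E i ·ᵛ v)
        into′ i v x = begin
          (A ·ᵛ E i ·ᵛ v) x     ≈⟨ ·-cong A (⊙≈· (E i) v) x ⟨
          (A ·ᵛ (E i ⊙ v)) x    ≈⟨ ⊙≈· A (E i ⊙ v) x ⟨
          (A ⊙ (E i ⊙ v)) x     ≈⟨ into i v x ⟩
          ϑ i ✶ (E i ⊙ v) x     ≈⟨ ✶≈* (ϑ i) _ ⟩
          ϑ i C.* (E i ⊙ v) x   ≈⟨ C.*-congˡ (⊙≈· (E i) v x) ⟩
          ϑ i C.* (E i ·ᵛ v) x  ∎
          where open SetoidReasoning C.setoid

        eigen⇐ : ∀ {k v} → Eigenvector A ϑ k v → ∀ x → (A ⊙ v) x C.≈ ϑ k ✶ v x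
        eigen⇐ {k} {v} e x = C.trans (⊙≈· A v x) (C.trans (e x) (C.sym (✶≈* (ϑ k) (v x))))

        eigen⇒ : ∀ {k v} → (∀ x → (A ⊙ v) x C.≈ ϑ k ✶ v x) → Eigenvector A ϑ k v
        eigen⇒ {k} {v} e x = C.trans (C.sym (⊙≈· A v x)) (C.trans (e x) (✶≈* (ϑ k) (v x)))

        identity′ : ∀ i v → Eigenvector A ϑ i v → E i ·ᵛ v ≋ᵛ v
        identity′ i v e x = C.trans (C.sym (⊙≈· (E i) v x)) (identity i v (eigen⇐ e) x)

        annihilates′ : ∀ i v → Complementary A ϑ i v → E i ·ᵛ v ≋ᵛ λ _ → C.0#
        annihilates′ i v (w , eigen , w≈0 , v≈) x = C.trans (C.sym (⊙≈· (E i) v x))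
          (annihilates i v w (λ k → eigen⇐ (eigen k)) w≈0 (λ y → C.trans (v≈ y) (C.sym (∑≈sum λ k → w k y))) x)

        kernel⊆′ : ∀ i v → E i ·ᵛ v ≋ᵛ (λ _ → C.0#) → Complementary A ϑ i v
        kernel⊆′ i v Ev≈0 = let w , eigen , w≈0 , v≈ = kernel⊆ i v (λ x → C.trans (⊙≈· (E i) v x) (Ev≈0 x)) in
          w , (λ k → eigen⇒ (eigen k)) , w≈0 , λ y → C.trans (v≈ y) (∑≈sum λ k → w k y)

      -- Evaluating `left-eigen` on the unit vector `δ z` reads off one entry of the identity
      -- `E A = θ E`.
      row : ∀ i x z → sum (λ y → E i x y C.* Weighted.A y z) C.≈ Eigen.θ (toℕ i) C.* E i x z
      row i x z = begin
        sum (λ y → E i x y C.* Weighted.A y z)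
          ≈⟨ ·-cong (E i) (λ y → C.trans (·-δ A y z) (A≈ y z)) x ⟨
        (E i ·ᵛ A ·ᵛ δ z) x
          ≈⟨ left-eigen A ϑ i (E i) (into′ i) (identity′ i) (annihilates′ i) (kernel⊆′ i) (δ z) x ⟩
        ϑ i C.* (E i ·ᵛ δ z) x
          ≈⟨ C.*-cong (C.trans (ϑ≈ i) (θ≈ i)) (·-δ (E i) x z) ⟩
        Eigen.θ (toℕ i) C.* E i x z ∎
        where open SetoidReasoning C.setoid

      column : ∀ j y x → Weighted.apply (λ z → E j z y) x C.≈ Eigen.θ (toℕ j) C.* E j x y
      column j y x = begin
        sum (λ z → Weighted.A x z C.* E j z y)
          ≈⟨ sum-cong-≋ (λ z → C.*-cong (A≈ x z) (·-δ (E j) z y)) ⟨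
        (A ·ᵛ E j ·ᵛ δ y) x              ≈⟨ into′ j (δ y) x ⟩
        ϑ j C.* (E j ·ᵛ δ y) x           ≈⟨ C.*-cong (C.trans (ϑ≈ j) (θ≈ j)) (·-δ (E j) x y) ⟩
        Eigen.θ (toℕ j) C.* E j x y      ∎
        where open SetoidReasoning C.setoid

      -- As `A*` is diagonal, an entry of the product pairs a row of `E i` with `A*` applied to a
      -- column of `E j`. These are a left and a right eigenvector of `A`, so `eigenvalue-relation`
      -- applies and the scalar can be cancelled.
      vanishing : ∀ i j → value {N} i ℚ.- value {N} j ∉ (1ℚ ∷ 0ℚ ∷ ℚ.- 1ℚ ∷ []) →
        ∀ x y → ((E i ⊗ A*) ⊗ E j) x y C.≈ C.0#
      vanishing i j i-j∉ x y = begin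
        ((E i ⊗ A*) ⊗ E j) x y
          ≈⟨ C.trans (⊗≈ (E i ⊗ A*) (E j) x y) (sum-cong-≋ λ w → C.*-congʳ (⊗≈ (E i) A* x w)) ⟩
        sum (λ w → sum (λ z → E i x z C.* A* z w) C.* E j w y)
          ≈⟨ sum-cong-≋ (λ w → C.trans (C.*-congʳ (C.trans (sum-cong-≋ λ z → C.*-congˡ (A*≈ z w))
               (sum-diagonal (E i x) (λ z → a (Space.d z)) w))) (C.*-assoc (E i x w) (a (Space.d w)) (E j w y))) ⟩
        sum (λ w → E i x w C.* (a (Space.d w) C.* E j w y))
          ≈⟨ Eigen.eigenvalue-separation (toℕ i) (toℕ j) (ℕ.≤-pred (Fin.toℕ<n i)) (ℕ.≤-pred (Fin.toℕ<n j))
               i≢j i≢j+1 j≢i+1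
               (Weighted.eigenvalue-relation relation {E i x} {λ w → E j w y} (row i x) (column j y)) ⟩
        C.0# ∎
        where
        open SetoidReasoning C.setoid

        i≢j : toℕ i ≢ toℕ j
        i≢j e = i-j∉ (there (here (≡.trans (≡.cong (λ k → + k ℚ./ 2 ℚ.- value {N} j) e) (ℚ.+-inverseʳ (value {N} j)))))

        i≢j+1 : toℕ i ≢ 2 ℕ.+ toℕ j
        i≢j+1 e = i-j∉ (here (≡.trans (≡.cong (λ k → + k ℚ./ 2 ℚ.- value {N} j) e)
          (≡.trans (≡.cong (ℚ._- value {N} j) (half-shift (toℕ j))) (1+p-p≡1 (value {N} j)))))

        j≢i+1 : toℕ j ≢ 2 ℕ.+ toℕ i
        j≢i+1 e = i-j∉ (there (there (here (≡.trans (≡.cong (λ k → value {N} i ℚ.- + k ℚ./ 2) e)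
          (≡.trans (≡.cong (λ p → value {N} i ℚ.- p) (half-shift (toℕ i))) (p-[1+p]≡-1 (value {N} i)))))))

open import Defs using (θ)
open import Data.Nat.Base using (_+_)
open import Data.Rational.Base using (_/_; _-_; -_)
open Subspaces using (HasDimension; Subspace; pointSetoid; A; A*)
open Subspace using (dim)

proposition10p1 : ∀ {q} (F : FiniteField q) (N M : ℕ) .{{_ : NonZero N}} .{{_ : NonZero M}} →
    (H : VectorSpace F) → HasDimension F H (N + M) →
    (h : Subspace F H) → dim h ≡ M →
    ∀ {n} (X : Enumeration (pointSetoid F H h) n) →
    (√q : ℝ) → Positive √q → √q *ℝ √q ≈ℝ fromℚ (+ q / 1) →
    (E : HalfIntegers N → Matrix n) →
    (∀ i → IsPrimitiveIdempotent (A F H h X) (θ F √q N M) i (E i)) →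
    ∀ i j → value {N} i - value {N} j ∉ (1ℚ ∷ 0ℚ ∷ - 1ℚ ∷ []) →
    E i · A* F H h X · E j ≋ 0ₘ
proposition10p1 F N M H dimH h _ X √q √q>0 √q*√q≈q E idempotent i j i-j∉ x y =
  Assembly.Main.vanishing ℝ-commutativeRing fromℚ R.refl R.refl fromℚ-+ fromℚ-*
    F N M H dimH h X √q (mk≈ (_≈ℝ_.un≈ √q*√q≈q))
    (λ i j y e → power-sum-cancellable {√q} √q>0 i j y (mk≈ (_≈ℝ_.un≈ e)))
    ℂ._*_ (λ _ _ → ℂ.refl) sum (λ _ → ℂ.refl) _·ᵥ_ (λ _ _ _ → ℂ.refl) _·_ (λ _ _ _ _ → ℂ.refl)
    (A F H h X) (A* F H h X) (λ _ _ → ℂ.refl) (λ _ _ → ℂ.refl)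
    (θ F √q N M) (λ k → fromSequences (sequences (ℂ.refl {θ F √q N M k}))) E
    (λ i → IsProjection.into (idempotent i))
    (λ i v eigen → IsProjection.identity (idempotent i) v (λ x → eigen x))
    (λ i v w eigen w≈0 v≈ → IsProjection.annihilates (idempotent i) v
      (w , (λ k x → eigen k x) , (λ x → w≈0 x) , (λ x → v≈ x)))
    (λ i v Ev≈0 → IsProjection.kernel⊆ (idempotent i) v (λ x → Ev≈0 x))
    i j i-j∉ x y
  where
  open Reals
  open import Algebra.Properties.CommutativeMonoid.Sum ℂ.+-commutativeMonoid using (sum)
  module R = CommutativeRing ℝ-commutativeRing
  open AdjoinI.Complex
  open AdjoinI._≈_

  -- Definitionally equal reals are compared through their sequences, so that
  -- the type checker does not unfold the proofs that these are Cauchy.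
  sequences : ∀ {w z} → w ℂ.≈ z → ℝ.seq (re w) ~ ℝ.seq (re z) × ℝ.seq (im w) ~ ℝ.seq (im z)
  sequences e = _≈ℝ_.un≈ (re≈ e) , _≈ℝ_.un≈ (im≈ e)

  fromSequences : ∀ {w z} → ℝ.seq (re w) ~ ℝ.seq (re z) × ℝ.seq (im w) ~ ℝ.seq (im z) → w ℂ.≈ z
  fromSequences (p , r) = mk≈ p AdjoinI.+i mk≈ r
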